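{- Let $\mathfrak{R}=\mathbb{C}[a,b,c,d,e,f]^H$ be the invariant ring of the group $H\subset GL(6,\mathbb{C})$ given in the context. Then the symmetrized weight enumerators $\mathscr{W}_{(\mathscr{E}_8,\mathscr{Q}_8)}$ and $\mathscr{W}_{(\mathscr{E}_8,\mathscr{K}_8)}$ form a basis of the $\mathbb{C}$-vector space of homogeneous elements of degree 8 of $\mathfrak{R}$.
   Context: **The group.** Let $i=\sqrt{ -1}$ and $z=e^{2\pi i/8}$. The group $H=\langle X,P_1,P_2,E_1,E_2,zI_6\rangle\subset GL(6,\mathbb{C})$ is generated by the following matrices (rows and columns indexed in order by the variables $a,b,c,d,e,f$): $$X=\frac{z^3+z}{4}\begin{pmatrix}1&2&1&1&2&1\\1&0&-1&1&0&-1\\1&-2&1&1&-2&1\\1&2&1&-1&-2&-1\\1&0&-1&-1&0&1\\1&-2&1&-1&2&-1\end{pmatrix},$$ $$P_1=\begin{pmatrix}1&0&0&0&0&0\\0&0&0&0&1&0\\0&0&1&0&0&0\\0&0&0&1&0&0\\0&1&0&0&0&0\\0&0&0&0&0&1\end{pmatrix},\qquad P_2=z^2\begin{pmatrix}1&0&0&0&0&0\\0&0&0&0&1&0\\0&0&1&0&0&0\\0&0&0&0&0&1\\0&1&0&0&0&0\\0&0&0&1&0&0\end{pmatrix},$$ $$E_1=\mathrm{diag}(1,z,-1,z^2,-z^3,-z^2),\qquad E_2=\mathrm{diag}(1,z,-1,1,z,-1),$$ and $zI_6$, where $I_6$ is the identity matrix. A matrix $A=(A_{ij})\in GL(6,\mathbb{C})$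 acts on a polynomial $f(x_1,\dots,x_6)$, where $(x_1,\dots,x_6)=(a,b,c,d,e,f)$, by $A\cdot f(x_1,\dots,x_6)=f\left(\sum_j A_{1j}x_j,\dots,\sum_j A_{6j}x_j\right)$. The invariant ring $\mathbb{C}[a,b,c,d,e,f]^H$ consists of the polynomials fixed by every element of $H$, graded by total degree. **Symmetrized weight enumerators.** A linear code of length $n$ over $\mathbb{F}_2=\mathbb{Z}/2\mathbb{Z}$ (resp. $\mathbb{Z}_4=\mathbb{Z}/4\mathbb{Z}$) is an additive subgroup of $\mathbb{F}_2^n$ (resp. $\mathbb{Z}_4^n$); the rows of a generator matrix generate it as an additive group. Let $R=\mathbb{F}_2\times\mathbb{Z}_4$ and let $\bar R$ be the quotient of $R$ by the relation $r\sim s\Leftrightarrow r=s$ or $r=-s$. It has six classes, with representatives $(0,0),(0,1),(0,2),(1,0),(1,1),(1,2)$, to which the variables $a,b,c,d,e,f$ are attached in this order (so $(0,3)\sim(0,1)$ gets $b$ and $(1,3)\sim(1,1)$ gets $e$). Denote by $x_{\bar r}$ the variable attached to the class $\bar r$. For linear codes $\mathscr{C}_1\subset\mathbb{F}_2^n$ and $\mathscr{C}_2\subset\mathbb{Z}_4^n$, $$\mathscr{W}_{(\mathscr{C}_1,\mathscr{C}_2)}=\sum_{u\in\mathscr{C}_1,\,v\in\mathscr{C}_2}\ \prod_{\bar r\in\bar R}x_{\bar r}^{\,n_{\bar r}(u,v)},$$ where $n_{\bar r}(u,v)$ is the number of coordinates $j\in\{1,\dots,n\}$ with $\overline{(u_j,v_j)}=\bar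 r$. **The codes.** $\mathscr{E}_8\subset\mathbb{F}_2^8$ and $\mathscr{Q}_8,\mathscr{K}_8\subset\mathbb{Z}_4^8$ are the linear codes with generator matrices $$\mathscr{E}_8:\begin{pmatrix}1&1&1&1&0&0&0&0\\0&0&1&1&1&1&0&0\\0&0&0&0&1&1&1&1\\1&0&1&0&1&0&1&0\end{pmatrix},\quad \mathscr{Q}_8:\begin{pmatrix}0&0&1&1&0&2&1&3\\0&0&0&2&1&3&1&1\\1&1&0&2&0&0&1&3\\0&2&0&2&0&2&0&2\\0&0&0&0&0&0&2&2\end{pmatrix},$$ $$\mathscr{K}_8:\begin{pmatrix}1&1&1&1&1&1&1&1\\0&2&0&0&0&0&0&2\\0&0&2&0&0&0&0&2\\0&0&0&2&0&0&0&2\\0&0&0&0&2&0&0&2\\0&0&0&0&0&2&0&2\\0&0&0&0&0&0&2&2\end{pmatrix}.$$ -}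

module Defs where

open import Algebra.Bundles using (CommutativeRing; Semiring)
open import Algebra.Bundles.Raw using (RawSemiring)
open import Algebra.Module.Bundles.Raw using (RawLeftModule)
import Algebra.Consequences.Setoid
import Algebra.Definitions.RawMonoid
import Algebra.Definitions.RawSemiring
open import Algebra.Structures using (IsCommutativeRing)
open import Data.Bool.Base using (if_then_else_)
open import Data.Fin.Base using (Fin; toℕ)
open import Data.Fin.Patterns using (0F; 1F; 2F; 3F; 4F; 5F)
import Data.Fin.Properties as Fin
open import Data.Integer.Base as ℤ using (ℤ; +_; -[1+_]; 0ℤ; 1ℤ; -1ℤ)
import Data.Integer.Properties as ℤ
import Data.Integer.Solver as ℤ
open import Data.List.Base using (List; []; _∷_; _++_; map; concatMap; filter; cartesianProduct; cartesianProductWith; allFin)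
open import Data.List.Membership.Propositional using (_∈_; lose; find)
open import Data.List.Membership.Propositional.Properties using (∈-cartesianProductWith⁺; ∈-allFin)
open import Data.List.Relation.Unary.Any using (here; any?)
open import Data.Nat.Base as ℕ using (ℕ; zero; suc)
open import Data.Nat.DivMod using (_mod_; _%_; m<n⇒m%n≡m; n%n≡0; %-distribˡ-+; %-distribˡ-*)
import Data.Nat.Properties as ℕ
import Data.Nat.Solver as ℕ
open import Data.Product.Base using (∃; _×_; _,_)
open import Data.Product.Properties using () renaming (≡-dec to ×-≡-dec)
open import Data.Rational.Base as ℚ using (ℚ; 0ℚ; 1ℚ; ½; ∣_∣)
import Data.Rational.Properties as ℚ
import Data.Rational.Solver as ℚ
import Data.Rational.Unnormalised.Base as ℚᵘ
import Data.Rational.Unnormalised.Properties as ℚᵘ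
open import Data.Sum.Base using (_⊎_; inj₁; inj₂)
open import Data.Vec.Base as Vec using (Vec; []; _∷_; lookup; replicate; zipWith; zip; count)
import Data.Vec.Properties as Vec
open import Level using (0ℓ; _⊔_)
open import Relation.Binary.Bundles using (Setoid)
open import Relation.Binary.PropositionalEquality using (_≡_; _≢_; refl; sym; trans; cong; cong₂; subst; subst₂; module ≡-Reasoning)
open import Relation.Nullary using (Dec; yes; no; does)
open import Relation.Nullary.Decidable using (map′; _⊎-dec_)
open import Relation.Unary using (Pred; Decidable)

------------------------------------------------------------------------
-- The real numbers: Cauchy sequences of rationals, where x ≃ y means
-- that the difference of the two sequences tends to 0.

Null : (ℕ → ℚ) → Set
Null f = ∀ ε → 0ℚ ℚ.< ε → ∃ λ N → ∀ n → N ℕ.≤ n → ∣ f n ∣ ℚ.< ε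

Cauchy : (ℕ → ℚ) → Set
Cauchy f = ∀ ε → 0ℚ ℚ.< ε →
  ∃ λ N → ∀ m n → N ℕ.≤ m → N ℕ.≤ n → ∣ f m ℚ.- f n ∣ ℚ.< ε

record ℝ : Set where
  no-eta-equality
  field
    seq    : ℕ → ℚ
    cauchy : Cauchy seq

open ℝ public

infix 4 _≃_

record _≃_ (x y : ℝ) : Set where
  constructor mk≃
  field null : Null (λ n → seq x n ℚ.- seq y n)

open _≃_ public

halve : ∀ {ε} → 0ℚ ℚ.< ε → 0ℚ ℚ.< ½ ℚ.* ε
halve {ε} 0<ε = ℚ.≤-<-trans (ℚ.≤-reflexive (sym (ℚ.*-zeroʳ ½))) (ℚ.*-monoʳ-<-pos ½ 0<ε)

halves : ∀ ε → ½ ℚ.* ε ℚ.+ ½ ℚ.* ε ≡ ε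
halves ε = trans (sym (ℚ.*-distribʳ-+ ε ½ ½)) (ℚ.*-identityˡ ε)

∣+∣< : ∀ {x y ε} → ∣ x ∣ ℚ.< ½ ℚ.* ε → ∣ y ∣ ℚ.< ½ ℚ.* ε → ∣ x ℚ.+ y ∣ ℚ.< ε
∣+∣< {x} {y} {ε} p q = ℚ.≤-<-trans (ℚ.∣p+q∣≤∣p∣+∣q∣ x y)
  (ℚ.<-≤-trans (ℚ.+-mono-< p q) (ℚ.≤-reflexive (halves ε)))

∣*∣< : ∀ {B ε} → 0ℚ ℚ.< B → 0ℚ ℚ.< ε → ∃ λ δ → 0ℚ ℚ.< δ ×
  (∀ x y → ∣ x ∣ ℚ.< B → ∣ y ∣ ℚ.< δ → ∣ x ℚ.* y ∣ ℚ.< ε)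
∣*∣< {B} {ε} 0<B 0<ε = δ , 0<δ , bound
  where
  instance
    B>0 : ℚ.Positive B
    B>0 = ℚ.positive 0<B
    B≢0 : ℚ.NonZero B
    B≢0 = ℚ.pos⇒nonZero B
    1/B>0 : ℚ.Positive (ℚ.1/ B)
    1/B>0 = ℚ.1/pos⇒pos B
  δ : ℚ
  δ = ℚ.1/ B ℚ.* ε
  0<δ : 0ℚ ℚ.< δ
  0<δ = ℚ.≤-<-trans (ℚ.≤-reflexive (sym (ℚ.*-zeroʳ (ℚ.1/ B)))) (ℚ.*-monoʳ-<-pos (ℚ.1/ B) 0<ε)
  Bδ≡ε : B ℚ.* δ ≡ ε
  Bδ≡ε = trans (sym (ℚ.*-assoc B (ℚ.1/ B) ε))
    (trans (cong (ℚ._* ε) (ℚ.*-inverseʳ B)) (ℚ.*-identityˡ ε))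
  bound : ∀ x y → ∣ x ∣ ℚ.< B → ∣ y ∣ ℚ.< δ → ∣ x ℚ.* y ∣ ℚ.< ε
  bound x y p q = begin-strict
    ∣ x ℚ.* y ∣       ≡⟨ ℚ.∣p*q∣≡∣p∣*∣q∣ x y ⟩
    ∣ x ∣ ℚ.* ∣ y ∣   ≤⟨ ℚ.*-monoʳ-≤-nonNeg ∣ y ∣ {{ℚ.∣-∣-nonNeg y}} (ℚ.<⇒≤ p) ⟩
    B ℚ.* ∣ y ∣       <⟨ ℚ.*-monoʳ-<-pos B q ⟩
    B ℚ.* δ           ≡⟨ Bδ≡ε ⟩
    ε                 ∎
    where open ℚ.≤-Reasoning

eventuallyBounded : ∀ x → ∃ λ B → 0ℚ ℚ.< B × ∃ λ N → ∀ n → N ℕ.≤ n → ∣ seq x n ∣ ℚ.< B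
eventuallyBounded x with cauchy x 1ℚ (ℚ.positive⁻¹ 1ℚ)
... | N , close = B , 0<B , N , bound
  where
  B = ∣ seq x N ∣ ℚ.+ 1ℚ
  0<B : 0ℚ ℚ.< B
  0<B = ℚ.<-≤-trans (ℚ.positive⁻¹ 1ℚ) (ℚ.≤-trans (ℚ.≤-reflexive (sym (ℚ.+-identityˡ 1ℚ)))
    (ℚ.+-monoˡ-≤ 1ℚ (ℚ.0≤∣p∣ (seq x N))))
  bound : ∀ n → N ℕ.≤ n → ∣ seq x n ∣ ℚ.< B
  bound n N≤n = begin-strict
    ∣ seq x n ∣                                   ≡⟨ cong ∣_∣ (solve 2 (λ a b → a := b :+ (a :- b)) refl (seq x n) (seq x N)) ⟩
    ∣ seq x N ℚ.+ (seq x n ℚ.- seq x N) ∣         ≤⟨ ℚ.∣p+q∣≤∣p∣+∣q∣ (seq x N) (seq x n ℚ.- seq x N) ⟩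
    ∣ seq x N ∣ ℚ.+ ∣ seq x n ℚ.- seq x N ∣       <⟨ ℚ.+-monoʳ-< ∣ seq x N ∣ (close n N N≤n ℕ.≤-refl) ⟩
    B                                             ∎
    where
    open ℚ.≤-Reasoning
    open ℚ.+-*-Solver

Null-cong : ∀ {f g} → (∀ n → f n ≡ g n) → Null f → Null g
Null-cong f≗g null-f ε 0<ε with null-f ε 0<ε
... | N , small = N , λ n N≤n → subst (λ q → ∣ q ∣ ℚ.< ε) (f≗g n) (small n N≤n)

Null-0 : Null (λ _ → 0ℚ)
Null-0 ε 0<ε = 0 , λ _ _ → 0<ε

Null-+ : ∀ {f g} → Null f → Null g → Null (λ n → f n ℚ.+ g n)
Null-+ null-f null-g ε 0<ε =
  let M , small-f = null-f (½ ℚ.* ε) (halve 0<ε)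
      N , small-g = null-g (½ ℚ.* ε) (halve 0<ε)
  in M ℕ.⊔ N , λ n le →
       ∣+∣< (small-f n (ℕ.m⊔n≤o⇒m≤o M N le)) (small-g n (ℕ.m⊔n≤o⇒n≤o M N le))

Null-neg : ∀ {f} → Null f → Null (λ n → ℚ.- f n)
Null-neg {f} null-f ε 0<ε with null-f ε 0<ε
... | N , small = N , λ n N≤n → subst (ℚ._< ε) (sym (ℚ.∣-p∣≡∣p∣ (f n))) (small n N≤n)

Null-* : ∀ x {f} → Null f → Null (λ n → seq x n ℚ.* f n)
Null-* x {f} null-f ε 0<ε =
  let B , 0<B , M , bound = eventuallyBounded x
      δ , 0<δ , small     = ∣*∣< 0<B 0<ε
      N , small-f         = null-f δ 0<δ
  in M ℕ.⊔ N , λ n le →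
       small (seq x n) (f n) (bound n (ℕ.m⊔n≤o⇒m≤o M N le)) (small-f n (ℕ.m⊔n≤o⇒n≤o M N le))

≗⇒≃ : ∀ {x y} → (∀ n → seq x n ≡ seq y n) → x ≃ y
≗⇒≃ {x} {y} x≗y = mk≃ (Null-cong (λ n →
  trans (sym (ℚ.+-inverseʳ (seq y n))) (cong (ℚ._- seq y n) (sym (x≗y n)))) Null-0)

fromℚ : ℚ → ℝ
fromℚ q .seq _ = q
fromℚ q .cauchy ε 0<ε =
  0 , λ _ _ _ _ → subst (λ p → ∣ p ∣ ℚ.< ε) (sym (ℚ.+-inverseʳ q)) 0<ε

infixl 6 _+ʳ_
infixl 7 _*ʳ_
infix  8 -ʳ_

_+ʳ_ : ℝ → ℝ → ℝ
(x +ʳ y) .seq n = seq x n ℚ.+ seq y n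
(x +ʳ y) .cauchy ε 0<ε =
  let M , close-x = cauchy x (½ ℚ.* ε) (halve 0<ε)
      N , close-y = cauchy y (½ ℚ.* ε) (halve 0<ε)
  in M ℕ.⊔ N , λ m n le le′ → subst (λ q → ∣ q ∣ ℚ.< ε)
       (solve 4 (λ a b c d → (a :- b) :+ (c :- d) := (a :+ c) :- (b :+ d)) refl
         (seq x m) (seq x n) (seq y m) (seq y n))
       (∣+∣< (close-x m n (ℕ.m⊔n≤o⇒m≤o M N le) (ℕ.m⊔n≤o⇒m≤o M N le′))
             (close-y m n (ℕ.m⊔n≤o⇒n≤o M N le) (ℕ.m⊔n≤o⇒n≤o M N le′)))
  where open ℚ.+-*-Solver

-ʳ_ : ℝ → ℝ
(-ʳ x) .seq n = ℚ.- seq x n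
(-ʳ x) .cauchy ε 0<ε =
  let N , close = cauchy x ε 0<ε
  in N , λ m n le le′ → subst (λ q → ∣ q ∣ ℚ.< ε)
       (solve 2 (λ a b → b :- a := (:- a) :- (:- b)) refl (seq x m) (seq x n))
       (close n m le′ le)
  where open ℚ.+-*-Solver

_*ʳ_ : ℝ → ℝ → ℝ
(x *ʳ y) .seq n = seq x n ℚ.* seq y n
(x *ʳ y) .cauchy ε 0<ε =
  let Bx , 0<Bx , Nx , bound-x = eventuallyBounded x
      By , 0<By , Ny , bound-y = eventuallyBounded y
      δy , 0<δy , small-y = ∣*∣< 0<Bx (halve 0<ε)
      δx , 0<δx , small-x = ∣*∣< 0<By (halve 0<ε)
      Mx , close-x = cauchy x δx 0<δx
      My , close-y = cauchy y δy 0<δy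
      N = (Nx ℕ.⊔ Ny) ℕ.⊔ (Mx ℕ.⊔ My)
      Nx≤ = λ {n} (le : N ℕ.≤ n) → ℕ.m⊔n≤o⇒m≤o Nx Ny (ℕ.m⊔n≤o⇒m≤o (Nx ℕ.⊔ Ny) (Mx ℕ.⊔ My) le)
      Ny≤ = λ {n} (le : N ℕ.≤ n) → ℕ.m⊔n≤o⇒n≤o Nx Ny (ℕ.m⊔n≤o⇒m≤o (Nx ℕ.⊔ Ny) (Mx ℕ.⊔ My) le)
      Mx≤ = λ {n} (le : N ℕ.≤ n) → ℕ.m⊔n≤o⇒m≤o Mx My (ℕ.m⊔n≤o⇒n≤o (Nx ℕ.⊔ Ny) (Mx ℕ.⊔ My) le)
      My≤ = λ {n} (le : N ℕ.≤ n) → ℕ.m⊔n≤o⇒n≤o Mx My (ℕ.m⊔n≤o⇒n≤o (Nx ℕ.⊔ Ny) (Mx ℕ.⊔ My) le)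
  in N , λ m n le le′ → subst (λ q → ∣ q ∣ ℚ.< ε)
       (solve 4 (λ a b c d → a :* (c :- d) :+ d :* (a :- b) := a :* c :- b :* d) refl
         (seq x m) (seq x n) (seq y m) (seq y n))
       (∣+∣< (small-y _ _ (bound-x m (Nx≤ le)) (close-y m n (My≤ le) (My≤ le′)))
             (small-x _ _ (bound-y n (Ny≤ le′)) (close-x m n (Mx≤ le) (Mx≤ le′))))
  where open ℚ.+-*-Solver

≃-refl : ∀ {x} → x ≃ x
≃-refl {x} = ≗⇒≃ {x} {x} λ _ → refl

≃-sym : ∀ {x y} → x ≃ y → y ≃ x
≃-sym {x} {y} p = mk≃ (Null-cong
  (λ n → solve 2 (λ a b → :- (a :- b) := b :- a) refl (seq x n) (seq y n))
  (Null-neg (null p)))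
  where open ℚ.+-*-Solver

≃-trans : ∀ {x y w} → x ≃ y → y ≃ w → x ≃ w
≃-trans {x} {y} {w} p q = mk≃ (Null-cong
  (λ n → solve 3 (λ a b c → (a :- b) :+ (b :- c) := a :- c) refl (seq x n) (seq y n) (seq w n))
  (Null-+ (null p) (null q)))
  where open ℚ.+-*-Solver

+ʳ-cong : ∀ {x y u v} → x ≃ y → u ≃ v → x +ʳ u ≃ y +ʳ v
+ʳ-cong {x} {y} {u} {v} p q = mk≃ (Null-cong
  (λ n → solve 4 (λ a b c d → (a :- b) :+ (c :- d) := (a :+ c) :- (b :+ d)) refl
    (seq x n) (seq y n) (seq u n) (seq v n))
  (Null-+ (null p) (null q)))
  where open ℚ.+-*-Solver

-ʳ-cong : ∀ {x y} → x ≃ y → -ʳ x ≃ -ʳ y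
-ʳ-cong {x} {y} p = mk≃ (Null-cong
  (λ n → solve 2 (λ a b → :- (a :- b) := (:- a) :- (:- b)) refl (seq x n) (seq y n))
  (Null-neg (null p)))
  where open ℚ.+-*-Solver

*ʳ-cong : ∀ {x y u v} → x ≃ y → u ≃ v → x *ʳ u ≃ y *ʳ v
*ʳ-cong {x} {y} {u} {v} p q = mk≃ (Null-cong
  (λ n → solve 4 (λ a b c d → a :* (c :- d) :+ d :* (a :- b) := a :* c :- b :* d) refl
    (seq x n) (seq y n) (seq u n) (seq v n))
  (Null-+ (Null-* x (null q)) (Null-* v (null p))))
  where open ℚ.+-*-Solver

-- ⌊√ n ⌋ is the largest k with k * k ≤ n.
⌊√_⌋ : ℕ → ℕ
⌊√ zero ⌋  = zero
⌊√ suc n ⌋ with suc ⌊√ n ⌋ ℕ.* suc ⌊√ n ⌋ ℕ.≤? suc n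
... | yes _ = suc ⌊√ n ⌋
... | no  _ = ⌊√ n ⌋

⌊√⌋-lower : ∀ n → ⌊√ n ⌋ ℕ.* ⌊√ n ⌋ ℕ.≤ n
⌊√⌋-lower zero = ℕ.z≤n
⌊√⌋-lower (suc n) with suc ⌊√ n ⌋ ℕ.* suc ⌊√ n ⌋ ℕ.≤? suc n
... | yes p = p
... | no  _ = ℕ.m≤n⇒m≤1+n (⌊√⌋-lower n)

⌊√⌋-upper : ∀ n → n ℕ.< suc ⌊√ n ⌋ ℕ.* suc ⌊√ n ⌋
⌊√⌋-upper zero = ℕ.s≤s ℕ.z≤n
⌊√⌋-upper (suc n) with suc ⌊√ n ⌋ ℕ.* suc ⌊√ n ⌋ ℕ.≤? suc n
... | yes _ = ℕ.≤-<-trans (⌊√⌋-upper n) (ℕ.*-mono-< (ℕ.n<1+n (suc ⌊√ n ⌋)) (ℕ.n<1+n (suc ⌊√ n ⌋)))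
... | no ¬p = ℕ.≰⇒> ¬p

-- The n-th term of √2 is ⌊(n+1)√2⌋ / (n+1).
√2-numerator : ℕ → ℕ
√2-numerator n = ⌊√ 2 ℕ.* (suc n ℕ.* suc n) ⌋

√2-seq : ℕ → ℚ
√2-seq n = + √2-numerator n ℚ./ suc n

√2-numerator-cross : ∀ m n → √2-numerator m ℕ.* suc n ℕ.< suc (√2-numerator n) ℕ.* suc m
√2-numerator-cross m n = ℕ.≰⇒> λ le → ℕ.<-irrefl refl (begin-strict
  2 ℕ.* (suc n ℕ.* suc n) ℕ.* (suc m ℕ.* suc m)   <⟨ ℕ.*-monoˡ-< (suc m ℕ.* suc m) (⌊√⌋-upper (2 ℕ.* (suc n ℕ.* suc n))) ⟩
  suc b ℕ.* suc b ℕ.* (suc m ℕ.* suc m)           ≡⟨ swap (suc b) (suc m) ⟩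
  suc b ℕ.* suc m ℕ.* (suc b ℕ.* suc m)           ≤⟨ ℕ.*-mono-≤ le le ⟩
  a ℕ.* suc n ℕ.* (a ℕ.* suc n)                   ≡⟨ swap a (suc n) ⟨
  a ℕ.* a ℕ.* (suc n ℕ.* suc n)                   ≤⟨ ℕ.*-monoˡ-≤ (suc n ℕ.* suc n) (⌊√⌋-lower (2 ℕ.* (suc m ℕ.* suc m))) ⟩
  2 ℕ.* (suc m ℕ.* suc m) ℕ.* (suc n ℕ.* suc n)   ≡⟨ solve 2 (λ x y → con 2 :* (x :* x) :* (y :* y) := con 2 :* (y :* y) :* (x :* x)) refl (suc m) (suc n) ⟩
  2 ℕ.* (suc n ℕ.* suc n) ℕ.* (suc m ℕ.* suc m)   ∎)
  where
  open ℕ.≤-Reasoning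
  open ℕ.+-*-Solver
  a = √2-numerator m
  b = √2-numerator n
  swap : ∀ x y → x ℕ.* x ℕ.* (y ℕ.* y) ≡ x ℕ.* y ℕ.* (x ℕ.* y)
  swap = solve 2 (λ x y → x :* x :* (y :* y) := x :* y :* (x :* y)) refl

√2-step : ∀ m n → √2-seq m ℚ.< √2-seq n ℚ.+ 1ℤ ℚ./ suc n
√2-step m n = ℚ.toℚᵘ-cancel-< (begin-strict
  ℚ.toℚᵘ (√2-seq m)                                ≃⟨ ℚ.toℚᵘ-fromℚᵘ (ℚᵘ.mkℚᵘ (+ a) m) ⟩
  ℚᵘ.mkℚᵘ (+ a) m                                  <⟨ ℚᵘ.*<* (subst₂ ℤ._<_ (ℤ.pos-* a (suc n)) (ℤ.pos-* (suc b) (suc m)) (ℤ.+<+ (√2-numerator-cross m n))) ⟩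
  ℚᵘ.mkℚᵘ (+ suc b) n                              ≃⟨ ℚᵘ.*≡* (solve 2 (λ x y → (con 1ℤ :+ x) :* (y :* y) := (x :* y :+ con 1ℤ :* y) :* y) refl (+ b) (+ suc n)) ⟩
  ℚᵘ.mkℚᵘ (+ b) n ℚᵘ.+ ℚᵘ.mkℚᵘ 1ℤ n                ≃⟨ ℚᵘ.+-cong (ℚ.toℚᵘ-fromℚᵘ (ℚᵘ.mkℚᵘ (+ b) n)) (ℚ.toℚᵘ-fromℚᵘ (ℚᵘ.mkℚᵘ 1ℤ n)) ⟨
  ℚ.toℚᵘ (√2-seq n) ℚᵘ.+ ℚ.toℚᵘ (1ℤ ℚ./ suc n)     ≃⟨ ℚ.toℚᵘ-homo-+ (√2-seq n) (1ℤ ℚ./ suc n) ⟨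
  ℚ.toℚᵘ (√2-seq n ℚ.+ 1ℤ ℚ./ suc n)               ∎)
  where
  open ℚᵘ.≤-Reasoning
  open ℤ.+-*-Solver
  a = √2-numerator m
  b = √2-numerator n

archimedean : ∀ ε → 0ℚ ℚ.< ε → ∃ λ N → ∀ n → N ℕ.≤ n → 1ℤ ℚ./ suc n ℚ.< ε
archimedean ε@(ℚ.mkℚ (+ zero) d _) 0<ε with () ← ℤ.Positive.pos (ℚ.positive 0<ε)
archimedean ε@(ℚ.mkℚ -[1+ k ] d _) 0<ε with () ← ℤ.Positive.pos (ℚ.positive 0<ε)
archimedean ε@(ℚ.mkℚ (+ suc k) d _) _ = suc d , λ n d<n → ℚ.toℚᵘ-cancel-< (begin-strict
  ℚ.toℚᵘ (1ℤ ℚ./ suc n)   ≃⟨ ℚ.toℚᵘ-fromℚᵘ (ℚᵘ.mkℚᵘ 1ℤ n) ⟩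
  ℚᵘ.mkℚᵘ 1ℤ n            <⟨ ℚᵘ.*<* (ℤ.+<+ (ℕ.≤-<-trans (ℕ.≤-reflexive (ℕ.*-identityˡ (suc d)))
                               (ℕ.<-≤-trans (ℕ.s≤s d<n) (ℕ.m≤m+n (suc n) (k ℕ.* suc n))))) ⟩
  ℚᵘ.mkℚᵘ (+ suc k) d     ∎)
  where open ℚᵘ.≤-Reasoning

√2-cauchy : Cauchy √2-seq
√2-cauchy ε 0<ε = let N , small = archimedean ε 0<ε in N , λ m n N≤m N≤n →
  case-∣∣ (√2-seq m ℚ.- √2-seq n)
    (diff m n (small n N≤n))
    (subst (ℚ._< ε) (solve 2 (λ a b → b :- a := :- (a :- b)) refl (√2-seq m) (√2-seq n))
      (diff n m (small m N≤m)))
  where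
  open ℚ.+-*-Solver
  case-∣∣ : ∀ q → q ℚ.< ε → ℚ.- q ℚ.< ε → ∣ q ∣ ℚ.< ε
  case-∣∣ q q<ε -q<ε with ℚ.∣p∣≡p∨∣p∣≡-p q
  ... | inj₁ eq = subst (ℚ._< ε) (sym eq) q<ε
  ... | inj₂ eq = subst (ℚ._< ε) (sym eq) -q<ε
  diff : ∀ m n → 1ℤ ℚ./ suc n ℚ.< ε → √2-seq m ℚ.- √2-seq n ℚ.< ε
  diff m n u<ε = subst (√2-seq m ℚ.- √2-seq n ℚ.<_)
    (solve 2 (λ a e → a :+ e :- a := e) refl (√2-seq n) ε)
    (ℚ.+-monoˡ-< (ℚ.- √2-seq n) (ℚ.<-trans (√2-step m n) (ℚ.+-monoʳ-< (√2-seq n) u<ε)))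

√2 : ℝ
√2 .seq    = √2-seq
√2 .cauchy = √2-cauchy

------------------------------------------------------------------------
-- The complex numbers

record ℂ : Set where
  no-eta-equality
  field
    re im : ℝ

open ℂ public

infix 4 _≃ᶜ_

record _≃ᶜ_ (x y : ℂ) : Set where
  constructor mk≃ᶜ
  field
    re≃ : re x ≃ re y
    im≃ : im x ≃ im y

fromℝ : ℝ → ℂ
fromℝ x .re = x
fromℝ x .im = fromℚ 0ℚ

infixl 6 _+ᶜ_
infixl 7 _*ᶜ_
infix  8 -ᶜ_

_+ᶜ_ : ℂ → ℂ → ℂ
(x +ᶜ y) .re = re x +ʳ re y
(x +ᶜ y) .im = im x +ʳ im y

-ᶜ_ : ℂ → ℂ
(-ᶜ x) .re = -ʳ re x
(-ᶜ x) .im = -ʳ im x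

_*ᶜ_ : ℂ → ℂ → ℂ
(x *ᶜ y) .re = re x *ʳ re y +ʳ -ʳ (im x *ʳ im y)
(x *ᶜ y) .im = re x *ʳ im y +ʳ im x *ʳ re y

0ᶜ 1ᶜ : ℂ
0ᶜ = fromℝ (fromℚ 0ℚ)
1ᶜ = fromℝ (fromℚ 1ℚ)

≗⇒≃ᶜ : ∀ x y → (∀ n → seq (re x) n ≡ seq (re y) n) → (∀ n → seq (im x) n ≡ seq (im y) n) → x ≃ᶜ y
≗⇒≃ᶜ x y p q = mk≃ᶜ (≗⇒≃ p) (≗⇒≃ q)

+ᶜ-assoc : ∀ x y w → (x +ᶜ y) +ᶜ w ≃ᶜ x +ᶜ (y +ᶜ w)
+ᶜ-assoc x y w = ≗⇒≃ᶜ ((x +ᶜ y) +ᶜ w) (x +ᶜ (y +ᶜ w))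
  (λ n → solve 6 (λ a b c d e f →
       (a :+ c) :+ e
    := a :+ (c :+ e)) refl (seq (re x) n) (seq (im x) n) (seq (re y) n) (seq (im y) n) (seq (re w) n) (seq (im w) n))
  (λ n → solve 6 (λ a b c d e f →
       (b :+ d) :+ f
    := b :+ (d :+ f)) refl (seq (re x) n) (seq (im x) n) (seq (re y) n) (seq (im y) n) (seq (re w) n) (seq (im w) n))
  where open ℚ.+-*-Solver

+ᶜ-comm : ∀ x y → x +ᶜ y ≃ᶜ y +ᶜ x
+ᶜ-comm x y = ≗⇒≃ᶜ (x +ᶜ y) (y +ᶜ x)
  (λ n → solve 4 (λ a b c d →
       a :+ c
    := c :+ a) refl (seq (re x) n) (seq (im x) n) (seq (re y) n) (seq (im y) n))
  (λ n → solve 4 (λ a b c d →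
       b :+ d
    := d :+ b) refl (seq (re x) n) (seq (im x) n) (seq (re y) n) (seq (im y) n))
  where open ℚ.+-*-Solver

+ᶜ-identityˡ : ∀ x → 0ᶜ +ᶜ x ≃ᶜ x
+ᶜ-identityˡ x = ≗⇒≃ᶜ (0ᶜ +ᶜ x) (x)
  (λ n → solve 2 (λ a b →
       con 0ℚ :+ a
    := a) refl (seq (re x) n) (seq (im x) n))
  (λ n → solve 2 (λ a b →
       con 0ℚ :+ b
    := b) refl (seq (re x) n) (seq (im x) n))
  where open ℚ.+-*-Solver

+ᶜ-inverseˡ : ∀ x → (-ᶜ x) +ᶜ x ≃ᶜ 0ᶜ
+ᶜ-inverseˡ x = ≗⇒≃ᶜ ((-ᶜ x) +ᶜ x) (0ᶜ)
  (λ n → solve 2 (λ a b →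
       (:- a) :+ a
    := con 0ℚ) refl (seq (re x) n) (seq (im x) n))
  (λ n → solve 2 (λ a b →
       (:- b) :+ b
    := con 0ℚ) refl (seq (re x) n) (seq (im x) n))
  where open ℚ.+-*-Solver

*ᶜ-assoc : ∀ x y w → (x *ᶜ y) *ᶜ w ≃ᶜ x *ᶜ (y *ᶜ w)
*ᶜ-assoc x y w = ≗⇒≃ᶜ ((x *ᶜ y) *ᶜ w) (x *ᶜ (y *ᶜ w))
  (λ n → solve 6 (λ a b c d e f →
       (a :* c :+ :- (b :* d)) :* e :+ :- ((a :* d :+ b :* c) :* f)
    := a :* (c :* e :+ :- (d :* f)) :+ :- (b :* (c :* f :+ d :* e))) refl (seq (re x) n) (seq (im x) n) (seq (re y) n) (seq (im y) n) (seq (re w) n) (seq (im w) n))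
  (λ n → solve 6 (λ a b c d e f →
       (a :* c :+ :- (b :* d)) :* f :+ (a :* d :+ b :* c) :* e
    := a :* (c :* f :+ d :* e) :+ b :* (c :* e :+ :- (d :* f))) refl (seq (re x) n) (seq (im x) n) (seq (re y) n) (seq (im y) n) (seq (re w) n) (seq (im w) n))
  where open ℚ.+-*-Solver

*ᶜ-comm : ∀ x y → x *ᶜ y ≃ᶜ y *ᶜ x
*ᶜ-comm x y = ≗⇒≃ᶜ (x *ᶜ y) (y *ᶜ x)
  (λ n → solve 4 (λ a b c d →
       a :* c :+ :- (b :* d)
    := c :* a :+ :- (d :* b)) refl (seq (re x) n) (seq (im x) n) (seq (re y) n) (seq (im y) n))
  (λ n → solve 4 (λ a b c d →
       a :* d :+ b :* c
    := c :* b :+ d :* a) refl (seq (re x) n) (seq (im x) n) (seq (re y) n) (seq (im y) n))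
  where open ℚ.+-*-Solver

*ᶜ-identityˡ : ∀ x → 1ᶜ *ᶜ x ≃ᶜ x
*ᶜ-identityˡ x = ≗⇒≃ᶜ (1ᶜ *ᶜ x) (x)
  (λ n → solve 2 (λ a b →
       con 1ℚ :* a :+ :- (con 0ℚ :* b)
    := a) refl (seq (re x) n) (seq (im x) n))
  (λ n → solve 2 (λ a b →
       con 1ℚ :* b :+ con 0ℚ :* a
    := b) refl (seq (re x) n) (seq (im x) n))
  where open ℚ.+-*-Solver

*ᶜ-distribˡ-+ᶜ : ∀ x y w → x *ᶜ (y +ᶜ w) ≃ᶜ x *ᶜ y +ᶜ x *ᶜ w
*ᶜ-distribˡ-+ᶜ x y w = ≗⇒≃ᶜ (x *ᶜ (y +ᶜ w)) (x *ᶜ y +ᶜ x *ᶜ w)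
  (λ n → solve 6 (λ a b c d e f →
       a :* (c :+ e) :+ :- (b :* (d :+ f))
    := (a :* c :+ :- (b :* d)) :+ (a :* e :+ :- (b :* f))) refl (seq (re x) n) (seq (im x) n) (seq (re y) n) (seq (im y) n) (seq (re w) n) (seq (im w) n))
  (λ n → solve 6 (λ a b c d e f →
       a :* (d :+ f) :+ b :* (c :+ e)
    := (a :* d :+ b :* c) :+ (a :* f :+ b :* e)) refl (seq (re x) n) (seq (im x) n) (seq (re y) n) (seq (im y) n) (seq (re w) n) (seq (im w) n))
  where open ℚ.+-*-Solver

≃ᶜ-refl : ∀ {x} → x ≃ᶜ x
≃ᶜ-refl = mk≃ᶜ ≃-refl ≃-refl

≃ᶜ-sym : ∀ {x y} → x ≃ᶜ y → y ≃ᶜ x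
≃ᶜ-sym (mk≃ᶜ p q) = mk≃ᶜ (≃-sym p) (≃-sym q)

≃ᶜ-trans : ∀ {x y w} → x ≃ᶜ y → y ≃ᶜ w → x ≃ᶜ w
≃ᶜ-trans (mk≃ᶜ p q) (mk≃ᶜ p′ q′) = mk≃ᶜ (≃-trans p p′) (≃-trans q q′)

+ᶜ-cong : ∀ {x y u v} → x ≃ᶜ y → u ≃ᶜ v → x +ᶜ u ≃ᶜ y +ᶜ v
+ᶜ-cong (mk≃ᶜ p q) (mk≃ᶜ p′ q′) = mk≃ᶜ (+ʳ-cong p p′) (+ʳ-cong q q′)

-ᶜ-cong : ∀ {x y} → x ≃ᶜ y → -ᶜ x ≃ᶜ -ᶜ y
-ᶜ-cong (mk≃ᶜ p q) = mk≃ᶜ (-ʳ-cong p) (-ʳ-cong q)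

*ᶜ-cong : ∀ {x y u v} → x ≃ᶜ y → u ≃ᶜ v → x *ᶜ u ≃ᶜ y *ᶜ v
*ᶜ-cong (mk≃ᶜ p q) (mk≃ᶜ p′ q′) = mk≃ᶜ
  (+ʳ-cong (*ʳ-cong p p′) (-ʳ-cong (*ʳ-cong q q′)))
  (+ʳ-cong (*ʳ-cong p q′) (*ʳ-cong q p′))

ℂ-setoid : Setoid 0ℓ 0ℓ
ℂ-setoid = record
  { _≈_           = _≃ᶜ_
  ; isEquivalence = record { refl = ≃ᶜ-refl ; sym = ≃ᶜ-sym ; trans = ≃ᶜ-trans }
  }

open Algebra.Consequences.Setoid ℂ-setoid using (comm∧idˡ⇒id; comm∧invˡ⇒inv; comm∧distrˡ⇒distr)

ℂ-isCommutativeRing : IsCommutativeRing _≃ᶜ_ _+ᶜ_ _*ᶜ_ -ᶜ_ 0ᶜ 1ᶜ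
ℂ-isCommutativeRing = record
  { isRing = record
    { +-isAbelianGroup = record
      { isGroup = record
        { isMonoid = record
          { isSemigroup = record
            { isMagma = record { isEquivalence = Setoid.isEquivalence ℂ-setoid ; ∙-cong = +ᶜ-cong }
            ; assoc = +ᶜ-assoc
            }
          ; identity = comm∧idˡ⇒id +ᶜ-comm +ᶜ-identityˡ
          }
        ; inverse = comm∧invˡ⇒inv +ᶜ-comm +ᶜ-inverseˡ
        ; ⁻¹-cong = -ᶜ-cong
        }
      ; comm = +ᶜ-comm
      }
    ; *-cong = *ᶜ-cong
    ; *-assoc = *ᶜ-assoc
    ; *-identity = comm∧idˡ⇒id *ᶜ-comm *ᶜ-identityˡ
    ; distrib = comm∧distrˡ⇒distr +ᶜ-cong *ᶜ-comm *ᶜ-distribˡ-+ᶜ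
    }
  ; *-comm = *ᶜ-comm
  }

ℂ-commutativeRing : CommutativeRing 0ℓ 0ℓ
ℂ-commutativeRing = record { isCommutativeRing = ℂ-isCommutativeRing }

ℚ⇒ℂ : ℚ → ℂ
ℚ⇒ℂ q = fromℝ (fromℚ q)

ℤ⇒ℂ : ℤ → ℂ
ℤ⇒ℂ k = ℚ⇒ℂ (k ℚ./ 1)

open Algebra.Definitions.RawSemiring (Semiring.rawSemiring (CommutativeRing.semiring ℂ-commutativeRing)) using () renaming (_^_ to _^ᶜ_)

-- e^{2πi/8} = cos(π/4) + i sin(π/4) = √2/2 + (√2/2) i
z : ℂ
z .re = fromℚ ½ *ʳ √2
z .im = fromℚ ½ *ʳ √2

------------------------------------------------------------------------
-- Bases

module Basis {c ℓ} (K : CommutativeRing c ℓ) {m ℓm} (V : RawLeftModule (CommutativeRing.Carrier K) m ℓm) where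

  open CommutativeRing K using (Carrier; _≈_; 0#)
  open RawLeftModule V
  open Algebra.Definitions.RawMonoid +ᴹ-rawMonoid using (sum)

  record IsBasisOf {p k} (S : Pred Carrierᴹ p) (b : Fin k → Carrierᴹ) : Set (c ⊔ ℓ ⊔ m ⊔ ℓm ⊔ p) where
    field
      belongs     : ∀ i → S (b i)
      independent : ∀ (a : Fin k → Carrier) → sum (λ i → a i *ₗ b i) ≈ᴹ 0ᴹ → ∀ i → a i ≈ 0#
      spanning    : ∀ v → S v → ∃ λ (a : Fin k → Carrier) → v ≈ᴹ sum (λ i → a i *ₗ b i)

------------------------------------------------------------------------
-- Polynomials in n variables over a commutative ring K, and the action
-- of square matrices on them

module Polynomials {c ℓ} (K : CommutativeRing c ℓ) (n : ℕ) where

  open CommutativeRing K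
  open Algebra.Definitions.RawSemiring (Semiring.rawSemiring semiring) using () renaming (sum to ∑)

  Exponents : Set
  Exponents = Vec ℕ n

  -- A formal sum of terms a · x₁^α₁ ⋯ xₙ^αₙ.  The same monomial may
  -- occur several times; polynomials are equal when all their
  -- coefficients are.
  Poly : Set c
  Poly = List (Carrier × Exponents)

  coefficient : Poly → Exponents → Carrier
  coefficient []            α = 0#
  coefficient ((a , β) ∷ f) α =
    (if does (Vec.≡-dec ℕ._≟_ β α) then a else 0#) + coefficient f α

  infix  4 _≈ₚ_
  infixl 6 _+ₚ_
  infixl 7 _*ₚ_ _∙ₚ_
  infix  8 -ₚ_

  _≈ₚ_ : Poly → Poly → Set ℓ
  f ≈ₚ g = ∀ α → coefficient f α ≈ coefficient g α

  0ₚ 1ₚ : Poly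
  0ₚ = []
  1ₚ = (1# , replicate n 0) ∷ []

  _+ₚ_ _*ₚ_ : Poly → Poly → Poly
  _+ₚ_ = _++_
  _*ₚ_ = cartesianProductWith λ (a , α) (b , β) → a * b , zipWith ℕ._+_ α β

  _∙ₚ_ : Carrier → Poly → Poly
  a ∙ₚ f = map (λ (b , β) → a * b , β) f

  -ₚ_ : Poly → Poly
  -ₚ f = - 1# ∙ₚ f

  var : Fin n → Poly
  var i = (1# , Vec.tabulate λ j → if does (i Fin.≟ j) then 1 else 0) ∷ []

  polyRawSemiring : RawSemiring c ℓ
  polyRawSemiring = record
    { Carrier = Poly ; _≈_ = _≈ₚ_ ; _+_ = _+ₚ_ ; _*_ = _*ₚ_ ; 0# = 0ₚ ; 1# = 1ₚ }

  polyRawModule : RawLeftModule Carrier c ℓ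
  polyRawModule = record
    { Carrierᴹ = Poly ; _≈ᴹ_ = _≈ₚ_ ; _+ᴹ_ = _+ₚ_ ; _*ₗ_ = _∙ₚ_ ; 0ᴹ = 0ₚ ; -ᴹ_ = -ₚ_ }

  open Algebra.Definitions.RawSemiring polyRawSemiring public
    using () renaming (sum to ∑ₚ; product to ∏ₚ; _^_ to _^ₚ_)

  IsHomogeneous : ℕ → Pred Poly ℓ
  IsHomogeneous d f = ∀ α → Vec.sum α ≢ d → coefficient f α ≈ 0#

  Matrix : Set c
  Matrix = Fin n → Fin n → Carrier

  infix  4 _≈ₘ_
  infixl 7 _*ₘ_

  _≈ₘ_ : Matrix → Matrix → Set ℓ
  A ≈ₘ B = ∀ i j → A i j ≈ B i j

  _*ₘ_ : Matrix → Matrix → Matrix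
  (A *ₘ B) i j = ∑ λ k → A i k * B k j

  diagonal : (Fin n → Carrier) → Matrix
  diagonal d i j = if does (i Fin.≟ j) then d i else 0#

  scalar : Carrier → Matrix
  scalar a = diagonal λ _ → a

  1ₘ : Matrix
  1ₘ = scalar 1#

  -- The subgroup of GL(n, K) generated by a family of invertible
  -- matrices.  Invertibility of the generators is not recorded: a matrix
  -- enters as an inverse only if it is shown to be a two-sided one.
  data ⟨_⟩ {k} (generator : Fin k → Matrix) : Matrix → Set (c ⊔ ℓ) where
    generated : ∀ i → ⟨ generator ⟩ (generator i)
    identity  : ⟨ generator ⟩ 1ₘ
    product   : ∀ {A B} → ⟨ generator ⟩ A → ⟨ generator ⟩ B → ⟨ generator ⟩ (A *ₘ B)
    inverse   : ∀ {A B} → ⟨ generator ⟩ A → A *ₘ B ≈ₘ 1ₘ → B *ₘ A ≈ₘ 1ₘ → ⟨ generator ⟩ B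
    respects  : ∀ {A B} → A ≈ₘ B → ⟨ generator ⟩ A → ⟨ generator ⟩ B

  infixr 7 _·_

  -- (A · f)(x₁, …, xₙ) = f (∑ⱼ A₁ⱼ xⱼ, …, ∑ⱼ Aₙⱼ xⱼ)
  _·_ : Matrix → Poly → Poly
  A · f = concatMap (λ (a , α) → a ∙ₚ ∏ₚ λ i → (∑ₚ λ j → A i j ∙ₚ var j) ^ₚ lookup α i) f

  InvariantRing : ∀ {h} → Pred Matrix h → Pred Poly (c ⊔ ℓ ⊔ h)
  InvariantRing H f = ∀ A → H A → A · f ≈ₚ f

  HomogeneousInvariant : ∀ {h} → Pred Matrix h → ℕ → Pred Poly (c ⊔ ℓ ⊔ h)
  HomogeneousInvariant H d f = InvariantRing H f × IsHomogeneous d f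

------------------------------------------------------------------------
-- Linear codes over ℤ/m; a residue class is represented by the element
-- of Fin m with the corresponding value.

module ℤ/ (m : ℕ) .{{_ : ℕ.NonZero m}} where

  infixl 6 _⊕_
  infixl 7 _⊗_
  infix  8 ⊖_

  [_] : ℕ → Fin m
  [ k ] = k mod m

  𝟘 : Fin m
  𝟘 = [ 0 ]

  _⊕_ _⊗_ : Fin m → Fin m → Fin m
  a ⊕ b = [ toℕ a ℕ.+ toℕ b ]
  a ⊗ b = [ toℕ a ℕ.* toℕ b ]

  ⊖_ : Fin m → Fin m
  ⊖ a = [ m ℕ.∸ toℕ a ]

  toℕ-[] : ∀ k → toℕ [ k ] ≡ k % m
  toℕ-[] k = Fin.toℕ-fromℕ< _

  []-toℕ : ∀ a → [ toℕ a ] ≡ a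
  []-toℕ a = Fin.toℕ-injective (trans (toℕ-[] (toℕ a)) (m<n⇒m%n≡m (Fin.toℕ<n a)))

  []-cong-% : ∀ j k → j % m ≡ k % m → [ j ] ≡ [ k ]
  []-cong-% j k eq = Fin.toℕ-injective (trans (toℕ-[] j) (trans eq (sym (toℕ-[] k))))

  []-+ : ∀ j k → [ j ] ⊕ [ k ] ≡ [ j ℕ.+ k ]
  []-+ j k = []-cong-% _ _ (trans (cong₂ (λ a b → (a ℕ.+ b) % m) (toℕ-[] j) (toℕ-[] k)) (sym (%-distribˡ-+ j k m)))

  []-* : ∀ j k → [ j ] ⊗ [ k ] ≡ [ j ℕ.* k ]
  []-* j k = []-cong-% _ _ (trans (cong₂ (λ a b → (a ℕ.* b) % m) (toℕ-[] j) (toℕ-[] k)) (sym (%-distribˡ-* j k m)))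

  ⊕-comm : ∀ a b → a ⊕ b ≡ b ⊕ a
  ⊕-comm a b = cong [_] (ℕ.+-comm (toℕ a) (toℕ b))

  ⊕-assoc : ∀ a b d → (a ⊕ b) ⊕ d ≡ a ⊕ (b ⊕ d)
  ⊕-assoc a b d = begin
    (a ⊕ b) ⊕ d                          ≡⟨ cong ((a ⊕ b) ⊕_) ([]-toℕ d) ⟨
    (a ⊕ b) ⊕ [ toℕ d ]                  ≡⟨ []-+ (toℕ a ℕ.+ toℕ b) (toℕ d) ⟩
    [ toℕ a ℕ.+ toℕ b ℕ.+ toℕ d ]        ≡⟨ cong [_] (ℕ.+-assoc (toℕ a) (toℕ b) (toℕ d)) ⟩
    [ toℕ a ℕ.+ (toℕ b ℕ.+ toℕ d) ]      ≡⟨ []-+ (toℕ a) (toℕ b ℕ.+ toℕ d) ⟨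
    [ toℕ a ] ⊕ (b ⊕ d)                  ≡⟨ cong (_⊕ (b ⊕ d)) ([]-toℕ a) ⟩
    a ⊕ (b ⊕ d)                          ∎
    where open ≡-Reasoning

  ⊕-identityˡ : ∀ a → 𝟘 ⊕ a ≡ a
  ⊕-identityˡ a = trans (cong (𝟘 ⊕_) (sym ([]-toℕ a))) (trans ([]-+ 0 (toℕ a)) ([]-toℕ a))

  ⊖-inverseˡ : ∀ a → ⊖ a ⊕ a ≡ 𝟘
  ⊖-inverseˡ a = begin
    ⊖ a ⊕ a                          ≡⟨ cong (⊖ a ⊕_) ([]-toℕ a) ⟨
    ⊖ a ⊕ [ toℕ a ]                  ≡⟨ []-+ (m ℕ.∸ toℕ a) (toℕ a) ⟩
    [ m ℕ.∸ toℕ a ℕ.+ toℕ a ]        ≡⟨ cong [_] (ℕ.m∸n+n≡m (ℕ.<⇒≤ (Fin.toℕ<n a))) ⟩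
    [ m ]                            ≡⟨ []-cong-% m 0 (trans (n%n≡0 m) (sym (m<n⇒m%n≡m (ℕ.>-nonZero⁻¹ m)))) ⟩
    𝟘                                ∎
    where open ≡-Reasoning

  [+]⊗ : ∀ j k a → [ j ℕ.+ k ] ⊗ a ≡ ([ j ] ⊗ a) ⊕ ([ k ] ⊗ a)
  [+]⊗ j k a = begin
    [ j ℕ.+ k ] ⊗ a                                ≡⟨ cong ([ j ℕ.+ k ] ⊗_) ([]-toℕ a) ⟨
    [ j ℕ.+ k ] ⊗ [ toℕ a ]                        ≡⟨ []-* (j ℕ.+ k) (toℕ a) ⟩
    [ (j ℕ.+ k) ℕ.* toℕ a ]                        ≡⟨ cong [_] (ℕ.*-distribʳ-+ (toℕ a) j k) ⟩
    [ j ℕ.* toℕ a ℕ.+ k ℕ.* toℕ a ]                ≡⟨ []-+ (j ℕ.* toℕ a) (k ℕ.* toℕ a) ⟨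
    [ j ℕ.* toℕ a ] ⊕ [ k ℕ.* toℕ a ]              ≡⟨ cong₂ _⊕_ ([]-* j (toℕ a)) ([]-* k (toℕ a)) ⟨
    ([ j ] ⊗ [ toℕ a ]) ⊕ ([ k ] ⊗ [ toℕ a ])      ≡⟨ cong (λ b → ([ j ] ⊗ b) ⊕ ([ k ] ⊗ b)) ([]-toℕ a) ⟩
    ([ j ] ⊗ a) ⊕ ([ k ] ⊗ a)                      ∎
    where open ≡-Reasoning

  ⊗-distribʳ-⊕ : ∀ a b d → (a ⊕ b) ⊗ d ≡ (a ⊗ d) ⊕ (b ⊗ d)
  ⊗-distribʳ-⊕ a b d = trans ([+]⊗ (toℕ a) (toℕ b) d)
    (cong₂ (λ a b → (a ⊗ d) ⊕ (b ⊗ d)) ([]-toℕ a) ([]-toℕ b))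

  𝟘-⊗ : ∀ a → 𝟘 ⊗ a ≡ 𝟘
  𝟘-⊗ a = trans (cong (𝟘 ⊗_) (sym ([]-toℕ a))) ([]-* 0 (toℕ a))

  𝟙-⊗ : ∀ a → [ 1 ] ⊗ a ≡ a
  𝟙-⊗ a = trans (cong ([ 1 ] ⊗_) (sym ([]-toℕ a)))
    (trans ([]-* 1 (toℕ a)) (trans (cong [_] (ℕ.*-identityˡ (toℕ a))) ([]-toℕ a)))

  Word : ℕ → Set
  Word n = Vec (Fin m) n

  infixl 6 _+ʷ_
  infixl 7 _*ʷ_
  infix  8 -ʷ_

  0ʷ : ∀ {n} → Word n
  0ʷ = replicate _ 𝟘

  _+ʷ_ : ∀ {n} → Word n → Word n → Word n
  _+ʷ_ = zipWith _⊕_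

  -ʷ_ : ∀ {n} → Word n → Word n
  -ʷ_ = Vec.map ⊖_

  record LinearCode (n : ℕ) : Set₁ where
    field
      Codeword   : Pred (Word n) 0ℓ
      codeword?  : Decidable Codeword
      0-closed   : Codeword 0ʷ
      +-closed   : ∀ {v w} → Codeword v → Codeword w → Codeword (v +ʷ w)
      neg-closed : ∀ {v} → Codeword v → Codeword (-ʷ v)

  words : ∀ n → List (Word n)
  words zero    = [] ∷ []
  words (suc n) = cartesianProductWith _∷_ (allFin m) (words n)

  ∈-words : ∀ {n} (w : Word n) → w ∈ words n
  ∈-words []      = here refl
  ∈-words (a ∷ w) = ∈-cartesianProductWith⁺ _∷_ (∈-allFin a) (∈-words w)

  codewords : ∀ {n} → LinearCode n → List (Word n)
  codewords {n} C = filter (LinearCode.codeword? C) (words n)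

  data Generated {k n} (G : Vec (Word n) k) : Pred (Word n) 0ℓ where
    row  : ∀ i → Generated G (lookup G i)
    zero : Generated G 0ʷ
    add  : ∀ {v w} → Generated G v → Generated G w → Generated G (v +ʷ w)
    neg  : ∀ {v} → Generated G v → Generated G (-ʷ v)

  _*ʷ_ : ∀ {n} → Fin m → Word n → Word n
  a *ʷ w = Vec.map (a ⊗_) w

  -- Membership in the generated code is decided by running through the
  -- linear combinations of the rows.
  combination : ∀ {k n} → Word k → Vec (Word n) k → Word n
  combination []      []      = 0ʷ
  combination (a ∷ c) (g ∷ G) = a *ʷ g +ʷ combination c G

  +ʷ-comm : ∀ {n} (v w : Word n) → v +ʷ w ≡ w +ʷ v
  +ʷ-comm = Vec.zipWith-comm ⊕-comm

  +ʷ-assoc : ∀ {n} (u v w : Word n) → (u +ʷ v) +ʷ w ≡ u +ʷ (v +ʷ w)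
  +ʷ-assoc = Vec.zipWith-assoc ⊕-assoc

  +ʷ-identityˡ : ∀ {n} (w : Word n) → 0ʷ +ʷ w ≡ w
  +ʷ-identityˡ = Vec.zipWith-identityˡ ⊕-identityˡ

  -ʷ-inverseˡ : ∀ {n} (w : Word n) → -ʷ w +ʷ w ≡ 0ʷ
  -ʷ-inverseˡ = Vec.zipWith-inverseˡ ⊖-inverseˡ

  +ʷ-identityʳ : ∀ {n} (w : Word n) → w +ʷ 0ʷ ≡ w
  +ʷ-identityʳ w = trans (+ʷ-comm w 0ʷ) (+ʷ-identityˡ w)

  inverse-unique : ∀ {n} (v w : Word n) → v +ʷ w ≡ 0ʷ → v ≡ -ʷ w
  inverse-unique v w eq = begin
    v                      ≡⟨ +ʷ-identityʳ v ⟨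
    v +ʷ 0ʷ                ≡⟨ cong (v +ʷ_) (trans (+ʷ-comm w (-ʷ w)) (-ʷ-inverseˡ w)) ⟨
    v +ʷ (w +ʷ -ʷ w)       ≡⟨ +ʷ-assoc v w (-ʷ w) ⟨
    (v +ʷ w) +ʷ -ʷ w       ≡⟨ cong (_+ʷ -ʷ w) eq ⟩
    0ʷ +ʷ -ʷ w             ≡⟨ +ʷ-identityˡ (-ʷ w) ⟩
    -ʷ w                   ∎
    where open ≡-Reasoning

  +ʷ-interchange : ∀ {n} (s t u v : Word n) → (s +ʷ t) +ʷ (u +ʷ v) ≡ (s +ʷ u) +ʷ (t +ʷ v)
  +ʷ-interchange s t u v = begin
    (s +ʷ t) +ʷ (u +ʷ v)     ≡⟨ +ʷ-assoc s t (u +ʷ v) ⟩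
    s +ʷ (t +ʷ (u +ʷ v))     ≡⟨ cong (s +ʷ_) (+ʷ-assoc t u v) ⟨
    s +ʷ ((t +ʷ u) +ʷ v)     ≡⟨ cong (λ w → s +ʷ (w +ʷ v)) (+ʷ-comm t u) ⟩
    s +ʷ ((u +ʷ t) +ʷ v)     ≡⟨ cong (s +ʷ_) (+ʷ-assoc u t v) ⟩
    s +ʷ (u +ʷ (t +ʷ v))     ≡⟨ +ʷ-assoc s u (t +ʷ v) ⟨
    (s +ʷ u) +ʷ (t +ʷ v)     ∎
    where open ≡-Reasoning

  ⊕-*ʷ : ∀ {n} a b (w : Word n) → (a ⊕ b) *ʷ w ≡ a *ʷ w +ʷ b *ʷ w
  ⊕-*ʷ a b []      = refl
  ⊕-*ʷ a b (d ∷ w) = cong₂ _∷_ (⊗-distribʳ-⊕ a b d) (⊕-*ʷ a b w)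

  𝟘-*ʷ : ∀ {n} (w : Word n) → 𝟘 *ʷ w ≡ 0ʷ
  𝟘-*ʷ []      = refl
  𝟘-*ʷ (d ∷ w) = cong₂ _∷_ (𝟘-⊗ d) (𝟘-*ʷ w)

  𝟙-*ʷ : ∀ {n} (w : Word n) → [ 1 ] *ʷ w ≡ w
  𝟙-*ʷ []      = refl
  𝟙-*ʷ (d ∷ w) = cong₂ _∷_ (𝟙-⊗ d) (𝟙-*ʷ w)

  combination-+ : ∀ {k n} (c d : Word k) (G : Vec (Word n) k) →
    combination (c +ʷ d) G ≡ combination c G +ʷ combination d G
  combination-+ []      []      []      = sym (+ʷ-identityˡ 0ʷ)
  combination-+ (a ∷ c) (b ∷ d) (g ∷ G) = trans
    (cong₂ _+ʷ_ (⊕-*ʷ a b g) (combination-+ c d G))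
    (+ʷ-interchange (a *ʷ g) (b *ʷ g) (combination c G) (combination d G))

  combination-0 : ∀ {k n} (G : Vec (Word n) k) → combination 0ʷ G ≡ 0ʷ
  combination-0 []      = refl
  combination-0 (g ∷ G) = trans (cong₂ _+ʷ_ (𝟘-*ʷ g) (combination-0 G)) (+ʷ-identityˡ 0ʷ)

  combination-neg : ∀ {k n} (c : Word k) (G : Vec (Word n) k) → combination (-ʷ c) G ≡ -ʷ combination c G
  combination-neg c G = inverse-unique _ _ (trans (sym (combination-+ (-ʷ c) c G))
    (trans (cong (λ d → combination d G) (-ʷ-inverseˡ c)) (combination-0 G)))

  combination-row : ∀ {k n} (G : Vec (Word n) k) i → ∃ λ c → combination c G ≡ lookup G i
  combination-row (g ∷ G) Fin.zero    = [ 1 ] ∷ 0ʷ ,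
    trans (cong₂ _+ʷ_ (𝟙-*ʷ g) (combination-0 G)) (+ʷ-identityʳ g)
  combination-row (g ∷ G) (Fin.suc i) = let c , eq = combination-row G i in 𝟘 ∷ c ,
    trans (cong₂ _+ʷ_ (𝟘-*ʷ g) eq) (+ʷ-identityˡ (lookup G i))

  generated⇒combination : ∀ {k n} {G : Vec (Word n) k} {w} → Generated G w → ∃ λ c → combination c G ≡ w
  generated⇒combination {G = G} (row i) = combination-row G i
  generated⇒combination {G = G} zero = 0ʷ , combination-0 G
  generated⇒combination {G = G} (add p q) =
    let c , eq = generated⇒combination p ; d , eq′ = generated⇒combination q
    in c +ʷ d , trans (combination-+ c d G) (cong₂ _+ʷ_ eq eq′)
  generated⇒combination {G = G} (neg p) =
    let c , eq = generated⇒combination p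
    in -ʷ c , trans (combination-neg c G) (cong -ʷ_ eq)

  generated-multiple : ∀ {k n} {G : Vec (Word n) k} {w} j → Generated G w → Generated G ([ j ] *ʷ w)
  generated-multiple {G = G} {w} zero    p = subst (Generated G) (sym (𝟘-*ʷ w)) zero
  generated-multiple {G = G} {w} (suc j) p = subst (Generated G) eq (add p (generated-multiple j p))
    where
    eq : w +ʷ [ j ] *ʷ w ≡ [ suc j ] *ʷ w
    eq = trans (cong (_+ʷ [ j ] *ʷ w) (sym (𝟙-*ʷ w)))
      (trans (sym (⊕-*ʷ [ 1 ] [ j ] w)) (cong (_*ʷ w) ([]-+ 1 j)))

  generated-mono : ∀ {k n} {g : Word n} {G : Vec (Word n) k} {w} → Generated G w → Generated (g ∷ G) w
  generated-mono (row i)   = row (Fin.suc i)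
  generated-mono zero      = zero
  generated-mono (add p q) = add (generated-mono p) (generated-mono q)
  generated-mono (neg p)   = neg (generated-mono p)

  combination⇒generated : ∀ {k n} (c : Word k) (G : Vec (Word n) k) → Generated G (combination c G)
  combination⇒generated []      []      = zero
  combination⇒generated (a ∷ c) (g ∷ G) = add
    (subst (λ b → Generated (g ∷ G) (b *ʷ g)) ([]-toℕ a) (generated-multiple (toℕ a) (row Fin.zero)))
    (generated-mono (combination⇒generated c G))

  generated? : ∀ {k n} (G : Vec (Word n) k) → Decidable (Generated G)
  generated? G w = map′
    (λ any → let c , _ , eq = find any in subst (Generated G) eq (combination⇒generated c G))
    (λ p → let c , eq = generated⇒combination p in lose (∈-words c) eq)
    (any? (λ c → Vec.≡-dec Fin._≟_ (combination c G) w) (words _))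

  generatedBy : ∀ {k n} → Vec (Word n) k → LinearCode n
  generatedBy G = record
    { Codeword   = Generated G
    ; codeword?  = generated? G
    ; 0-closed   = zero
    ; +-closed   = add
    ; neg-closed = neg
    }

open ℤ/ using (Word; LinearCode; generatedBy; codewords) public

------------------------------------------------------------------------
-- Symmetrized weight enumerators of pairs of codes over ℤ/2 and ℤ/4

R : Set
R = Fin 2 × Fin 4

-ᴿ_ : R → R
-ᴿ (a , b) = ℤ/.⊖_ 2 a , ℤ/.⊖_ 4 b

infix 4 _∼_ _∼?_
infix 8 -ᴿ_

_∼_ : R → R → Set
r ∼ s = r ≡ s ⊎ r ≡ -ᴿ s

_∼?_ : ∀ r s → Dec (r ∼ s)
r ∼? s = (r ≟ s) ⊎-dec (r ≟ (-ᴿ s))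
  where _≟_ = ×-≡-dec Fin._≟_ Fin._≟_

-- The six classes of R under _∼_, in the order of the variables a, …, f.
representative : Fin 6 → R
representative 0F = 0F , 0F
representative 1F = 0F , 1F
representative 2F = 0F , 2F
representative 3F = 1F , 0F
representative 4F = 1F , 1F
representative 5F = 1F , 2F

multiplicity : ∀ {n} → Fin 6 → Word 2 n → Word 4 n → ℕ
multiplicity i u v = count (_∼? representative i) (zip u v)

module WeightEnumerator {c ℓ} (K : CommutativeRing c ℓ) where

  open Polynomials K 6

  weightEnumerator : ∀ {n} → LinearCode 2 n → LinearCode 4 n → Poly
  weightEnumerator C₁ C₂ =
    concatMap (λ (u , v) → ∏ₚ λ i → var i ^ₚ multiplicity i u v)
      (cartesianProduct (codewords 2 C₁) (codewords 4 C₂))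

------------------------------------------------------------------------
-- The group H and the codes ℰ₈, 𝒬₈, 𝒦₈

open Polynomials ℂ-commutativeRing 6 public
open Basis ℂ-commutativeRing polyRawModule public
open WeightEnumerator ℂ-commutativeRing public

pattern 2ℤ  = + 2
pattern -2ℤ = -[1+ 1 ]

scaledRows : ℂ → Vec (Vec ℤ 6) 6 → Matrix
scaledRows a rows i j = a *ᶜ ℤ⇒ℂ (lookup (lookup rows i) j)

X P₁ P₂ E₁ E₂ : Matrix

X = scaledRows ((z ^ᶜ 3 +ᶜ z) *ᶜ ℚ⇒ℂ (1ℤ ℚ./ 4))
  ( (1ℤ ∷  2ℤ ∷  1ℤ ∷  1ℤ ∷  2ℤ ∷  1ℤ ∷ [])
  ∷ (1ℤ ∷  0ℤ ∷ -1ℤ ∷  1ℤ ∷  0ℤ ∷ -1ℤ ∷ [])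
  ∷ (1ℤ ∷ -2ℤ ∷  1ℤ ∷  1ℤ ∷ -2ℤ ∷  1ℤ ∷ [])
  ∷ (1ℤ ∷  2ℤ ∷  1ℤ ∷ -1ℤ ∷ -2ℤ ∷ -1ℤ ∷ [])
  ∷ (1ℤ ∷  0ℤ ∷ -1ℤ ∷ -1ℤ ∷  0ℤ ∷  1ℤ ∷ [])
  ∷ (1ℤ ∷ -2ℤ ∷  1ℤ ∷ -1ℤ ∷  2ℤ ∷ -1ℤ ∷ [])
  ∷ [])

P₁ = scaledRows 1ᶜ
  ( (1ℤ ∷ 0ℤ ∷ 0ℤ ∷ 0ℤ ∷ 0ℤ ∷ 0ℤ ∷ [])
  ∷ (0ℤ ∷ 0ℤ ∷ 0ℤ ∷ 0ℤ ∷ 1ℤ ∷ 0ℤ ∷ [])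
  ∷ (0ℤ ∷ 0ℤ ∷ 1ℤ ∷ 0ℤ ∷ 0ℤ ∷ 0ℤ ∷ [])
  ∷ (0ℤ ∷ 0ℤ ∷ 0ℤ ∷ 1ℤ ∷ 0ℤ ∷ 0ℤ ∷ [])
  ∷ (0ℤ ∷ 1ℤ ∷ 0ℤ ∷ 0ℤ ∷ 0ℤ ∷ 0ℤ ∷ [])
  ∷ (0ℤ ∷ 0ℤ ∷ 0ℤ ∷ 0ℤ ∷ 0ℤ ∷ 1ℤ ∷ [])
  ∷ [])

P₂ = scaledRows (z ^ᶜ 2)
  ( (1ℤ ∷ 0ℤ ∷ 0ℤ ∷ 0ℤ ∷ 0ℤ ∷ 0ℤ ∷ [])
  ∷ (0ℤ ∷ 0ℤ ∷ 0ℤ ∷ 0ℤ ∷ 1ℤ ∷ 0ℤ ∷ [])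
  ∷ (0ℤ ∷ 0ℤ ∷ 1ℤ ∷ 0ℤ ∷ 0ℤ ∷ 0ℤ ∷ [])
  ∷ (0ℤ ∷ 0ℤ ∷ 0ℤ ∷ 0ℤ ∷ 0ℤ ∷ 1ℤ ∷ [])
  ∷ (0ℤ ∷ 1ℤ ∷ 0ℤ ∷ 0ℤ ∷ 0ℤ ∷ 0ℤ ∷ [])
  ∷ (0ℤ ∷ 0ℤ ∷ 0ℤ ∷ 1ℤ ∷ 0ℤ ∷ 0ℤ ∷ [])
  ∷ [])

E₁ = diagonal (lookup (1ᶜ ∷ z ∷ -ᶜ 1ᶜ ∷ z ^ᶜ 2 ∷ -ᶜ (z ^ᶜ 3) ∷ -ᶜ (z ^ᶜ 2) ∷ []))
E₂ = diagonal (lookup (1ᶜ ∷ z ∷ -ᶜ 1ᶜ ∷ 1ᶜ ∷ z ∷ -ᶜ 1ᶜ ∷ []))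

H : Pred Matrix 0ℓ
H = ⟨ lookup (X ∷ P₁ ∷ P₂ ∷ E₁ ∷ E₂ ∷ scalar z ∷ []) ⟩

ℰ₈ : LinearCode 2 8
ℰ₈ = generatedBy 2
  ( (1F ∷ 1F ∷ 1F ∷ 1F ∷ 0F ∷ 0F ∷ 0F ∷ 0F ∷ [])
  ∷ (0F ∷ 0F ∷ 1F ∷ 1F ∷ 1F ∷ 1F ∷ 0F ∷ 0F ∷ [])
  ∷ (0F ∷ 0F ∷ 0F ∷ 0F ∷ 1F ∷ 1F ∷ 1F ∷ 1F ∷ [])
  ∷ (1F ∷ 0F ∷ 1F ∷ 0F ∷ 1F ∷ 0F ∷ 1F ∷ 0F ∷ [])
  ∷ [])

𝒬₈ : LinearCode 4 8
𝒬₈ = generatedBy 4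
  ( (0F ∷ 0F ∷ 1F ∷ 1F ∷ 0F ∷ 2F ∷ 1F ∷ 3F ∷ [])
  ∷ (0F ∷ 0F ∷ 0F ∷ 2F ∷ 1F ∷ 3F ∷ 1F ∷ 1F ∷ [])
  ∷ (1F ∷ 1F ∷ 0F ∷ 2F ∷ 0F ∷ 0F ∷ 1F ∷ 3F ∷ [])
  ∷ (0F ∷ 2F ∷ 0F ∷ 2F ∷ 0F ∷ 2F ∷ 0F ∷ 2F ∷ [])
  ∷ (0F ∷ 0F ∷ 0F ∷ 0F ∷ 0F ∷ 0F ∷ 2F ∷ 2F ∷ [])
  ∷ [])

𝒦₈ : LinearCode 4 8
𝒦₈ = generatedBy 4
  ( (1F ∷ 1F ∷ 1F ∷ 1F ∷ 1F ∷ 1F ∷ 1F ∷ 1F ∷ [])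
  ∷ (0F ∷ 2F ∷ 0F ∷ 0F ∷ 0F ∷ 0F ∷ 0F ∷ 2F ∷ [])
  ∷ (0F ∷ 0F ∷ 2F ∷ 0F ∷ 0F ∷ 0F ∷ 0F ∷ 2F ∷ [])
  ∷ (0F ∷ 0F ∷ 0F ∷ 2F ∷ 0F ∷ 0F ∷ 0F ∷ 2F ∷ [])
  ∷ (0F ∷ 0F ∷ 0F ∷ 0F ∷ 2F ∷ 0F ∷ 0F ∷ 2F ∷ [])
  ∷ (0F ∷ 0F ∷ 0F ∷ 0F ∷ 0F ∷ 2F ∷ 0F ∷ 2F ∷ [])
  ∷ (0F ∷ 0F ∷ 0F ∷ 0F ∷ 0F ∷ 0F ∷ 2F ∷ 2F ∷ [])
  ∷ [])

-- X = ξ X′ with X′ an integer matrix and ξ⁸ = 1/4096, so in degree 8 invariance under X is the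
-- integral identity f(X′x) = 4096 f(x); X′ is the product of the MacWilliams transforms of the two
-- coordinates.  The two weight enumerators are expanded by running through the codewords, and
-- their invariance under the generators of H is then checked on the integer coefficients, those
-- of E₁, E₂ and z I₆ through the divisibility by 8 of certain weights of the monomials.
--
-- Conversely let f be an invariant of degree 8.  Since z⁴ = −1, E₁ and E₂ kill all but 46 of its
-- coefficients.  Evaluating f(X′q) = 4096 f(q) at integer points q gives integral linear relations
-- between these, and by elimination two coefficients determine all the others.  The 2 × 2 matrix
-- of these two coefficients of the weight enumerators is invertible.

module Submission where

open import Algebra.Bundles using (CommutativeRing; CommutativeSemiring; Semiring)
open import Algebra.Bundles.Raw using (RawSemiring)
import Algebra.Definitions.RawSemiring as RawSemiringDefinitions
import Algebra.Morphism.Construct.Composition as Composition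
import Algebra.Morphism.Construct.Identity as Identity
open import Algebra.Morphism.Structures using (module SemiringMorphisms)
import Algebra.Properties.CommutativeMonoid.Sum
import Algebra.Properties.CommutativeSemigroup
import Algebra.Properties.CommutativeSemiring.Exp
import Algebra.Properties.Semiring.Sum
open import Algebra.Structures.Biased using (isCommutativeSemiringˡ)
open import Data.Bool.Base using (Bool; true; false; T; _∧_; if_then_else_)
open import Data.Bool.Properties using (T-∧; T-≡)
open import Data.Fin.Base using (Fin; zero; suc)
open import Data.Fin.Patterns using (0F; 1F; 2F; 3F; 4F; 5F)
import Data.Fin.Properties as Fin
open import Data.Integer.Base as ℤ using (ℤ; +_; -[1+_]; 0ℤ; 1ℤ; -1ℤ)
import Data.Integer.Properties as ℤ
import Data.Integer.Solver
open import Data.List.Base using (List; []; _∷_; _++_; map; concatMap; filter; deduplicate; foldr; cartesianProduct; cartesianProductWith; allFin; upTo)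
import Data.List.Membership.DecPropositional as DecMembership
open import Data.List.Membership.Propositional using (_∈_; _∉_; lose)
open import Data.List.Membership.Propositional.Properties
  using ( ∈-++⁺ˡ; ∈-++⁺ʳ; ∈-allFin; ∈-cartesianProduct⁺; ∈-cartesianProduct⁻; ∈-cartesianProductWith⁺; ∈-cartesianProductWith⁻
        ; ∈-deduplicate⁺; ∈-deduplicate⁻; ∈-filter⁺; ∈-filter⁻; ∈-map⁺; ∈-concatMap⁺; ∈-upTo⁺)
open import Data.List.Membership.Propositional.Properties.WithK using (unique∧set⇒bag)
import Data.List.Properties as List
open import Data.List.Relation.Binary.BagAndSetEquality using (∼bag⇒↭)
open import Data.List.Relation.Binary.Permutation.Propositional as ↭ using (_↭_)
open import Data.List.Relation.Unary.All as All using (All; []; _∷_)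
import Data.List.Relation.Unary.AllPairs as AllPairs
open import Data.List.Relation.Unary.Any using (here; there)
import Data.List.Relation.Unary.Unique.DecPropositional.Properties as DecUnique
open import Data.List.Relation.Unary.Unique.Propositional using (Unique)
import Data.List.Relation.Unary.Unique.Propositional.Properties as Unique
open import Data.Nat.Base as ℕ using (ℕ; nonZero)
open import Data.Nat.DivMod using (_%_; _/_; m≡m%n+[m/n]*n; m%n<n)
import Data.Nat.Properties as ℕ
import Data.Nat.Solver
open import Data.Product.Base using (∃; _×_; _,_; proj₁; proj₂)
open import Data.Rational.Base as ℚ using (ℚ; 0ℚ; 1ℚ; ½; ∣_∣)
import Data.Rational.Properties as ℚ
import Data.Rational.Solver
import Data.Rational.Unnormalised.Base as ℚᵘ
import Data.Rational.Unnormalised.Properties as ℚᵘ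
open import Data.Unit.Base using (⊤; tt)
open import Data.Vec.Base as Vec using (Vec; []; _∷_; lookup; replicate; tabulate; zipWith)
import Data.Vec.Properties as Vec
open import Function.Base using (_∘_)
open import Function.Bundles using (_⇔_; mk⇔; module Equivalence)
open import Function.Construct.Identity using (⇔-id)
open import Level using (0ℓ)
open import Relation.Binary.Definitions using (DecidableEquality)
open import Relation.Binary.PropositionalEquality as ≡ using (_≡_; _≢_)
import Relation.Binary.Reasoning.Setoid as SetoidReasoning
open import Relation.Binary.Structures using (IsEquivalence)
open import Relation.Nullary using (Dec; contradiction; does; no; yes)
open import Relation.Nullary.Decidable using (⌊_⌋; dec-true; dec-false; ¬?; toWitness; _×-dec_; _→-dec_)

open import Defs using (module Polynomials)

-- Equality of Cauchy sequences cannot be decided, so no step may compute with complex coefficients.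
-- Whatever has to be evaluated is therefore stated over ℤ and carried to ℂ along `ℤ⇒ℂ`; the
-- irrational numbers survive only in a few scalar identities that follow from z² = i, and division
-- is only ever by integers. A second obstacle is that a polynomial is an uncollected list of terms,
-- compared by coefficients. That products, evaluation and the matrix action respect this equality
-- has to be proved, and the action on monomials is hard to follow coefficient by coefficient. Both
-- are handled by linear functionals: a K-linear map out of the polynomials is fixed by its values
-- on monomials, and evaluation, substitution and the action of a matrix are all instances. The
-- number 4096 is 16 · 256, the numbers of words of the binary and of a quaternary code: the
-- MacWilliams identity of a self-dual code multiplies its enumerator by its number of words.
-- Splitting X′ in two also keeps the substituted forms at two and three terms, where X′ has rows of
-- six.

unit : ∀ {n} → Fin n → Vec ℕ n
unit i = tabulate λ j → if does (i Fin.≟ j) then 1 else 0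

-- Monomials in commutative semirings, and semiring homomorphisms

module Powers {c ℓ} (R : RawSemiring c ℓ) where
  open RawSemiring R using (Carrier)
  open RawSemiringDefinitions R using (product; _^_)

  power : ∀ {n} → (Fin n → Carrier) → Vec ℕ n → Carrier
  power p α = product λ i → p i ^ lookup α i

module CommutativeSemiringLemmas {c ℓ} (S : CommutativeSemiring c ℓ) where
  open CommutativeSemiring S public hiding (zero)
  open RawSemiringDefinitions rawSemiring public using (sum; product; _^_)
  open Powers rawSemiring public
  open Algebra.Properties.Semiring.Sum semiring public
    using (*-distribˡ-sum; *-distribʳ-sum; ∑-comm) renaming (sum-cong-≋ to sum-cong; ∑-distrib-+ to sum-+)
  open Algebra.Properties.CommutativeMonoid.Sum *-commutativeMonoid public
    using () renaming (sum-cong-≋ to product-cong; ∑-distrib-+ to product-*)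
  open Algebra.Properties.CommutativeSemiring.Exp S public using (^-homo-*; ^-congˡ; ^-distrib-*; ^-assocʳ)
  open Algebra.Properties.CommutativeSemigroup +-commutativeSemigroup public
    using () renaming (interchange to +-interchange)
  open Algebra.Properties.CommutativeSemigroup *-commutativeSemigroup public
    using () renaming (interchange to *-interchange; x∙yz≈y∙xz to x*yz≈y*xz)

  product-1 : ∀ {n} (f : Fin n → Carrier) → (∀ i → f i ≈ 1#) → product f ≈ 1#
  product-1 {ℕ.zero}  f f≈1 = refl
  product-1 {ℕ.suc n} f f≈1 = trans (*-cong (f≈1 zero) (product-1 (f ∘ suc) (f≈1 ∘ suc))) (*-identityˡ 1#)

  sum-0 : ∀ {n} (f : Fin n → Carrier) → (∀ i → f i ≈ 0#) → sum f ≈ 0#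
  sum-0 {ℕ.zero}  f f≈0 = refl
  sum-0 {ℕ.suc n} f f≈0 = trans (+-cong (f≈0 zero) (sum-0 (f ∘ suc) (f≈0 ∘ suc))) (+-identityˡ 0#)

  sum-single : ∀ {n} (f : Fin n → Carrier) i → (∀ j → i ≢ j → f j ≈ 0#) → sum f ≈ f i
  sum-single f zero    f≈0 = trans (+-congˡ (sum-0 (f ∘ suc) (λ j → f≈0 (suc j) λ ()))) (+-identityʳ (f zero))
  sum-single f (suc i) f≈0 = trans
    (+-cong (f≈0 zero λ ()) (sum-single (f ∘ suc) i (λ j i≢j → f≈0 (suc j) (i≢j ∘ Fin.suc-injective))))
    (+-identityˡ (f (suc i)))

  product-single : ∀ {n} (f : Fin n → Carrier) i → (∀ j → i ≢ j → f j ≈ 1#) → product f ≈ f i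
  product-single f zero    f≈1 = trans (*-congˡ (product-1 (f ∘ suc) (λ j → f≈1 (suc j) λ ()))) (*-identityʳ (f zero))
  product-single f (suc i) f≈1 = trans
    (*-cong (f≈1 zero λ ()) (product-single (f ∘ suc) i (λ j i≢j → f≈1 (suc j) (i≢j ∘ Fin.suc-injective))))
    (*-identityˡ (f (suc i)))

  power-cong : ∀ {n} {p q : Fin n → Carrier} → (∀ i → p i ≈ q i) → ∀ α → power p α ≈ power q α
  power-cong p≈q α = product-cong λ i → ^-congˡ (lookup α i) (p≈q i)

  power-0 : ∀ {n} (p : Fin n → Carrier) → power p (replicate n 0) ≈ 1#
  power-0 {n} p = product-1 (λ i → p i ^ lookup (replicate n 0) i)
    λ i → reflexive (≡.cong (p i ^_) (Vec.lookup-replicate i 0))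

  power-+ : ∀ {n} (p : Fin n → Carrier) α β → power p (zipWith ℕ._+_ α β) ≈ power p α * power p β
  power-+ p α β = trans
    (product-cong λ i → trans (reflexive (≡.cong (p i ^_) (Vec.lookup-zipWith ℕ._+_ i α β)))
      (^-homo-* (p i) (lookup α i) (lookup β i)))
    (product-* (λ i → p i ^ lookup α i) (λ i → p i ^ lookup β i))

  power-* : ∀ {n} (p q : Fin n → Carrier) α → power (λ i → p i * q i) α ≈ power p α * power q α
  power-* p q α = trans (product-cong λ i → ^-distrib-* (p i) (q i) (lookup α i))
    (product-* (λ i → p i ^ lookup α i) (λ i → q i ^ lookup α i))

  power-unit : ∀ {n} (p : Fin n → Carrier) i → power p (unit i) ≈ p i
  power-unit p i = trans
    (product-single (λ j → p j ^ lookup (unit i) j) i λ j i≢j → reflexive (≡.cong (p j ^_)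
      (≡.trans (Vec.lookup∘tabulate _ j) (≡.cong (if_then 1 else 0) (dec-false (i Fin.≟ j) i≢j)))))
    (trans (reflexive (≡.cong (p i ^_)
      (≡.trans (Vec.lookup∘tabulate _ i) (≡.cong (if_then 1 else 0) (dec-true (i Fin.≟ i) ≡.refl)))))
      (*-identityʳ (p i)))

  power-const : ∀ {n} x (α : Vec ℕ n) → power (λ _ → x) α ≈ x ^ Vec.sum α
  power-const x []      = refl
  power-const x (i ∷ α) = trans (*-congˡ (power-const x α)) (sym (^-homo-* x i (Vec.sum α)))

  -- Used with x = z: on a monomial, a diagonal matrix of powers of z acts by a single power of z,
  -- whose exponent modulo 8 decides invariance.
  power-^ : ∀ {n} x (k α : Vec ℕ n) → power (λ i → x ^ lookup k i) α ≈ x ^ Vec.sum (zipWith ℕ._*_ k α)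
  power-^ x []      []      = refl
  power-^ x (k ∷ ks) (i ∷ α) = trans (*-cong (^-assocʳ x k i) (power-^ x ks α))
    (sym (^-homo-* x (k ℕ.* i) (Vec.sum (zipWith ℕ._*_ ks α))))

  -- The exponents are the free commutative monoid on the vectors unit i.
  multiplicative⇒power : ∀ n (m : Vec ℕ n → Carrier) → m (replicate n 0) ≈ 1# →
    (∀ α β → m (zipWith ℕ._+_ α β) ≈ m α * m β) → ∀ α → m α ≈ power (m ∘ unit) α
  multiplicative⇒power ℕ.zero    m m-0 m-+ []      = m-0
  multiplicative⇒power (ℕ.suc n) m m-0 m-+ (k ∷ α) = begin
    m (k ∷ α)
      ≡⟨ ≡.cong m (≡.cong₂ _∷_ (ℕ.+-identityʳ k) (Vec.zipWith-identityˡ (λ _ → ≡.refl) α)) ⟨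
    m (zipWith ℕ._+_ (k ∷ replicate n 0) (0 ∷ α))
      ≈⟨ m-+ (k ∷ replicate n 0) (0 ∷ α) ⟩
    m (k ∷ replicate n 0) * m (0 ∷ α)
      ≈⟨ *-cong (first k) (multiplicative⇒power n (m ∘ (0 ∷_)) m-0 (λ α β → m-+ (0 ∷ α) (0 ∷ β)) α) ⟩
    power (m ∘ unit) (k ∷ α)   ∎
    where
    open SetoidReasoning setoid
    first : ∀ k → m (k ∷ replicate n 0) ≈ m (unit zero) ^ k
    first ℕ.zero    = m-0
    first (ℕ.suc k) = begin
      m (ℕ.suc k ∷ replicate n 0)
        -- `unit zero` unfolds to `1 ∷ tabulate (λ _ → 0)`, not to a vector ending in
        -- `replicate n 0`.
        ≡⟨ ≡.cong (λ β → m (ℕ.suc k ∷ β)) (≡.trans (Vec.zipWith-identityʳ ℕ.+-identityʳ _) (≡.sym (replicate-tabulate n))) ⟨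
      m (zipWith ℕ._+_ (unit zero) (k ∷ replicate n 0))
        ≈⟨ m-+ (unit zero) (k ∷ replicate n 0) ⟩
      m (unit zero) * m (k ∷ replicate n 0)
        ≈⟨ *-congˡ (first k) ⟩
      m (unit zero) ^ ℕ.suc k   ∎
      where
      replicate-tabulate : ∀ n → replicate n 0 ≡ tabulate (λ _ → 0)
      replicate-tabulate ℕ.zero    = ≡.refl
      replicate-tabulate (ℕ.suc n) = ≡.cong (0 ∷_) (replicate-tabulate n)

-- The source is left raw because nested lists of coefficients obey the semiring laws only up to
-- trailing zeros, while `nestedRawSemiring` compares them by `_≡_`.
module SemiringHomomorphismLemmas {a ℓa b ℓb} (R : RawSemiring a ℓa) (S : CommutativeSemiring b ℓb)
  {h} (homo : SemiringMorphisms.IsSemiringHomomorphism R (CommutativeSemiring.rawSemiring S) h) where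

  private
    module R where
      open RawSemiring R public using (Carrier)
      open RawSemiringDefinitions R public using (sum; product; _^_)
      open Powers R public
  open CommutativeSemiringLemmas S
  open SemiringMorphisms.IsSemiringHomomorphism homo

  sum-homo : ∀ {n} (f : Fin n → R.Carrier) → h (R.sum f) ≈ sum (h ∘ f)
  sum-homo {ℕ.zero}  f = 0#-homo
  sum-homo {ℕ.suc n} f = trans (+-homo (f zero) (R.sum (f ∘ suc))) (+-congˡ (sum-homo (f ∘ suc)))

  product-homo : ∀ {n} (f : Fin n → R.Carrier) → h (R.product f) ≈ product (h ∘ f)
  product-homo {ℕ.zero}  f = 1#-homo
  product-homo {ℕ.suc n} f = trans (*-homo (f zero) (R.product (f ∘ suc))) (*-congˡ (product-homo (f ∘ suc)))

  ^-homo : ∀ x n → h (x R.^ n) ≈ h x ^ n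
  ^-homo x ℕ.zero    = 1#-homo
  ^-homo x (ℕ.suc n) = trans (*-homo x (x R.^ n)) (*-congˡ (^-homo x n))

  power-homo : ∀ {n} (p : Fin n → R.Carrier) α → h (R.power p α) ≈ power (h ∘ p) α
  power-homo p α = trans (product-homo λ i → p i R.^ lookup α i) (product-cong λ i → ^-homo (p i) (lookup α i))

infix 4 _≟ₑ_
_≟ₑ_ : ∀ {n} → DecidableEquality (Vec ℕ n)
_≟ₑ_ = Vec.≡-dec ℕ._≟_

-- Polynomials as a commutative semiring

-- A K-linear map out of the polynomials is determined by its values φ α on the monomials.
module LinearExtension {c ℓ} (K : CommutativeRing c ℓ) (n : ℕ) {s ℓs} (S : CommutativeSemiring s ℓs)
  {ι} (ι-homo : SemiringMorphisms.IsSemiringHomomorphism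
    (Semiring.rawSemiring (CommutativeRing.semiring K)) (CommutativeSemiring.rawSemiring S) ι) where

  open Polynomials K n
  private module K = CommutativeRing K
  open CommutativeSemiringLemmas S
  open SemiringMorphisms.IsSemiringHomomorphism ι-homo using ()
    renaming (⟦⟧-cong to ι-cong; +-homo to ι-+; *-homo to ι-*; 0#-homo to ι-0; 1#-homo to ι-1)
  open SetoidReasoning setoid

  extend : (Exponents → Carrier) → Poly → Carrier
  extend φ []            = 0#
  extend φ ((a , α) ∷ f) = ι a * φ α + extend φ f

  sumOver : (Exponents → Carrier) → List Exponents → Carrier
  sumOver φ []       = 0#
  sumOver φ (α ∷ αs) = φ α + sumOver φ αs

  sumOver-0 : ∀ {φ} αs → (∀ {α} → α ∈ αs → φ α ≈ 0#) → sumOver φ αs ≈ 0#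
  sumOver-0 []       φ≈0 = refl
  sumOver-0 (α ∷ αs) φ≈0 = trans (+-cong (φ≈0 (here ≡.refl)) (sumOver-0 αs (φ≈0 ∘ there))) (+-identityˡ 0#)

  sumOver-cong : ∀ {φ ψ} αs → (∀ α → φ α ≈ ψ α) → sumOver φ αs ≈ sumOver ψ αs
  sumOver-cong []       φ≈ψ = refl
  sumOver-cong (α ∷ αs) φ≈ψ = +-cong (φ≈ψ α) (sumOver-cong αs φ≈ψ)

  sumOver-+ : ∀ φ ψ αs → sumOver (λ α → φ α + ψ α) αs ≈ sumOver φ αs + sumOver ψ αs
  sumOver-+ φ ψ []       = sym (+-identityˡ 0#)
  sumOver-+ φ ψ (α ∷ αs) = trans (+-congˡ (sumOver-+ φ ψ αs)) (+-interchange _ _ _ _)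

  sumOver-++ : ∀ φ αs βs → sumOver φ (αs ++ βs) ≈ sumOver φ αs + sumOver φ βs
  sumOver-++ φ []       βs = sym (+-identityˡ _)
  sumOver-++ φ (α ∷ αs) βs = trans (+-congˡ (sumOver-++ φ αs βs)) (sym (+-assoc _ _ _))

  sumOver-single : ∀ (φ : Exponents → Carrier) {αs} a β → Unique αs → β ∈ αs →
    sumOver (λ α → ι (if does (β ≟ₑ α) then a else K.0#) * φ α) αs ≈ ι a * φ β
  sumOver-single φ {α ∷ αs} a β (α∉αs AllPairs.∷ _) (here ≡.refl) = begin
    ι (if does (β ≟ₑ β) then a else K.0#) * φ β + sumOver _ αs
      ≈⟨ +-cong (*-congʳ (reflexive (≡.cong (λ b → ι (if b then a else K.0#)) (dec-true (β ≟ₑ β) ≡.refl))))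
          (sumOver-0 αs λ {γ} γ∈αs → trans (*-congʳ (trans
            (reflexive (≡.cong (λ b → ι (if b then a else K.0#)) (dec-false (β ≟ₑ γ) (All.lookup α∉αs γ∈αs)))) ι-0))
            (zeroˡ (φ γ))) ⟩
    ι a * φ β + 0#   ≈⟨ +-identityʳ _ ⟩
    ι a * φ β        ∎
  sumOver-single φ {α ∷ αs} a β (α∉αs AllPairs.∷ αs!) (there β∈αs) = begin
    ι (if does (β ≟ₑ α) then a else K.0#) * φ α + sumOver _ αs
      ≈⟨ +-cong (trans (*-congʳ (trans (reflexive (≡.cong (λ b → ι (if b then a else K.0#))
            (dec-false (β ≟ₑ α) (All.lookup α∉αs β∈αs ∘ ≡.sym)))) ι-0)) (zeroˡ (φ α)))
          (sumOver-single φ a β αs! β∈αs) ⟩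
    0# + ι a * φ β   ≈⟨ +-identityˡ _ ⟩
    ι a * φ β        ∎

  -- Regrouping the terms by monomial expresses `extend φ f`, a recursion on the list of terms,
  -- through the coefficients alone. Uniqueness of `αs` keeps a monomial from being counted twice.
  extend-expand : ∀ φ {αs} f → Unique αs → (∀ {β} → β ∈ map proj₂ f → β ∈ αs) →
    extend φ f ≈ sumOver (λ α → ι (coefficient f α) * φ α) αs
  extend-expand φ {αs} [] αs! ⊆αs = sym (sumOver-0 αs λ {α} _ → trans (*-congʳ ι-0) (zeroˡ (φ α)))
  extend-expand φ {αs} ((a , β) ∷ f) αs! ⊆αs = begin
    ι a * φ β + extend φ f
      ≈⟨ +-cong (sym (sumOver-single φ a β αs! (⊆αs (here ≡.refl)))) (extend-expand φ f αs! (⊆αs ∘ there)) ⟩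
    sumOver (λ α → ι (if does (β ≟ₑ α) then a else K.0#) * φ α) αs + sumOver (λ α → ι (coefficient f α) * φ α) αs
      ≈⟨ sumOver-+ _ _ αs ⟨
    sumOver (λ α → ι (if does (β ≟ₑ α) then a else K.0#) * φ α + ι (coefficient f α) * φ α) αs
      ≈⟨ sumOver-cong αs (λ α → trans (sym (distribʳ _ _ _)) (*-congʳ (sym (ι-+ _ _)))) ⟩
    sumOver (λ α → ι (coefficient ((a , β) ∷ f) α) * φ α) αs   ∎

  -- Terms of `f` may cancel, so monomials outside `αs` can still occur in the list. They are
  -- collected in `rest`, where every coefficient is zero.
  extend-support : ∀ φ {αs} f → Unique αs → (∀ α → α ∉ αs → coefficient f α K.≈ K.0#) →
    extend φ f ≈ sumOver (λ α → ι (coefficient f α) * φ α) αs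
  extend-support φ {αs} f αs! f≈0 = begin
    extend φ f                            ≈⟨ extend-expand φ f (Unique.++⁺ αs! rest! disjoint) covers ⟩
    sumOver ψ (αs ++ rest)                ≈⟨ sumOver-++ ψ αs rest ⟩
    sumOver ψ αs + sumOver ψ rest         ≈⟨ +-congˡ (sumOver-0 rest λ {α} α∈rest →
                                               trans (*-congʳ (trans (ι-cong (f≈0 α (rest∉αs α∈rest))) ι-0)) (zeroˡ (φ α))) ⟩
    sumOver ψ αs + 0#                     ≈⟨ +-identityʳ _ ⟩
    sumOver ψ αs                          ∎
    where
    open DecMembership _≟ₑ_ using (_∈?_)
    ψ = λ α → ι (coefficient f α) * φ α
    monomials = deduplicate _≟ₑ_ (map proj₂ f)
    rest = filter (λ α → ¬? (α ∈? αs)) monomials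
    rest! : Unique rest
    rest! = Unique.filter⁺ (λ α → ¬? (α ∈? αs)) (DecUnique.deduplicate-! _≟ₑ_ (map proj₂ f))
    rest∉αs : ∀ {α} → α ∈ rest → α ∉ αs
    rest∉αs α∈rest = proj₂ (∈-filter⁻ (λ α → ¬? (α ∈? αs)) {xs = monomials} α∈rest)
    disjoint : ∀ {α} → α ∈ αs × α ∈ rest → _
    disjoint (α∈αs , α∈rest) = rest∉αs α∈rest α∈αs
    covers : ∀ {β} → β ∈ map proj₂ f → β ∈ αs ++ rest
    covers {β} β∈f with β ∈? αs
    ... | yes β∈αs = ∈-++⁺ˡ β∈αs
    ... | no  β∉αs = ∈-++⁺ʳ αs (∈-filter⁺ (λ α → ¬? (α ∈? αs)) (∈-deduplicate⁺ _≟ₑ_ β∈f) β∉αs)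

  -- Both sides are expanded over one common list, the monomials of `f` and `g` without repetition.
  extend-congʳ : ∀ φ f g → f ≈ₚ g → extend φ f ≈ extend φ g
  extend-congʳ φ f g f≈g = begin
    extend φ f                                      ≈⟨ extend-expand φ f αs! (∈-deduplicate⁺ _≟ₑ_ ∘ ∈-++⁺ˡ) ⟩
    sumOver (λ α → ι (coefficient f α) * φ α) αs    ≈⟨ sumOver-cong αs (λ α → *-congʳ (ι-cong (f≈g α))) ⟩
    sumOver (λ α → ι (coefficient g α) * φ α) αs    ≈⟨ extend-expand φ g αs! (∈-deduplicate⁺ _≟ₑ_ ∘ ∈-++⁺ʳ (map proj₂ f)) ⟨
    extend φ g                                      ∎
    where
    αs = deduplicate _≟ₑ_ (map proj₂ f ++ map proj₂ g)
    αs! = DecUnique.deduplicate-! _≟ₑ_ (map proj₂ f ++ map proj₂ g)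

  extend-congˡ : ∀ {φ ψ} f → (∀ α → φ α ≈ ψ α) → extend φ f ≈ extend ψ f
  extend-congˡ []            φ≈ψ = refl
  extend-congˡ ((a , α) ∷ f) φ≈ψ = +-cong (*-congˡ (φ≈ψ α)) (extend-congˡ f φ≈ψ)

  extend-+ₚ : ∀ φ f g → extend φ (f +ₚ g) ≈ extend φ f + extend φ g
  extend-+ₚ φ []            g = sym (+-identityˡ _)
  extend-+ₚ φ ((a , α) ∷ f) g = trans (+-congˡ (extend-+ₚ φ f g)) (sym (+-assoc _ _ _))

  extend-∙ₚ : ∀ φ a f → extend φ (a ∙ₚ f) ≈ ι a * extend φ f
  extend-∙ₚ φ a []            = sym (zeroʳ _)
  extend-∙ₚ φ a ((b , β) ∷ f) = trans
    (+-cong (trans (*-congʳ (ι-* a b)) (*-assoc _ _ _)) (extend-∙ₚ φ a f)) (sym (distribˡ _ _ _))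

  extend-0 : ∀ f → extend (λ _ → 0#) f ≈ 0#
  extend-0 []            = refl
  extend-0 ((a , α) ∷ f) = trans (+-cong (zeroʳ (ι a)) (extend-0 f)) (+-identityˡ 0#)

  extend-+ : ∀ φ ψ f → extend (λ α → φ α + ψ α) f ≈ extend φ f + extend ψ f
  extend-+ φ ψ []            = sym (+-identityˡ 0#)
  extend-+ φ ψ ((a , α) ∷ f) = trans (+-cong (distribˡ _ _ _) (extend-+ φ ψ f)) (+-interchange _ _ _ _)

  extend-* : ∀ x φ f → extend (λ α → x * φ α) f ≈ x * extend φ f
  extend-* x φ []            = sym (zeroʳ x)
  extend-* x φ ((a , α) ∷ f) = trans (+-cong (x*yz≈y*xz (ι a) x (φ α)) (extend-* x φ f)) (sym (distribˡ _ _ _))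

  extend-swap : ∀ (φ : Exponents → Exponents → Carrier) f g → extend (λ α → extend (φ α) g) f ≈ extend (λ β → extend (λ α → φ α β) f) g
  extend-swap φ []            g = sym (extend-0 g)
  extend-swap φ ((a , α) ∷ f) g = begin
    ι a * extend (φ α) g + extend (λ α → extend (φ α) g) f
      ≈⟨ +-cong (sym (extend-* (ι a) (φ α) g)) (extend-swap φ f g) ⟩
    extend (λ β → ι a * φ α β) g + extend (λ β → extend (λ α → φ α β) f) g
      ≈⟨ extend-+ _ _ g ⟨
    extend (λ β → ι a * φ α β + extend (λ α → φ α β) f) g   ∎

  -- Under a functional the product becomes a double extension over sums of exponents. Congruence,
  -- commutativity and associativity of `_*ₚ_` thereby reduce to laws of addition of exponents and
  -- to `extend-swap`.
  extend-*ₚ : ∀ φ f g → extend φ (f *ₚ g) ≈ extend (λ α → extend (λ β → φ (zipWith ℕ._+_ α β)) g) f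
  extend-*ₚ φ []            g = refl
  extend-*ₚ φ ((a , α) ∷ f) g = trans (extend-+ₚ φ (map _ g) (f *ₚ g)) (+-cong (term g) (extend-*ₚ φ f g))
    where
    term : ∀ g → extend φ (map (λ (b , β) → a K.* b , zipWith ℕ._+_ α β) g) ≈ ι a * extend (λ β → φ (zipWith ℕ._+_ α β)) g
    term []            = sym (zeroʳ _)
    term ((b , β) ∷ g) = trans (+-cong (trans (*-congʳ (ι-* a b)) (*-assoc _ _ _)) (term g)) (sym (distribˡ _ _ _))

module PolynomialSemiring {c ℓ} (K : CommutativeRing c ℓ) (n : ℕ) where

  open Polynomials K n
  open CommutativeRing K
  open LinearExtension K n commutativeSemiring (Identity.isSemiringHomomorphism (Semiring.rawSemiring semiring) refl) public
    using () renaming (extend to functional)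
  open LinearExtension K n commutativeSemiring (Identity.isSemiringHomomorphism (Semiring.rawSemiring semiring) refl)
  open SetoidReasoning setoid

  coefficient-extend : ∀ f α → coefficient f α ≈ functional (λ β → if does (β ≟ₑ α) then 1# else 0#) f
  coefficient-extend []            α = refl
  coefficient-extend ((a , β) ∷ f) α = +-cong term (coefficient-extend f α)
    where
    term : (if does (β ≟ₑ α) then a else 0#) ≈ a * (if does (β ≟ₑ α) then 1# else 0#)
    term with does (β ≟ₑ α)
    ... | true  = sym (*-identityʳ a)
    ... | false = sym (zeroʳ a)

  -- A coefficient is itself the value of a functional. Testing against all functionals is preferred
  -- in what follows because they have a simple rule for products.
  ≈ₚ-intro : ∀ f g → (∀ φ → functional φ f ≈ functional φ g) → f ≈ₚ g
  ≈ₚ-intro f g eq α = trans (coefficient-extend f α) (trans (eq _) (sym (coefficient-extend g α)))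

  functional-cong : ∀ φ f g → f ≈ₚ g → functional φ f ≈ functional φ g
  functional-cong = extend-congʳ

  private
    _+ₑ_ : Exponents → Exponents → Exponents
    _+ₑ_ = zipWith ℕ._+_

  +ₚ-cong : ∀ {f f′ g g′} → f ≈ₚ f′ → g ≈ₚ g′ → f +ₚ g ≈ₚ f′ +ₚ g′
  +ₚ-cong {f} {f′} {g} {g′} f≈ g≈ = ≈ₚ-intro (f +ₚ g) (f′ +ₚ g′) λ φ → trans (extend-+ₚ φ f g)
    (trans (+-cong (extend-congʳ φ f f′ f≈) (extend-congʳ φ g g′ g≈)) (sym (extend-+ₚ φ f′ g′)))

  +ₚ-comm : ∀ f g → f +ₚ g ≈ₚ g +ₚ f
  +ₚ-comm f g = ≈ₚ-intro (f +ₚ g) (g +ₚ f) λ φ → trans (extend-+ₚ φ f g) (trans (+-comm _ _) (sym (extend-+ₚ φ g f)))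

  *ₚ-cong : ∀ {f f′ g g′} → f ≈ₚ f′ → g ≈ₚ g′ → f *ₚ g ≈ₚ f′ *ₚ g′
  *ₚ-cong {f} {f′} {g} {g′} f≈ g≈ = ≈ₚ-intro (f *ₚ g) (f′ *ₚ g′) λ φ → begin
    functional φ (f *ₚ g)                                                ≈⟨ extend-*ₚ φ f g ⟩
    functional (λ α → functional (λ β → φ (α +ₑ β)) g) f         ≈⟨ extend-congʳ _ f f′ f≈ ⟩
    functional (λ α → functional (λ β → φ (α +ₑ β)) g) f′        ≈⟨ extend-congˡ f′ (λ α → extend-congʳ (λ β → φ (α +ₑ β)) g g′ g≈) ⟩
    functional (λ α → functional (λ β → φ (α +ₑ β)) g′) f′       ≈⟨ extend-*ₚ φ f′ g′ ⟨
    functional φ (f′ *ₚ g′)                                              ∎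

  *ₚ-comm : ∀ f g → f *ₚ g ≈ₚ g *ₚ f
  *ₚ-comm f g = ≈ₚ-intro (f *ₚ g) (g *ₚ f) λ φ → begin
    functional φ (f *ₚ g)                                          ≈⟨ extend-*ₚ φ f g ⟩
    functional (λ α → functional (λ β → φ (α +ₑ β)) g) f   ≈⟨ extend-swap (λ α β → φ (α +ₑ β)) f g ⟩
    functional (λ β → functional (λ α → φ (α +ₑ β)) f) g   ≈⟨ extend-congˡ g (λ β → extend-congˡ f λ α →
                                                                        reflexive (≡.cong φ (Vec.zipWith-comm ℕ.+-comm α β))) ⟩
    functional (λ β → functional (λ α → φ (β +ₑ α)) f) g   ≈⟨ extend-*ₚ φ g f ⟨
    functional φ (g *ₚ f)                                          ∎

  *ₚ-assoc : ∀ f g h → (f *ₚ g) *ₚ h ≈ₚ f *ₚ (g *ₚ h)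
  *ₚ-assoc f g h = ≈ₚ-intro ((f *ₚ g) *ₚ h) (f *ₚ (g *ₚ h)) λ φ → begin
    functional φ ((f *ₚ g) *ₚ h)
      ≈⟨ extend-*ₚ φ (f *ₚ g) h ⟩
    functional (λ δ → functional (λ γ → φ (δ +ₑ γ)) h) (f *ₚ g)
      ≈⟨ extend-*ₚ _ f g ⟩
    functional (λ α → functional (λ β → functional (λ γ → φ ((α +ₑ β) +ₑ γ)) h) g) f
      ≈⟨ extend-congˡ f (λ α → extend-congˡ g λ β → extend-congˡ h λ γ →
           reflexive (≡.cong φ (Vec.zipWith-assoc ℕ.+-assoc α β γ))) ⟩
    functional (λ α → functional (λ β → functional (λ γ → φ (α +ₑ (β +ₑ γ))) h) g) f
      ≈⟨ extend-congˡ f (λ α → extend-*ₚ (λ δ → φ (α +ₑ δ)) g h) ⟨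
    functional (λ α → functional (λ δ → φ (α +ₑ δ)) (g *ₚ h)) f
      ≈⟨ extend-*ₚ φ f (g *ₚ h) ⟨
    functional φ (f *ₚ (g *ₚ h))   ∎

  constant : Carrier → Poly
  constant a = (a , replicate n 0) ∷ []

  constant-*ₚ : ∀ a f → constant a *ₚ f ≈ₚ a ∙ₚ f
  constant-*ₚ a f = ≈ₚ-intro (constant a *ₚ f) (a ∙ₚ f) λ φ → begin
    functional φ (constant a *ₚ f)                               ≈⟨ extend-*ₚ φ (constant a) f ⟩
    a * functional (λ β → φ (replicate n 0 +ₑ β)) f + 0#         ≈⟨ +-identityʳ _ ⟩
    a * functional (λ β → φ (replicate n 0 +ₑ β)) f
      ≈⟨ *-congˡ (extend-congˡ f λ β → reflexive (≡.cong φ (Vec.zipWith-identityˡ (λ _ → ≡.refl) β))) ⟩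
    a * functional φ f                                           ≈⟨ extend-∙ₚ φ a f ⟨
    functional φ (a ∙ₚ f)                                        ∎

  ∙ₚ-cong : ∀ {a b f g} → a ≈ b → f ≈ₚ g → a ∙ₚ f ≈ₚ b ∙ₚ g
  ∙ₚ-cong {a} {b} {f} {g} a≈b f≈g = ≈ₚ-intro (a ∙ₚ f) (b ∙ₚ g) λ φ →
    trans (extend-∙ₚ φ a f) (trans (*-cong a≈b (extend-congʳ φ f g f≈g)) (sym (extend-∙ₚ φ b g)))

  *ₚ-identityˡ : ∀ f → 1ₚ *ₚ f ≈ₚ f
  *ₚ-identityˡ f = ≈ₚ-intro (1ₚ *ₚ f) f λ φ → trans (functional-cong φ (1ₚ *ₚ f) (1# ∙ₚ f) (constant-*ₚ 1# f)) (trans (extend-∙ₚ φ 1# f) (*-identityˡ _))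

  *ₚ-distribʳ : ∀ h f g → (f +ₚ g) *ₚ h ≈ₚ f *ₚ h +ₚ g *ₚ h
  *ₚ-distribʳ h f g = ≈ₚ-intro ((f +ₚ g) *ₚ h) (f *ₚ h +ₚ g *ₚ h) λ φ → trans (extend-*ₚ φ (f +ₚ g) h) (trans (extend-+ₚ _ f g)
    (sym (trans (extend-+ₚ φ (f *ₚ h) (g *ₚ h)) (+-cong (extend-*ₚ φ f h) (extend-*ₚ φ g h)))))

  polyCommutativeSemiring : CommutativeSemiring c ℓ
  polyCommutativeSemiring = record
    { Carrier = Poly ; _≈_ = _≈ₚ_ ; _+_ = _+ₚ_ ; _*_ = _*ₚ_ ; 0# = 0ₚ ; 1# = 1ₚ
    ; isCommutativeSemiring = isCommutativeSemiringˡ record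
      { +-isCommutativeMonoid = record
        { isMonoid = record
          { isSemigroup = record
            { isMagma = record { isEquivalence = ≈ₚ-isEquivalence ; ∙-cong = λ {f} {f′} {g} {g′} → +ₚ-cong {f} {f′} {g} {g′} }
            ; assoc = λ f g h α → reflexive (≡.cong (λ p → coefficient p α) (List.++-assoc f g h)) }
          ; identity = (λ f α → refl) , (λ f α → reflexive (≡.cong (λ p → coefficient p α) (List.++-identityʳ f))) }
        ; comm = +ₚ-comm }
      ; *-isCommutativeMonoid = record
        { isMonoid = record
          { isSemigroup = record
            { isMagma = record { isEquivalence = ≈ₚ-isEquivalence ; ∙-cong = λ {f} {f′} {g} {g′} → *ₚ-cong {f} {f′} {g} {g′} }
            ; assoc = *ₚ-assoc }
          ; identity = *ₚ-identityˡ , λ f α → trans (*ₚ-comm f 1ₚ α) (*ₚ-identityˡ f α) }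
        ; comm = *ₚ-comm }
      ; distribʳ = *ₚ-distribʳ
      ; zeroˡ = λ f α → refl
      }
    }
    where
    ≈ₚ-isEquivalence : IsEquivalence _≈ₚ_
    ≈ₚ-isEquivalence = record
      { refl = λ α → refl ; sym = λ f≈g α → sym (f≈g α) ; trans = λ f≈g g≈h α → trans (f≈g α) (g≈h α) }

module _ {a ℓa b ℓb} {R : RawSemiring a ℓa} {S : RawSemiring b ℓb} where
  private
    module R = RawSemiring R
    module S = RawSemiring S

  semiringHomomorphism : (h : R.Carrier → S.Carrier) → (∀ {x y} → x R.≈ y → h x S.≈ h y) →
    (∀ x y → h (x R.+ y) S.≈ h x S.+ h y) → h R.0# S.≈ S.0# →
    (∀ x y → h (x R.* y) S.≈ h x S.* h y) → h R.1# S.≈ S.1# →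
    SemiringMorphisms.IsSemiringHomomorphism R S h
  semiringHomomorphism h cong +-homo 0#-homo *-homo 1#-homo = record
    { isNearSemiringHomomorphism = record
      { +-isMonoidHomomorphism = record
        { isMagmaHomomorphism = record { isRelHomomorphism = record { cong = cong } ; homo = +-homo }
        ; ε-homo = 0#-homo }
      ; *-homo = *-homo }
    ; 1#-homo = 1#-homo }

-- Evaluation and the action of matrices

module Evaluation {c ℓ} (K : CommutativeRing c ℓ) (n : ℕ) {s ℓs} (S : CommutativeSemiring s ℓs)
  {ι} (ι-homo : SemiringMorphisms.IsSemiringHomomorphism
    (Semiring.rawSemiring (CommutativeRing.semiring K)) (CommutativeSemiring.rawSemiring S) ι) where

  open Polynomials K n
  open PolynomialSemiring K n using (polyCommutativeSemiring; constant)
  open LinearExtension K n S ι-homo public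
  open CommutativeSemiringLemmas S
  open SemiringMorphisms.IsSemiringHomomorphism ι-homo using () renaming (1#-homo to ι-1)
  private
    module K = CommutativeRing K
    module Poly = CommutativeSemiringLemmas polyCommutativeSemiring
  open SetoidReasoning setoid

  evaluate : (Fin n → Carrier) → Poly → Carrier
  evaluate p = extend (power p)

  evaluate-*ₚ : ∀ p f g → evaluate p (f *ₚ g) ≈ evaluate p f * evaluate p g
  evaluate-*ₚ p f g = begin
    evaluate p (f *ₚ g)
      ≈⟨ extend-*ₚ (power p) f g ⟩
    extend (λ α → extend (λ β → power p (zipWith ℕ._+_ α β)) g) f
      ≈⟨ extend-congˡ f (λ α → trans (extend-congˡ g (power-+ p α)) (trans (extend-* (power p α) (power p) g) (*-comm _ _))) ⟩
    extend (λ α → evaluate p g * power p α) f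
      ≈⟨ extend-* (evaluate p g) (power p) f ⟩
    evaluate p g * evaluate p f
      ≈⟨ *-comm _ _ ⟩
    evaluate p f * evaluate p g   ∎

  evaluate-constant : ∀ p a → evaluate p (constant a) ≈ ι a
  evaluate-constant p a = trans (+-identityʳ _) (trans (*-congˡ (power-0 p)) (*-identityʳ (ι a)))

  evaluate-homo : ∀ p → SemiringMorphisms.IsSemiringHomomorphism polyRawSemiring rawSemiring (evaluate p)
  evaluate-homo p = semiringHomomorphism (evaluate p)
    (λ {f} {g} → extend-congʳ (power p) f g) (extend-+ₚ (power p)) refl
    (evaluate-*ₚ p) (trans (evaluate-constant p K.1#) ι-1)

  evaluate-var : ∀ p i → evaluate p (var i) ≈ p i
  evaluate-var p i = trans (+-identityʳ _) (trans (*-cong ι-1 (power-unit p i)) (*-identityˡ (p i)))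

  evaluate-cong : ∀ {p q} f → (∀ i → p i ≈ q i) → evaluate p f ≈ evaluate q f
  evaluate-cong f p≈q = extend-congˡ f (power-cong p≈q)

  evaluate-linear : ∀ p (a : Fin n → K.Carrier) → evaluate p (∑ₚ λ j → a j ∙ₚ var j) ≈ sum λ j → ι (a j) * p j
  evaluate-linear p a = trans (sum-homo (λ j → a j ∙ₚ var j))
    (sum-cong λ j → trans (extend-∙ₚ (power p) (a j) (var j)) (*-congˡ (evaluate-var p j)))
    where open SemiringHomomorphismLemmas polyRawSemiring S (evaluate-homo p)

  -- Evaluation is a homomorphism, so the substituted linear forms may be evaluated one by one. With
  -- numbers for `p` this yields the relations imposed by X; with polynomials for `p` it yields the
  -- composition law of the action.
  evaluate-· : ∀ p A f → evaluate p (A · f) ≈ evaluate (λ i → sum λ j → ι (A i j) * p j) f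
  evaluate-· p A []            = refl
  evaluate-· p A ((a , α) ∷ f) = begin
    evaluate p (a ∙ₚ Poly.power lines α ++ A · f)
      ≈⟨ extend-+ₚ (power p) (a ∙ₚ Poly.power lines α) (A · f) ⟩
    evaluate p (a ∙ₚ Poly.power lines α) + evaluate p (A · f)
      ≈⟨ +-cong (trans (extend-∙ₚ (power p) a (Poly.power lines α))
           (*-congˡ (trans (power-homo lines α) (power-cong (λ i → evaluate-linear p (A i)) α))))
           (evaluate-· p A f) ⟩
    ι a * power (λ i → sum λ j → ι (A i j) * p j) α + evaluate (λ i → sum λ j → ι (A i j) * p j) f   ∎
    where
    open SemiringHomomorphismLemmas polyRawSemiring S (evaluate-homo p)
    lines = λ i → ∑ₚ λ j → A i j ∙ₚ var j

module MatrixAction {c ℓ} (K : CommutativeRing c ℓ) (n : ℕ) where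

  open Polynomials K n
  open PolynomialSemiring K n
  private
    module K = CommutativeSemiringLemmas (CommutativeRing.commutativeSemiring K)
    module Poly = CommutativeSemiringLemmas polyCommutativeSemiring

  -- Makes the polynomials a K-algebra, so that substituting polynomials into a polynomial is one
  -- more case of `Evaluation`.
  constant-homo : SemiringMorphisms.IsSemiringHomomorphism (Semiring.rawSemiring (CommutativeRing.semiring K)) polyRawSemiring constant
  constant-homo = semiringHomomorphism constant
    (λ {a} {b} a≈b → ≈ₚ-intro (constant a) (constant b) λ φ → K.+-congʳ (K.*-congʳ a≈b))
    (λ a b → ≈ₚ-intro (constant (a K.+ b)) (constant a +ₚ constant b) λ φ →
      K.trans (K.+-congʳ (K.distribʳ _ a b)) (K.+-assoc _ _ _))
    (≈ₚ-intro (constant K.0#) [] λ φ → K.trans (K.+-identityʳ _) (K.zeroˡ _))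
    (λ a b → Poly.sym {constant a *ₚ constant b} {constant (a K.* b)} (Poly.trans {constant a *ₚ constant b} {a ∙ₚ constant b}
      {constant (a K.* b)} (constant-*ₚ a (constant b)) (Poly.refl {constant (a K.* b)})))
    (Poly.refl {1ₚ})

  open Evaluation K n polyCommutativeSemiring constant-homo public
  open SetoidReasoning Poly.setoid

  monomial : Exponents → Poly
  monomial α = (K.1# , α) ∷ []

  monomial-+ : ∀ α β → monomial (zipWith ℕ._+_ α β) ≈ₚ monomial α *ₚ monomial β
  monomial-+ α β = ≈ₚ-intro (monomial (zipWith ℕ._+_ α β)) (monomial α *ₚ monomial β) λ φ →
    K.+-congʳ (K.*-congʳ (K.sym (K.*-identityˡ K.1#)))

  power-var : ∀ α → Poly.power var α ≈ₚ monomial α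
  power-var α = Poly.sym {monomial α} {Poly.power var α}
    (Poly.multiplicative⇒power n monomial (Poly.refl {1ₚ}) monomial-+ α)

  linearForms : Matrix → Fin n → Poly
  linearForms A i = ∑ₚ λ j → A i j ∙ₚ var j

  evaluate-var-id : ∀ f → evaluate var f ≈ₚ f
  evaluate-var-id []            = Poly.refl {[]}
  evaluate-var-id ((a , α) ∷ f) = begin
    constant a *ₚ Poly.power var α +ₚ evaluate var f
      ≈⟨ +ₚ-cong {constant a *ₚ Poly.power var α} {a ∙ₚ monomial α} {evaluate var f} {f} term (evaluate-var-id f) ⟩
    (a K.* K.1# , α) ∷ f
      ≈⟨ ≈ₚ-intro ((a K.* K.1# , α) ∷ f) ((a , α) ∷ f) (λ φ → K.+-congʳ (K.*-congʳ (K.*-identityʳ a))) ⟩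
    (a , α) ∷ f   ∎
    where
    term : constant a *ₚ Poly.power var α ≈ₚ a ∙ₚ monomial α
    term = begin
      constant a *ₚ Poly.power var α   ≈⟨ constant-*ₚ a (Poly.power var α) ⟩
      a ∙ₚ Poly.power var α            ≈⟨ ∙ₚ-cong {a} {a} {Poly.power var α} {monomial α} K.refl (power-var α) ⟩
      a ∙ₚ monomial α                  ∎

  linearForms-const : ∀ A i → linearForms A i ≈ₚ Poly.sum λ j → constant (A i j) *ₚ var j
  linearForms-const A i = Poly.sum-cong {x = λ j → A i j ∙ₚ var j} {y = λ j → constant (A i j) *ₚ var j}
    λ j → Poly.sym {constant (A i j) *ₚ var j} {A i j ∙ₚ var j} (constant-*ₚ (A i j) (var j))

  -- Evaluating `A · f` at the variables returns it, and `evaluate-·` turns the same evaluation into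
  -- one of `f` at the linear forms. The action then inherits its congruences from `evaluate`.
  ·-evaluate : ∀ A f → A · f ≈ₚ evaluate (linearForms A) f
  ·-evaluate A f = begin
    A · f                                                          ≈⟨ evaluate-var-id (A · f) ⟨
    evaluate var (A · f)                                           ≈⟨ evaluate-· var A f ⟩
    evaluate (λ i → Poly.sum λ j → constant (A i j) *ₚ var j) f    ≈⟨ evaluate-cong f (linearForms-const A) ⟨
    evaluate (linearForms A) f                                     ∎

  ·-congʳ : ∀ A {f g} → f ≈ₚ g → A · f ≈ₚ A · g
  ·-congʳ A {f} {g} f≈g = begin
    A · f                        ≈⟨ ·-evaluate A f ⟩
    evaluate (linearForms A) f   ≈⟨ extend-congʳ _ f g f≈g ⟩
    evaluate (linearForms A) g   ≈⟨ ·-evaluate A g ⟨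
    A · g                        ∎

  linearForms-cong : ∀ {A B} → A ≈ₘ B → ∀ i → linearForms A i ≈ₚ linearForms B i
  linearForms-cong {A} {B} A≈B i = Poly.sum-cong {x = λ j → A i j ∙ₚ var j} {y = λ j → B i j ∙ₚ var j}
    λ j → ∙ₚ-cong {A i j} {B i j} {var j} {var j} (A≈B i j) (Poly.refl {var j})

  ·-congˡ : ∀ {A B} f → A ≈ₘ B → A · f ≈ₚ B · f
  ·-congˡ {A} {B} f A≈B = begin
    A · f                        ≈⟨ ·-evaluate A f ⟩
    evaluate (linearForms A) f   ≈⟨ evaluate-cong f (linearForms-cong A≈B) ⟩
    evaluate (linearForms B) f   ≈⟨ ·-evaluate B f ⟨
    B · f                        ∎

  -- The order is reversed because matrices act by substitution: the rows of `A` enter `f` first,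
  -- and the variables they contain are then replaced by the rows of `B`.
  *ₘ-· : ∀ A B f → (A *ₘ B) · f ≈ₚ B · (A · f)
  *ₘ-· A B f = begin
    (A *ₘ B) · f
      ≈⟨ ·-evaluate (A *ₘ B) f ⟩
    evaluate (linearForms (A *ₘ B)) f
      ≈⟨ evaluate-cong f product-forms ⟩
    evaluate (λ i → Poly.sum λ k → constant (A i k) *ₚ linearForms B k) f
      ≈⟨ evaluate-· (linearForms B) A f ⟨
    evaluate (linearForms B) (A · f)
      ≈⟨ ·-evaluate B (A · f) ⟨
    B · (A · f)   ∎
    where
    open SemiringHomomorphismLemmas K.rawSemiring polyCommutativeSemiring constant-homo
    module constant = SemiringMorphisms.IsSemiringHomomorphism constant-homo
    b = λ k j → constant (B k j) *ₚ var j
    product-forms : ∀ i → linearForms (A *ₘ B) i ≈ₚ Poly.sum λ k → constant (A i k) *ₚ linearForms B k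
    product-forms i = begin
      linearForms (A *ₘ B) i
        ≈⟨ linearForms-const (A *ₘ B) i ⟩
      Poly.sum (λ j → constant ((A *ₘ B) i j) *ₚ var j)
        ≈⟨ Poly.sum-cong {x = λ j → constant ((A *ₘ B) i j) *ₚ var j} {y = λ j → Poly.sum λ k → constant (A i k) *ₚ b k j} (λ j → begin
             constant ((A *ₘ B) i j) *ₚ var j
               ≈⟨ *ₚ-cong {constant ((A *ₘ B) i j)} {Poly.sum λ k → constant (A i k K.* B k j)} {var j} {var j}
                    (sum-homo λ k → A i k K.* B k j) (Poly.refl {var j}) ⟩
             Poly.sum (λ k → constant (A i k K.* B k j)) *ₚ var j
               ≈⟨ Poly.*-distribʳ-sum (var j) (λ k → constant (A i k K.* B k j)) ⟩
             Poly.sum (λ k → constant (A i k K.* B k j) *ₚ var j)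
               ≈⟨ Poly.sum-cong {x = λ k → constant (A i k K.* B k j) *ₚ var j} {y = λ k → constant (A i k) *ₚ b k j} (λ k → begin
                    constant (A i k K.* B k j) *ₚ var j
                      ≈⟨ *ₚ-cong {constant (A i k K.* B k j)} {constant (A i k) *ₚ constant (B k j)} {var j} {var j}
                           (constant.*-homo (A i k) (B k j)) (Poly.refl {var j}) ⟩
                    constant (A i k) *ₚ constant (B k j) *ₚ var j
                      ≈⟨ *ₚ-assoc (constant (A i k)) (constant (B k j)) (var j) ⟩
                    constant (A i k) *ₚ b k j   ∎) ⟩
             Poly.sum (λ k → constant (A i k) *ₚ b k j)   ∎) ⟩
      Poly.sum (λ j → Poly.sum λ k → constant (A i k) *ₚ b k j)
        ≈⟨ Poly.∑-comm (λ j k → constant (A i k) *ₚ b k j) ⟩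
      Poly.sum (λ k → Poly.sum λ j → constant (A i k) *ₚ b k j)
        ≈⟨ Poly.sum-cong {x = λ k → Poly.sum λ j → constant (A i k) *ₚ b k j} {y = λ k → constant (A i k) *ₚ linearForms B k} (λ k → begin
             Poly.sum (λ j → constant (A i k) *ₚ b k j)
               ≈⟨ Poly.*-distribˡ-sum (constant (A i k)) (b k) ⟨
             constant (A i k) *ₚ Poly.sum (b k)
               ≈⟨ *ₚ-cong {constant (A i k)} {constant (A i k)} {linearForms B k} {Poly.sum (b k)}
                    (Poly.refl {constant (A i k)}) (linearForms-const B k) ⟨
             constant (A i k) *ₚ linearForms B k   ∎) ⟩
      Poly.sum (λ k → constant (A i k) *ₚ linearForms B k)   ∎

  linearForms-diagonal : ∀ d i → linearForms (diagonal d) i ≈ₚ d i ∙ₚ var i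
  linearForms-diagonal d i = begin
    Poly.sum (λ j → diagonal d i j ∙ₚ var j)
      ≈⟨ Poly.sum-single (λ j → diagonal d i j ∙ₚ var j) i (λ j i≢j → ≈ₚ-intro (diagonal d i j ∙ₚ var j) [] λ φ →
           K.trans (K.+-identityʳ _) (K.trans (K.*-congʳ (K.trans (K.*-identityʳ _)
             (K.reflexive (≡.cong (if_then d i else K.0#) (dec-false (i Fin.≟ j) i≢j))))) (K.zeroˡ _))) ⟩
    diagonal d i i ∙ₚ var i
      ≡⟨ ≡.cong (λ b → (if b then d i else K.0#) ∙ₚ var i) (dec-true (i Fin.≟ i) ≡.refl) ⟩
    d i ∙ₚ var i   ∎

  1ₘ-· : ∀ f → 1ₘ · f ≈ₚ f
  1ₘ-· f = begin
    1ₘ · f                         ≈⟨ ·-evaluate 1ₘ f ⟩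
    evaluate (linearForms 1ₘ) f    ≈⟨ evaluate-cong f (λ i → begin
                                        linearForms 1ₘ i   ≈⟨ linearForms-diagonal (λ _ → K.1#) i ⟩
                                        K.1# ∙ₚ var i      ≈⟨ constant-*ₚ K.1# (var i) ⟨
                                        1ₚ *ₚ var i        ≈⟨ *ₚ-identityˡ (var i) ⟩
                                        var i              ∎) ⟩
    evaluate var f                 ≈⟨ evaluate-var-id f ⟩
    f                              ∎

  rescale : (Exponents → K.Carrier) → Poly → Poly
  rescale w = map λ (a , α) → w α K.* a , α

  coefficient-rescale : ∀ w f α → coefficient (rescale w f) α K.≈ w α K.* coefficient f α
  coefficient-rescale w []            α = K.sym (K.zeroʳ (w α))
  coefficient-rescale w ((a , β) ∷ f) α = K.trans (K.+-cong term (coefficient-rescale w f α)) (K.sym (K.distribˡ _ _ _))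
    where
    term : (if does (β ≟ₑ α) then w β K.* a else K.0#) K.≈ w α K.* (if does (β ≟ₑ α) then a else K.0#)
    term with β ≟ₑ α
    ... | yes ≡.refl = K.refl
    ... | no  _      = K.sym (K.zeroʳ (w α))

  -- Every monomial is an eigenvector, with eigenvalue the value of that monomial at the diagonal.
  diagonal-· : ∀ d f → diagonal d · f ≈ₚ rescale (K.power d) f
  diagonal-· d f = begin
    diagonal d · f                               ≈⟨ ·-evaluate (diagonal d) f ⟩
    evaluate (linearForms (diagonal d)) f        ≈⟨ evaluate-cong f (λ i → begin
                                                      linearForms (diagonal d) i   ≈⟨ linearForms-diagonal d i ⟩
                                                      d i ∙ₚ var i                 ≈⟨ constant-*ₚ (d i) (var i) ⟨
                                                      constant (d i) *ₚ var i      ∎) ⟩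
    evaluate (λ i → constant (d i) *ₚ var i) f   ≈⟨ terms f ⟩
    rescale (K.power d) f                        ∎
    where
    open SemiringHomomorphismLemmas K.rawSemiring polyCommutativeSemiring constant-homo
    x = λ i → constant (d i) *ₚ var i
    terms : ∀ f → evaluate x f ≈ₚ rescale (K.power d) f
    terms []            = Poly.refl {[]}
    terms ((a , α) ∷ f) = +ₚ-cong {constant a *ₚ Poly.power x α} {(K.power d α K.* a , α) ∷ []} {evaluate x f} {rescale (K.power d) f}
      (begin
        constant a *ₚ Poly.power x α
          ≈⟨ constant-*ₚ a (Poly.power x α) ⟩
        a ∙ₚ Poly.power x α
          ≈⟨ ∙ₚ-cong {a} {a} {Poly.power x α} {K.power d α ∙ₚ monomial α} K.refl (begin
               Poly.power x α
                 ≈⟨ Poly.power-* (constant ∘ d) var α ⟩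
               Poly.power (constant ∘ d) α *ₚ Poly.power var α
                 ≈⟨ *ₚ-cong {Poly.power (constant ∘ d) α} {constant (K.power d α)} {Poly.power var α} {monomial α}
                      (Poly.sym {constant (K.power d α)} {Poly.power (constant ∘ d) α} (power-homo d α)) (power-var α) ⟩
               constant (K.power d α) *ₚ monomial α
                 ≈⟨ constant-*ₚ (K.power d α) (monomial α) ⟩
               K.power d α ∙ₚ monomial α   ∎) ⟩
        (a K.* (K.power d α K.* K.1#) , α) ∷ []
          ≈⟨ ≈ₚ-intro ((a K.* (K.power d α K.* K.1#) , α) ∷ []) ((K.power d α K.* a , α) ∷ []) (λ φ → K.+-congʳ (K.*-congʳ
               (K.trans (K.*-congˡ (K.*-identityʳ _)) (K.*-comm _ _)))) ⟩
        (K.power d α K.* a , α) ∷ []   ∎)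
      (terms f)

  coefficient-diagonal : ∀ d f α → coefficient (diagonal d · f) α K.≈ K.power d α K.* coefficient f α
  coefficient-diagonal d f α = K.trans (diagonal-· d f α) (coefficient-rescale (K.power d) f α)

  ·-fixes : ∀ {k} {generator : Fin k → Matrix} f → (∀ i → generator i · f ≈ₚ f) → ∀ A → ⟨ generator ⟩ A → A · f ≈ₚ f
  ·-fixes f fixes _ (generated i) = fixes i
  ·-fixes f fixes _ identity      = 1ₘ-· f
  ·-fixes f fixes _ (product {A} {B} HA HB) = begin
    (A *ₘ B) · f   ≈⟨ *ₘ-· A B f ⟩
    B · (A · f)    ≈⟨ ·-congʳ B {A · f} {f} (·-fixes f fixes A HA) ⟩
    B · f          ≈⟨ ·-fixes f fixes B HB ⟩
    f              ∎
  -- Writing `f` as `A · f` inside `B · f` produces, by the reversed order of `*ₘ-·`, the product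
  -- `A *ₘ B`.
  ·-fixes f fixes B (inverse {A} HA AB≈1 _) = begin
    B · f          ≈⟨ ·-congʳ B {A · f} {f} (·-fixes f fixes A HA) ⟨
    B · (A · f)    ≈⟨ *ₘ-· A B f ⟨
    (A *ₘ B) · f   ≈⟨ ·-congˡ f AB≈1 ⟩
    1ₘ · f         ≈⟨ 1ₘ-· f ⟩
    f              ∎
  ·-fixes f fixes B (respects {A} A≈B HA) = begin
    B · f   ≈⟨ ·-congˡ {A} {B} f A≈B ⟨
    A · f   ≈⟨ ·-fixes f fixes A HA ⟩
    f       ∎

  ·-+ₚ : ∀ A f g → A · (f +ₚ g) ≈ₚ A · f +ₚ A · g
  ·-+ₚ A []            g = Poly.refl {A · g}
  ·-+ₚ A ((a , α) ∷ f) g = begin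
    t +ₚ A · (f +ₚ g)        ≈⟨ +ₚ-cong {t} {t} {A · (f +ₚ g)} {A · f +ₚ A · g} (Poly.refl {t}) (·-+ₚ A f g) ⟩
    t +ₚ (A · f +ₚ A · g)    ≈⟨ Poly.+-assoc t (A · f) (A · g) ⟨
    t +ₚ A · f +ₚ A · g      ∎
    where t = a ∙ₚ Poly.power (linearForms A) α

  ·-∙ₚ : ∀ A a f → A · (a ∙ₚ f) ≈ₚ a ∙ₚ (A · f)
  ·-∙ₚ A a f = begin
    A · (a ∙ₚ f)                               ≈⟨ ·-evaluate A (a ∙ₚ f) ⟩
    evaluate (linearForms A) (a ∙ₚ f)          ≈⟨ extend-∙ₚ (Poly.power (linearForms A)) a f ⟩
    constant a *ₚ evaluate (linearForms A) f   ≈⟨ constant-*ₚ a (evaluate (linearForms A) f) ⟩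
    a ∙ₚ evaluate (linearForms A) f            ≈⟨ ∙ₚ-cong {a} {a} {A · f} {evaluate (linearForms A) f} K.refl (·-evaluate A f) ⟨
    a ∙ₚ (A · f)                               ∎

-- Computation with integer polynomials

module ℤₚ n = Polynomials ℤ.+-*-commutativeRing n

-- An element of Nested (suc n) lists the coefficients of the powers of the first variable.
Nested : ℕ → Set
Nested ℕ.zero    = ℤ
Nested (ℕ.suc n) = List (Nested n)

0ᴺ : ∀ n → Nested n
0ᴺ ℕ.zero    = 0ℤ
0ᴺ (ℕ.suc n) = []

addᴺ : ∀ n → Nested n → Nested n → Nested n
addᴺ ℕ.zero    k       l       = k ℤ.+ l
addᴺ (ℕ.suc n) []      q       = q
addᴺ (ℕ.suc n) (a ∷ p) []      = a ∷ p
addᴺ (ℕ.suc n) (a ∷ p) (b ∷ q) = addᴺ n a b ∷ addᴺ (ℕ.suc n) p q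

mulᴺ : ∀ n → Nested n → Nested n → Nested n
mulᴺ ℕ.zero    k       l = k ℤ.* l
mulᴺ (ℕ.suc n) []      q = []
mulᴺ (ℕ.suc n) (a ∷ p) q = addᴺ (ℕ.suc n) (map (mulᴺ n a) q) (0ᴺ n ∷ mulᴺ (ℕ.suc n) p q)

termᴺ : ∀ n → ℤ → Vec ℕ n → Nested n
termᴺ ℕ.zero    k []            = k
termᴺ (ℕ.suc n) k (ℕ.zero  ∷ α) = termᴺ n k α ∷ []
termᴺ (ℕ.suc n) k (ℕ.suc i ∷ α) = 0ᴺ n ∷ termᴺ (ℕ.suc n) k (i ∷ α)

isZeroᴺ : ∀ n → Nested n → Bool
isZeroᴺ ℕ.zero    k       = ⌊ k ℤ.≟ 0ℤ ⌋
isZeroᴺ (ℕ.suc n) []      = true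
isZeroᴺ (ℕ.suc n) (a ∷ p) = isZeroᴺ n a ∧ isZeroᴺ (ℕ.suc n) p

-- Missing coefficients count as zeros, since the arithmetic leaves trailing zeros behind.
equalᴺ : ∀ n → Nested n → Nested n → Bool
equalᴺ ℕ.zero    k       l       = ⌊ k ℤ.≟ l ⌋
equalᴺ (ℕ.suc n) []      q       = isZeroᴺ (ℕ.suc n) q
equalᴺ (ℕ.suc n) (a ∷ p) []      = isZeroᴺ (ℕ.suc n) (a ∷ p)
equalᴺ (ℕ.suc n) (a ∷ p) (b ∷ q) = equalᴺ n a b ∧ equalᴺ (ℕ.suc n) p q

constantᴺ : ∀ n → ℤ → Nested n
constantᴺ n k = termᴺ n k (Vec.replicate n 0)

nestedRawSemiring : ℕ → RawSemiring 0ℓ 0ℓ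
nestedRawSemiring n = record
  { Carrier = Nested n ; _≈_ = _≡_ ; _+_ = addᴺ n ; _*_ = mulᴺ n ; 0# = 0ᴺ n ; 1# = constantᴺ n 1ℤ }

-- A form of a sparse matrix carries a term for each of its zero entries; dropping these terms keeps
-- the nested lists, and the products formed from them, short.
nested : ∀ n → ℤₚ.Poly n → Nested n
nested n []            = 0ᴺ n
nested n ((k , α) ∷ f) = if ⌊ k ℤ.≟ 0ℤ ⌋ then nested n f else addᴺ n (termᴺ n k α) (nested n f)

-- Nested lists merge equal monomials in every product, whereas `_*ₚ_` keeps all pairs of terms: the
-- eighth power of a form with three terms has 45 monomials but would be listed with 6561 terms.
substitute : ∀ {m} n → (Fin m → ℤₚ.Poly n) → ℤₚ.Poly m → Nested n
substitute n p = foldr (λ (k , α) → addᴺ n (mulᴺ n (constantᴺ n k) (power (nested n ∘ p) α))) (0ᴺ n)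
  where open Powers (nestedRawSemiring n)

module NestedSemantics {s ℓs} (S : CommutativeSemiring s ℓs)
  {ι} (ι-homo : SemiringMorphisms.IsSemiringHomomorphism
    (Semiring.rawSemiring (CommutativeRing.semiring ℤ.+-*-commutativeRing)) (CommutativeSemiring.rawSemiring S) ι) where

  open CommutativeSemiringLemmas S
  open SemiringMorphisms.IsSemiringHomomorphism ι-homo using ()
    renaming (+-homo to ι-+; *-homo to ι-*; 0#-homo to ι-0; 1#-homo to ι-1)
  open SetoidReasoning setoid
  private module Eval n = Evaluation ℤ.+-*-commutativeRing n S ι-homo

  -- Horner's rule in the first variable. The target semiring is arbitrary, so a comparison decided
  -- on integers is valid for polynomials over ℂ as well.
  ⟦_⟧ : ∀ {n} → Nested n → (Fin n → Carrier) → Carrier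
  ⟦_⟧ {ℕ.zero}  k       ρ = ι k
  ⟦_⟧ {ℕ.suc n} []      ρ = 0#
  ⟦_⟧ {ℕ.suc n} (a ∷ p) ρ = ⟦_⟧ {n} a (ρ ∘ suc) + ρ zero * ⟦_⟧ {ℕ.suc n} p ρ

  ⟦0ᴺ⟧ : ∀ n ρ → ⟦ 0ᴺ n ⟧ ρ ≈ 0#
  ⟦0ᴺ⟧ ℕ.zero    ρ = ι-0
  ⟦0ᴺ⟧ (ℕ.suc n) ρ = refl

  ⟦addᴺ⟧ : ∀ n p q ρ → ⟦ addᴺ n p q ⟧ ρ ≈ ⟦ p ⟧ ρ + ⟦ q ⟧ ρ
  ⟦addᴺ⟧ ℕ.zero    k       l       ρ = ι-+ k l
  ⟦addᴺ⟧ (ℕ.suc n) []      q       ρ = sym (+-identityˡ _)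
  ⟦addᴺ⟧ (ℕ.suc n) (a ∷ p) []      ρ = sym (+-identityʳ _)
  ⟦addᴺ⟧ (ℕ.suc n) (a ∷ p) (b ∷ q) ρ = trans
    (+-cong (⟦addᴺ⟧ n a b (ρ ∘ suc)) (trans (*-congˡ (⟦addᴺ⟧ (ℕ.suc n) p q ρ)) (distribˡ _ _ _)))
    (+-interchange _ _ _ _)

  ⟦0∷⟧ : ∀ n p ρ → ⟦_⟧ {ℕ.suc n} (0ᴺ n ∷ p) ρ ≈ ρ zero * ⟦_⟧ {ℕ.suc n} p ρ
  ⟦0∷⟧ n p ρ = trans (+-congʳ (⟦0ᴺ⟧ n (ρ ∘ suc))) (+-identityˡ _)

  ⟦mulᴺ⟧ : ∀ n p q ρ → ⟦ mulᴺ n p q ⟧ ρ ≈ ⟦ p ⟧ ρ * ⟦ q ⟧ ρ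
  ⟦mulᴺ⟧ ℕ.zero    k       l ρ = ι-* k l
  ⟦mulᴺ⟧ (ℕ.suc n) []      q ρ = sym (zeroˡ _)
  ⟦mulᴺ⟧ (ℕ.suc n) (a ∷ p) q ρ = begin
    ⟦ addᴺ (ℕ.suc n) (map (mulᴺ n a) q) (0ᴺ n ∷ mulᴺ (ℕ.suc n) p q) ⟧ ρ
      ≈⟨ ⟦addᴺ⟧ (ℕ.suc n) (map (mulᴺ n a) q) (0ᴺ n ∷ mulᴺ (ℕ.suc n) p q) ρ ⟩
    ⟦ map (mulᴺ n a) q ⟧ ρ + ⟦_⟧ {ℕ.suc n} (0ᴺ n ∷ mulᴺ (ℕ.suc n) p q) ρ
      ≈⟨ +-cong (scale q) (trans (⟦0∷⟧ n (mulᴺ (ℕ.suc n) p q) ρ)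
           (trans (*-congˡ (⟦mulᴺ⟧ (ℕ.suc n) p q ρ)) (sym (*-assoc _ _ _)))) ⟩
    ⟦ a ⟧ (ρ ∘ suc) * ⟦ q ⟧ ρ + ρ zero * ⟦ p ⟧ ρ * ⟦ q ⟧ ρ
      ≈⟨ distribʳ _ _ _ ⟨
    (⟦ a ⟧ (ρ ∘ suc) + ρ zero * ⟦ p ⟧ ρ) * ⟦ q ⟧ ρ   ∎
    where
    scale : ∀ q → ⟦_⟧ {ℕ.suc n} (map (mulᴺ n a) q) ρ ≈ ⟦ a ⟧ (ρ ∘ suc) * ⟦_⟧ {ℕ.suc n} q ρ
    scale []      = sym (zeroʳ _)
    scale (b ∷ q) = trans
      (+-cong (⟦mulᴺ⟧ n a b (ρ ∘ suc)) (trans (*-congˡ (scale q)) (x*yz≈y*xz _ _ _)))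
      (sym (distribˡ _ _ _))

  ⟦termᴺ⟧ : ∀ n k α ρ → ⟦ termᴺ n k α ⟧ ρ ≈ ι k * power ρ α
  ⟦termᴺ⟧ ℕ.zero    k []            ρ = sym (*-identityʳ (ι k))
  ⟦termᴺ⟧ (ℕ.suc n) k (ℕ.zero ∷ α)  ρ = begin
    ⟦ termᴺ n k α ⟧ (ρ ∘ suc) + ρ zero * 0#   ≈⟨ +-congˡ (zeroʳ _) ⟩
    ⟦ termᴺ n k α ⟧ (ρ ∘ suc) + 0#            ≈⟨ +-identityʳ _ ⟩
    ⟦ termᴺ n k α ⟧ (ρ ∘ suc)                 ≈⟨ ⟦termᴺ⟧ n k α (ρ ∘ suc) ⟩
    ι k * power (ρ ∘ suc) α                   ≈⟨ *-congˡ (*-identityˡ _) ⟨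
    ι k * (1# * power (ρ ∘ suc) α)            ∎
  ⟦termᴺ⟧ (ℕ.suc n) k (ℕ.suc i ∷ α) ρ = begin
    ⟦_⟧ {ℕ.suc n} (0ᴺ n ∷ termᴺ (ℕ.suc n) k (i ∷ α)) ρ   ≈⟨ ⟦0∷⟧ n (termᴺ (ℕ.suc n) k (i ∷ α)) ρ ⟩
    ρ zero * ⟦ termᴺ (ℕ.suc n) k (i ∷ α) ⟧ ρ             ≈⟨ *-congˡ (⟦termᴺ⟧ (ℕ.suc n) k (i ∷ α) ρ) ⟩
    ρ zero * (ι k * (ρ zero ^ i * power (ρ ∘ suc) α))    ≈⟨ x*yz≈y*xz _ _ _ ⟩
    ι k * (ρ zero * (ρ zero ^ i * power (ρ ∘ suc) α))    ≈⟨ *-congˡ (*-assoc _ _ _) ⟨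
    ι k * (ρ zero ^ ℕ.suc i * power (ρ ∘ suc) α)         ∎

  ⟦constantᴺ⟧ : ∀ n k ρ → ⟦ constantᴺ n k ⟧ ρ ≈ ι k
  ⟦constantᴺ⟧ n k ρ = trans (⟦termᴺ⟧ n k (Vec.replicate n 0) ρ) (trans (*-congˡ (power-0 ρ)) (*-identityʳ (ι k)))

  isZeroᴺ-sound : ∀ n p ρ → T (isZeroᴺ n p) → ⟦ p ⟧ ρ ≈ 0#
  isZeroᴺ-sound ℕ.zero    k       ρ k≡0 = trans (reflexive (≡.cong ι (toWitness {a? = k ℤ.≟ 0ℤ} k≡0))) ι-0
  isZeroᴺ-sound (ℕ.suc n) []      ρ _   = refl
  isZeroᴺ-sound (ℕ.suc n) (a ∷ p) ρ all with a≡0 , p≡0 ← Equivalence.to T-∧ all = trans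
    (+-cong (isZeroᴺ-sound n a (ρ ∘ suc) a≡0) (trans (*-congˡ (isZeroᴺ-sound (ℕ.suc n) p ρ p≡0)) (zeroʳ _)))
    (+-identityˡ 0#)

  T-equalᴺ-sound : ∀ n p q ρ → T (equalᴺ n p q) → ⟦ p ⟧ ρ ≈ ⟦ q ⟧ ρ
  T-equalᴺ-sound ℕ.zero    k       l       ρ k≡l = reflexive (≡.cong ι (toWitness {a? = k ℤ.≟ l} k≡l))
  T-equalᴺ-sound (ℕ.suc n) []      q       ρ q≡0 = sym (isZeroᴺ-sound (ℕ.suc n) q ρ q≡0)
  T-equalᴺ-sound (ℕ.suc n) (a ∷ p) []      ρ p≡0 = isZeroᴺ-sound (ℕ.suc n) (a ∷ p) ρ p≡0
  T-equalᴺ-sound (ℕ.suc n) (a ∷ p) (b ∷ q) ρ all with a≡b , p≡q ← Equivalence.to T-∧ all =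
    +-cong (T-equalᴺ-sound n a b (ρ ∘ suc) a≡b) (*-congˡ (T-equalᴺ-sound (ℕ.suc n) p q ρ p≡q))

  equalᴺ-sound : ∀ n p q ρ → equalᴺ n p q ≡ true → ⟦ p ⟧ ρ ≈ ⟦ q ⟧ ρ
  equalᴺ-sound n p q ρ p≡q = T-equalᴺ-sound n p q ρ (Equivalence.from T-≡ p≡q)

  ⟦⟧-homo : ∀ {n} ρ → SemiringMorphisms.IsSemiringHomomorphism (nestedRawSemiring n) rawSemiring (λ p → ⟦_⟧ {n} p ρ)
  ⟦⟧-homo {n} ρ = semiringHomomorphism (λ p → ⟦_⟧ {n} p ρ) (λ { ≡.refl → refl })
    (λ p q → ⟦addᴺ⟧ n p q ρ) (⟦0ᴺ⟧ n ρ) (λ p q → ⟦mulᴺ⟧ n p q ρ) (trans (⟦constantᴺ⟧ n 1ℤ ρ) ι-1)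

  ⟦nested⟧ : ∀ n f ρ → ⟦ nested n f ⟧ ρ ≈ Eval.evaluate n ρ f
  ⟦nested⟧ n []            ρ = ⟦0ᴺ⟧ n ρ
  ⟦nested⟧ n ((k , α) ∷ f) ρ with k ℤ.≟ 0ℤ
  ... | yes ≡.refl = trans (⟦nested⟧ n f ρ) (sym (trans (+-congʳ (trans (*-congʳ ι-0) (zeroˡ _))) (+-identityˡ _)))
  ... | no  _      = trans (⟦addᴺ⟧ n (termᴺ n k α) (nested n f) ρ) (+-cong (⟦termᴺ⟧ n k α ρ) (⟦nested⟧ n f ρ))

  ⟦substitute⟧ : ∀ {m} n p f ρ → ⟦ substitute {m} n p f ⟧ ρ ≈ Eval.evaluate m (λ i → Eval.evaluate n ρ (p i)) f
  ⟦substitute⟧ n p []            ρ = ⟦0ᴺ⟧ n ρ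
  ⟦substitute⟧ {m} n p ((k , α) ∷ f) ρ = trans
    (⟦addᴺ⟧ n (mulᴺ n (constantᴺ n k) (Powers.power (nestedRawSemiring n) (nested n ∘ p) α)) (substitute n p f) ρ)
    (+-cong (trans (⟦mulᴺ⟧ n (constantᴺ n k) (Powers.power (nestedRawSemiring n) (nested n ∘ p) α) ρ) (*-cong (⟦constantᴺ⟧ n k ρ)
        (trans (power-homo (nested n ∘ p) α) (power-cong (λ i → ⟦nested⟧ n (p i) ρ) α))))
      (⟦substitute⟧ n p f ρ))
    where open SemiringHomomorphismLemmas (nestedRawSemiring n) S (⟦⟧-homo ρ)

-- Homogeneity, and polynomials with integer coefficients

module Homogeneity {c ℓ} (K : CommutativeRing c ℓ) (n : ℕ) {s ℓs} (S : CommutativeSemiring s ℓs)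
  {ι} (ι-homo : SemiringMorphisms.IsSemiringHomomorphism
    (Semiring.rawSemiring (CommutativeRing.semiring K)) (CommutativeSemiring.rawSemiring S) ι) where

  open Polynomials K n
  open CommutativeSemiringLemmas S
  open Evaluation K n S ι-homo

  evaluate-homogeneous : ∀ x p {d f} → All (λ (_ , α) → Vec.sum α ≡ d) f →
    evaluate (λ i → x * p i) f ≈ x ^ d * evaluate p f
  evaluate-homogeneous x p []                           = sym (zeroʳ _)
  evaluate-homogeneous x p (_∷_ {a , α} {f} ≡.refl rest) = begin
    ι a * power (λ i → x * p i) α + evaluate (λ i → x * p i) f
      ≈⟨ +-cong (*-congˡ (trans (power-* (λ _ → x) p α) (*-congʳ (power-const x α)))) (evaluate-homogeneous x p rest) ⟩
    ι a * (x ^ Vec.sum α * power p α) + x ^ Vec.sum α * evaluate p f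
      ≈⟨ +-congʳ (x*yz≈y*xz _ _ _) ⟩
    x ^ Vec.sum α * (ι a * power p α) + x ^ Vec.sum α * evaluate p f
      ≈⟨ distribˡ _ _ _ ⟨
    x ^ Vec.sum α * evaluate p ((a , α) ∷ f)   ∎
    where open SetoidReasoning setoid

module IntegerCoefficients {c ℓ} (K : CommutativeRing c ℓ) (n : ℕ)
  {ι} (ι-homo : SemiringMorphisms.IsSemiringHomomorphism
    (Semiring.rawSemiring (CommutativeRing.semiring ℤ.+-*-commutativeRing))
    (Semiring.rawSemiring (CommutativeRing.semiring K)) ι) where

  open Polynomials K n
  open PolynomialSemiring K n
  open MatrixAction K n
  private
    module K = CommutativeSemiringLemmas (CommutativeRing.commutativeSemiring K)
    module Poly = CommutativeSemiringLemmas polyCommutativeSemiring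
    module ι = SemiringMorphisms.IsSemiringHomomorphism ι-homo
  open SetoidReasoning Poly.setoid

  constant∘ι-homo : SemiringMorphisms.IsSemiringHomomorphism
    (Semiring.rawSemiring (CommutativeRing.semiring ℤ.+-*-commutativeRing)) polyRawSemiring (constant ∘ ι)
  constant∘ι-homo = Composition.isSemiringHomomorphism (λ {f} {g} {h} → Poly.trans {f} {g} {h}) ι-homo constant-homo

  open Evaluation ℤ.+-*-commutativeRing n polyCommutativeSemiring constant∘ι-homo public
    using () renaming (evaluate to evaluateℤ; evaluate-cong to evaluateℤ-cong; evaluate-linear to evaluateℤ-linear; extend-∙ₚ to extendℤ-∙ₚ)
  open Homogeneity ℤ.+-*-commutativeRing n polyCommutativeSemiring constant∘ι-homo
  open NestedSemantics polyCommutativeSemiring constant∘ι-homo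

  embed : ℤₚ.Poly n → Poly
  embed = map λ (k , α) → ι k , α

  evaluate-embed : ∀ p f → evaluate p (embed f) ≡ evaluateℤ p f
  evaluate-embed p []            = ≡.refl
  evaluate-embed p ((k , α) ∷ f) = ≡.cong (constant (ι k) *ₚ Poly.power p α +ₚ_) (evaluate-embed p f)

  evaluateℤ-var : ∀ f → evaluateℤ var f ≈ₚ embed f
  evaluateℤ-var f = begin
    evaluateℤ var f          ≡⟨ evaluate-embed var f ⟨
    evaluate var (embed f)   ≈⟨ evaluate-var-id (embed f) ⟩
    embed f                  ∎

  evaluateℤ-scale : ∀ p N f → evaluateℤ p (ℤₚ._∙ₚ_ n N f) ≈ₚ constant (ι N) *ₚ evaluateℤ p f
  evaluateℤ-scale p = extendℤ-∙ₚ (Poly.power p)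

  coefficient-embed : ∀ f α → coefficient (embed f) α K.≈ ι (ℤₚ.coefficient n f α)
  coefficient-embed []            α = K.sym ι.0#-homo
  coefficient-embed ((k , β) ∷ f) α = K.trans (K.+-cong term (coefficient-embed f α)) (K.sym (ι.+-homo _ _))
    where
    term : (if does (β ≟ₑ α) then ι k else K.0#) K.≈ ι (if does (β ≟ₑ α) then k else 0ℤ)
    term with does (β ≟ₑ α)
    ... | true  = K.refl
    ... | false = K.sym ι.0#-homo

  embed-homogeneous : ∀ {d f} → All (λ (_ , α) → Vec.sum α ≡ d) f → IsHomogeneous d (embed f)
  embed-homogeneous []                             α α≢d = K.refl
  embed-homogeneous (_∷_ {k , β} {f} β≡d rest) α α≢d = K.trans
    (K.+-cong (K.reflexive (≡.cong (if_then ι k else K.0#) (dec-false (β ≟ₑ α) λ β≡α → α≢d (≡.trans (≡.cong Vec.sum (≡.sym β≡α)) β≡d))))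
      (embed-homogeneous rest α α≢d))
    (K.+-identityˡ K.0#)

  nested-equal⇒evaluateℤ : ∀ f g → equalᴺ n (nested n f) (nested n g) ≡ true → ∀ ρ → evaluateℤ ρ f ≈ₚ evaluateℤ ρ g
  nested-equal⇒evaluateℤ f g f≡g ρ = begin
    evaluateℤ ρ f        ≈⟨ ⟦nested⟧ n f ρ ⟨
    ⟦ nested n f ⟧ ρ     ≈⟨ equalᴺ-sound n (nested n f) (nested n g) ρ f≡g ⟩
    ⟦ nested n g ⟧ ρ     ≈⟨ ⟦nested⟧ n g ρ ⟩
    evaluateℤ ρ g        ∎

  -- The test is a computation with integers, but its conclusion holds at every family of
  -- polynomials over K. At the variables it is an identity of polynomials; at other linear forms it
  -- can be composed with a second identity.
  substitute-equal⇒evaluateℤ : ∀ p f g → equalᴺ n (substitute n p f) (nested n g) ≡ true →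
    ∀ ρ → evaluateℤ (λ i → evaluateℤ ρ (p i)) f ≈ₚ evaluateℤ ρ g
  substitute-equal⇒evaluateℤ p f g f≡g ρ = begin
    evaluateℤ (λ i → evaluateℤ ρ (p i)) f   ≈⟨ ⟦substitute⟧ n p f ρ ⟨
    ⟦ substitute n p f ⟧ ρ                  ≈⟨ equalᴺ-sound n (substitute n p f) (nested n g) ρ f≡g ⟩
    ⟦ nested n g ⟧ ρ                        ≈⟨ ⟦nested⟧ n g ρ ⟩
    evaluateℤ ρ g                           ∎

  forms : (Fin n → Fin n → ℤ) → Fin n → ℤₚ.Poly n
  forms L i = ℤₚ.∑ₚ n λ j → ℤₚ._∙ₚ_ n (L i j) (ℤₚ.var n j)

  linearForms-scaled : ∀ a L i → linearForms (λ i j → a K.* ι (L i j)) i ≈ₚ constant a *ₚ evaluateℤ var (forms L i)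
  linearForms-scaled a L i = begin
    linearForms (λ i j → a K.* ι (L i j)) i
      ≈⟨ Poly.sum-cong {x = λ j → (a K.* ι (L i j)) ∙ₚ var j} {y = λ j → constant a *ₚ t j} (λ j → begin
           (a K.* ι (L i j)) ∙ₚ var j
             ≈⟨ constant-*ₚ (a K.* ι (L i j)) (var j) ⟨
           constant (a K.* ι (L i j)) *ₚ var j
             ≈⟨ *ₚ-cong {constant (a K.* ι (L i j))} {constant a *ₚ constant (ι (L i j))} {var j} {var j}
                  (constant.*-homo a (ι (L i j))) (Poly.refl {var j}) ⟩
           constant a *ₚ constant (ι (L i j)) *ₚ var j
             ≈⟨ *ₚ-assoc (constant a) (constant (ι (L i j))) (var j) ⟩
           constant a *ₚ t j   ∎) ⟩
    Poly.sum (λ j → constant a *ₚ t j)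
      ≈⟨ Poly.*-distribˡ-sum (constant a) t ⟨
    constant a *ₚ Poly.sum t
      ≈⟨ *ₚ-cong {constant a} {constant a} {Poly.sum t} {evaluateℤ var (forms L i)} (Poly.refl {constant a})
           (Poly.sym {evaluateℤ var (forms L i)} {Poly.sum t} (evaluateℤ-linear var (L i))) ⟩
    constant a *ₚ evaluateℤ var (forms L i)   ∎
    where
    module constant = SemiringMorphisms.IsSemiringHomomorphism constant-homo
    t = λ j → constant (ι (L i j)) *ₚ var j

  -- The hypothesis on `p` holds at every point, in particular at the image of `ρ` under `q`, which
  -- gives f(r) = f(p(q)) = M f(q) = M N f. Invariance under a product of matrices can thus be
  -- tested on its sparse factors.
  compose-forms : ∀ (p q r : Fin n → ℤₚ.Poly n) f M N →
    (∀ i ρ → evaluateℤ (λ j → evaluateℤ ρ (q j)) (p i) ≈ₚ evaluateℤ ρ (r i)) →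
    (∀ ρ → evaluateℤ (λ i → evaluateℤ ρ (p i)) f ≈ₚ evaluateℤ ρ (ℤₚ._∙ₚ_ n M f)) →
    (∀ ρ → evaluateℤ (λ i → evaluateℤ ρ (q i)) f ≈ₚ evaluateℤ ρ (ℤₚ._∙ₚ_ n N f)) →
    ∀ ρ → evaluateℤ (λ i → evaluateℤ ρ (r i)) f ≈ₚ evaluateℤ ρ (ℤₚ._∙ₚ_ n (M ℤ.* N) f)
  compose-forms p q r f M N pq≈r pf≈Mf qf≈Nf ρ = begin
    evaluateℤ (λ i → evaluateℤ ρ (r i)) f
      ≈⟨ evaluateℤ-cong {p = λ i → evaluateℤ y (p i)} {q = λ i → evaluateℤ ρ (r i)} f (λ i → pq≈r i ρ) ⟨
    evaluateℤ (λ i → evaluateℤ y (p i)) f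
      ≈⟨ pf≈Mf y ⟩
    evaluateℤ y (ℤₚ._∙ₚ_ n M f)
      ≈⟨ evaluateℤ-scale y M f ⟩
    cM *ₚ evaluateℤ y f
      ≈⟨ *ₚ-cong {cM} {cM} {evaluateℤ y f} {cN *ₚ evaluateℤ ρ f} (Poly.refl {cM})
           (Poly.trans {evaluateℤ y f} {evaluateℤ ρ (ℤₚ._∙ₚ_ n N f)} {cN *ₚ evaluateℤ ρ f} (qf≈Nf ρ) (evaluateℤ-scale ρ N f)) ⟩
    cM *ₚ (cN *ₚ evaluateℤ ρ f)
      ≈⟨ *ₚ-assoc cM cN (evaluateℤ ρ f) ⟨
    cM *ₚ cN *ₚ evaluateℤ ρ f
      ≈⟨ *ₚ-cong {constant (ι (M ℤ.* N))} {cM *ₚ cN} {evaluateℤ ρ f} {evaluateℤ ρ f} (*-homo M N) (Poly.refl {evaluateℤ ρ f}) ⟨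
    constant (ι (M ℤ.* N)) *ₚ evaluateℤ ρ f
      ≈⟨ evaluateℤ-scale ρ (M ℤ.* N) f ⟨
    evaluateℤ ρ (ℤₚ._∙ₚ_ n (M ℤ.* N) f)   ∎
    where
    open SemiringMorphisms.IsSemiringHomomorphism constant∘ι-homo using (*-homo)
    y = λ i → evaluateℤ ρ (q i)
    cM = constant (ι M)
    cN = constant (ι N)

  -- Homogeneity pulls the scalar out of all the linear forms at once as its d-th power. What is
  -- left is an identity between integer polynomials and one equation between scalars, the only
  -- place where `a` matters.
  scaled-fixes-embed : ∀ a L {d} N {f} → All (λ (_ , α) → Vec.sum α ≡ d) f →
    evaluateℤ (λ i → evaluateℤ var (forms L i)) f ≈ₚ evaluateℤ var (ℤₚ._∙ₚ_ n N f) →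
    a K.^ d K.* ι N K.≈ K.1# → (λ i j → a K.* ι (L i j)) · embed f ≈ₚ embed f
  scaled-fixes-embed a L {d} N {f} homogeneous Lf≈Nf aᵈN≈1 = begin
    A · embed f
      ≈⟨ ·-evaluate A (embed f) ⟩
    evaluate (linearForms A) (embed f)
      ≡⟨ evaluate-embed (linearForms A) f ⟩
    evaluateℤ (linearForms A) f
      ≈⟨ evaluateℤ-cong f (linearForms-scaled a L) ⟩
    evaluateℤ (λ i → constant a *ₚ y i) f
      ≈⟨ evaluate-homogeneous (constant a) y homogeneous ⟩
    constant a Poly.^ d *ₚ evaluateℤ y f
      ≈⟨ *ₚ-cong {constant a Poly.^ d} {constant (a K.^ d)} {evaluateℤ y f} {constant (ι N) *ₚ embed f}
           (Poly.sym {constant (a K.^ d)} {constant a Poly.^ d} (^-homo a d)) (begin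
             evaluateℤ y f                          ≈⟨ Lf≈Nf ⟩
             evaluateℤ var (ℤₚ._∙ₚ_ n N f)          ≈⟨ evaluateℤ-scale var N f ⟩
             constant (ι N) *ₚ evaluateℤ var f      ≈⟨ *ₚ-cong {constant (ι N)} {constant (ι N)} {evaluateℤ var f} {embed f}
                                                         (Poly.refl {constant (ι N)}) (evaluateℤ-var f) ⟩
             constant (ι N) *ₚ embed f              ∎) ⟩
    constant (a K.^ d) *ₚ (constant (ι N) *ₚ embed f)
      ≈⟨ *ₚ-assoc (constant (a K.^ d)) (constant (ι N)) (embed f) ⟨
    constant (a K.^ d) *ₚ constant (ι N) *ₚ embed f
      ≈⟨ *ₚ-cong {constant (a K.^ d) *ₚ constant (ι N)} {1ₚ} {embed f} {embed f} (begin
           constant (a K.^ d) *ₚ constant (ι N)   ≈⟨ constant.*-homo (a K.^ d) (ι N) ⟨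
           constant (a K.^ d K.* ι N)             ≈⟨ constant.⟦⟧-cong aᵈN≈1 ⟩
           1ₚ                                     ∎) (Poly.refl {embed f}) ⟩
    1ₚ *ₚ embed f
      ≈⟨ *ₚ-identityˡ (embed f) ⟩
    embed f   ∎
    where
    module constant = SemiringMorphisms.IsSemiringHomomorphism constant-homo
    open SemiringHomomorphismLemmas K.rawSemiring polyCommutativeSemiring constant-homo using (^-homo)
    A = λ i j → a K.* ι (L i j)
    y = λ i → evaluateℤ var (forms L i)

open import Defs
open import Algebra.Properties.Ring (CommutativeRing.ring ℂ-commutativeRing) using (-1*x≈-x; +-cancelʳ)

-- Enumeration of linear codes

module Span (m : ℕ) .{{_ : ℕ.NonZero m}} where

  open ℤ/ m using (Generated; _+ʷ_; _*ʷ_; 0ʷ; combination; words; ∈-words; combination⇒generated; generated⇒combination)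

  -- Stands in for `codewords`, which would run through all 65536 quaternary words of length 8 and
  -- search the combinations of the rows for each. Rows of order 2 produce the same word several
  -- times, hence the removal of duplicates: each codeword must be counted once.
  span : ∀ {k n} → Vec (Word m n) k → List (Word m n)
  span []      = 0ʷ ∷ []
  span (g ∷ G) = deduplicate (Vec.≡-dec Fin._≟_) (cartesianProductWith (λ a w → a *ʷ g +ʷ w) (allFin m) (span G))

  span-unique : ∀ {k n} (G : Vec (Word m n) k) → Unique (span G)
  span-unique []      = All.[] AllPairs.∷ AllPairs.[]
  span-unique (g ∷ G) = DecUnique.deduplicate-! (Vec.≡-dec Fin._≟_) _

  combination∈span : ∀ {k n} (c : Word m k) (G : Vec (Word m n) k) → combination c G ∈ span G
  combination∈span []      []      = here ≡.refl
  combination∈span (a ∷ c) (g ∷ G) = ∈-deduplicate⁺ (Vec.≡-dec Fin._≟_)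
    (∈-cartesianProductWith⁺ (λ a w → a *ʷ g +ʷ w) (∈-allFin a) (combination∈span c G))

  ∈span⇒combination : ∀ {k n} (G : Vec (Word m n) k) {w} → w ∈ span G → ∃ λ c → combination c G ≡ w
  ∈span⇒combination []      (here ≡.refl) = [] , ≡.refl
  ∈span⇒combination (g ∷ G) w∈
    with a , v , _ , v∈ , ≡.refl ← ∈-cartesianProductWith⁻ (λ a w → a *ʷ g +ʷ w) (allFin m) (span G)
           (∈-deduplicate⁻ (Vec.≡-dec Fin._≟_) (cartesianProductWith (λ a w → a *ʷ g +ʷ w) (allFin m) (span G)) w∈)
    with c , ≡.refl ← ∈span⇒combination G v∈ = a ∷ c , ≡.refl

  words-unique : ∀ n → Unique (words n)
  words-unique ℕ.zero    = All.[] AllPairs.∷ AllPairs.[]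
  words-unique (ℕ.suc n) = Unique.cartesianProductWith⁺ _∷_ Vec.∷-injective (Unique.allFin⁺ m) (words-unique n)

  codewords-unique : ∀ {n} (C : LinearCode m n) → Unique (codewords m C)
  codewords-unique {n} C = Unique.filter⁺ (LinearCode.codeword? C) (words-unique n)

  _GeneratedBy_ : ∀ {k n} → LinearCode m n → Vec (Word m n) k → Set
  C GeneratedBy G = ∀ {w} → LinearCode.Codeword C w ⇔ Generated G w

  ∈codewords⇒∈span : ∀ {k n} (C : LinearCode m n) (G : Vec (Word m n) k) → C GeneratedBy G →
    ∀ {w} → w ∈ codewords m C → w ∈ span G
  ∈codewords⇒∈span {n = n} C G C⇔G w∈
    with _ , Cw ← ∈-filter⁻ (LinearCode.codeword? C) {xs = words n} w∈
    with c , ≡.refl ← generated⇒combination (Equivalence.to C⇔G Cw) = combination∈span c G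

  ∈span⇒∈codewords : ∀ {k n} (C : LinearCode m n) (G : Vec (Word m n) k) → C GeneratedBy G →
    ∀ {w} → w ∈ span G → w ∈ codewords m C
  ∈span⇒∈codewords C G C⇔G w∈ with c , ≡.refl ← ∈span⇒combination G w∈ =
    ∈-filter⁺ (LinearCode.codeword? C) (∈-words (combination c G)) (Equivalence.from C⇔G (combination⇒generated c G))

open Span using (span; _GeneratedBy_)

-- Two lists without repetitions and with the same elements are permutations of each other, and a
-- permutation leaves the sum over the pairs unchanged.
codeword-pairs↭span-pairs : ∀ {j k l n} (C : LinearCode 2 l) (C′ : LinearCode 4 n) (G : Vec (Word 2 l) j) (G′ : Vec (Word 4 n) k) →
  _GeneratedBy_ 2 C G → _GeneratedBy_ 4 C′ G′ →
  cartesianProduct (codewords 2 C) (codewords 4 C′) ↭ cartesianProduct (span 2 G) (span 4 G′)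
codeword-pairs↭span-pairs C C′ G G′ C⇔G C′⇔G′ = ∼bag⇒↭ (unique∧set⇒bag
  (Unique.cartesianProduct⁺ (Span.codewords-unique 2 C) (Span.codewords-unique 4 C′))
  (Unique.cartesianProduct⁺ (Span.span-unique 2 G) (Span.span-unique 4 G′))
  (mk⇔
    (λ p → let u , v = ∈-cartesianProduct⁻ (codewords 2 C) (codewords 4 C′) p
           in ∈-cartesianProduct⁺ (Span.∈codewords⇒∈span 2 C G C⇔G u) (Span.∈codewords⇒∈span 4 C′ G′ C′⇔G′ v))
    (λ p → let u , v = ∈-cartesianProduct⁻ (span 2 G) (span 4 G′) p
           in ∈-cartesianProduct⁺ (Span.∈span⇒∈codewords 2 C G C⇔G u) (Span.∈span⇒∈codewords 4 C′ G′ C′⇔G′ v))))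

-- Arithmetic of ℂ

module ≃-Reasoning = SetoidReasoning ℚᵘ.≃-setoid

module ℂ′ = CommutativeSemiringLemmas (CommutativeRing.commutativeSemiring ℂ-commutativeRing)

toℚᵘ-/1 : ∀ k → ℚ.toℚᵘ (k ℚ./ 1) ℚᵘ.≃ ℚᵘ.mkℚᵘ k 0
toℚᵘ-/1 k = ℚ.toℚᵘ-fromℚᵘ (ℚᵘ.mkℚᵘ k 0)

/1-homo-+ : ∀ j k → (j ℤ.+ k) ℚ./ 1 ≡ j ℚ./ 1 ℚ.+ k ℚ./ 1
/1-homo-+ j k = ℚ.toℚᵘ-injective (begin
  ℚ.toℚᵘ ((j ℤ.+ k) ℚ./ 1)                   ≈⟨ toℚᵘ-/1 (j ℤ.+ k) ⟩
  ℚᵘ.mkℚᵘ (j ℤ.+ k) 0                        ≈⟨ ℚᵘ.*≡* (solve 2 (λ j k → (j :+ k) :* con 1ℤ := (j :* con 1ℤ :+ k :* con 1ℤ) :* con 1ℤ) ≡.refl j k) ⟩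
  ℚᵘ.mkℚᵘ j 0 ℚᵘ.+ ℚᵘ.mkℚᵘ k 0               ≈⟨ ℚᵘ.+-cong (toℚᵘ-/1 j) (toℚᵘ-/1 k) ⟨
  ℚ.toℚᵘ (j ℚ./ 1) ℚᵘ.+ ℚ.toℚᵘ (k ℚ./ 1)     ≈⟨ ℚ.toℚᵘ-homo-+ (j ℚ./ 1) (k ℚ./ 1) ⟨
  ℚ.toℚᵘ (j ℚ./ 1 ℚ.+ k ℚ./ 1)               ∎)
  where
  open ≃-Reasoning
  open Data.Integer.Solver.+-*-Solver

/1-homo-* : ∀ j k → (j ℤ.* k) ℚ./ 1 ≡ (j ℚ./ 1) ℚ.* (k ℚ./ 1)
/1-homo-* j k = ℚ.toℚᵘ-injective (begin
  ℚ.toℚᵘ ((j ℤ.* k) ℚ./ 1)                   ≈⟨ toℚᵘ-/1 (j ℤ.* k) ⟩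
  ℚᵘ.mkℚᵘ j 0 ℚᵘ.* ℚᵘ.mkℚᵘ k 0               ≈⟨ ℚᵘ.*-cong (toℚᵘ-/1 j) (toℚᵘ-/1 k) ⟨
  ℚ.toℚᵘ (j ℚ./ 1) ℚᵘ.* ℚ.toℚᵘ (k ℚ./ 1)     ≈⟨ ℚ.toℚᵘ-homo-* (j ℚ./ 1) (k ℚ./ 1) ⟨
  ℚ.toℚᵘ ((j ℚ./ 1) ℚ.* (k ℚ./ 1))               ∎)
  where open ≃-Reasoning

/1-injective : ∀ {k} → k ℚ./ 1 ≡ 0ℚ → k ≡ 0ℤ
/1-injective {k} eq with ℚᵘ.*≡* p ← ℚᵘ.≃-trans (ℚᵘ.≃-sym (toℚᵘ-/1 k)) (ℚᵘ.≃-reflexive (≡.cong ℚ.toℚᵘ eq)) =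
  ≡.trans (≡.sym (ℤ.*-identityʳ k)) p

ℚ⇒ℂ-cong : ∀ {p q} → p ≡ q → ℚ⇒ℂ p ≃ᶜ ℚ⇒ℂ q
ℚ⇒ℂ-cong ≡.refl = ≃ᶜ-refl

ℚ⇒ℂ-homo-+ : ∀ p q → ℚ⇒ℂ (p ℚ.+ q) ≃ᶜ ℚ⇒ℂ p +ᶜ ℚ⇒ℂ q
ℚ⇒ℂ-homo-+ p q = ≗⇒≃ᶜ (ℚ⇒ℂ (p ℚ.+ q)) (ℚ⇒ℂ p +ᶜ ℚ⇒ℂ q) (λ _ → ≡.refl) (λ _ → ≡.refl)

ℚ⇒ℂ-homo-* : ∀ p q → ℚ⇒ℂ (p ℚ.* q) ≃ᶜ ℚ⇒ℂ p *ᶜ ℚ⇒ℂ q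
ℚ⇒ℂ-homo-* p q = ≗⇒≃ᶜ (ℚ⇒ℂ (p ℚ.* q)) (ℚ⇒ℂ p *ᶜ ℚ⇒ℂ q)
  (λ _ → ≡.sym (ℚ.+-identityʳ (p ℚ.* q)))
  (λ _ → ≡.sym (≡.trans (≡.cong₂ ℚ._+_ (ℚ.*-zeroʳ p) (ℚ.*-zeroˡ q)) ≡.refl))

ℤ⇒ℂ-homo : SemiringMorphisms.IsSemiringHomomorphism
  (Semiring.rawSemiring (CommutativeRing.semiring ℤ.+-*-commutativeRing))
  (Semiring.rawSemiring (CommutativeRing.semiring ℂ-commutativeRing)) ℤ⇒ℂ
ℤ⇒ℂ-homo = semiringHomomorphism ℤ⇒ℂ (λ { ≡.refl → ≃ᶜ-refl })
  (λ j k → ≃ᶜ-trans (ℚ⇒ℂ-cong (/1-homo-+ j k)) (ℚ⇒ℂ-homo-+ (j ℚ./ 1) (k ℚ./ 1))) ≃ᶜ-refl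
  (λ j k → ≃ᶜ-trans (ℚ⇒ℂ-cong (/1-homo-* j k)) (ℚ⇒ℂ-homo-* (j ℚ./ 1) (k ℚ./ 1))) ≃ᶜ-refl

-- Multiplication by the rational inverse. No other division in ℂ is called for, because the pivots
-- of the elimination are integers.
ℚ⇒ℂ-cancel : ∀ q → q ≢ 0ℚ → ∀ x → ℚ⇒ℂ q *ᶜ x ≃ᶜ 0ᶜ → x ≃ᶜ 0ᶜ
ℚ⇒ℂ-cancel q q≢0 x qx≈0 = begin
  x                                      ≈⟨ ℂ′.*-identityˡ x ⟨
  1ᶜ *ᶜ x                                ≈⟨ ℂ′.*-congʳ {x} {1ᶜ} (≃ᶜ-trans (ℚ⇒ℂ-cong (≡.sym (ℚ.*-inverseˡ q))) (ℚ⇒ℂ-homo-* (ℚ.1/ q) q)) ⟩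
  ℚ⇒ℂ (ℚ.1/ q) *ᶜ ℚ⇒ℂ q *ᶜ x             ≈⟨ ℂ′.*-assoc (ℚ⇒ℂ (ℚ.1/ q)) (ℚ⇒ℂ q) x ⟩
  ℚ⇒ℂ (ℚ.1/ q) *ᶜ (ℚ⇒ℂ q *ᶜ x)           ≈⟨ ℂ′.*-congˡ {ℚ⇒ℂ (ℚ.1/ q)} qx≈0 ⟩
  ℚ⇒ℂ (ℚ.1/ q) *ᶜ 0ᶜ                     ≈⟨ ℂ′.zeroʳ (ℚ⇒ℂ (ℚ.1/ q)) ⟩
  0ᶜ                                     ∎
  where
  open import Relation.Binary.Reasoning.Setoid ℂ′.setoid
  instance
    q-nonZero : ℚ.NonZero q
    q-nonZero = ℚ.≢-nonZero q≢0

ℤ⇒ℂ-cancel : ∀ k → k ≢ 0ℤ → ∀ x → ℤ⇒ℂ k *ᶜ x ≃ᶜ 0ᶜ → x ≃ᶜ 0ᶜ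
ℤ⇒ℂ-cancel k k≢0 = ℚ⇒ℂ-cancel (k ℚ./ 1) (λ eq → k≢0 (/1-injective eq))

-- For k = ⌊N√2⌋ one has 0 ≤ 2N² − k² ≤ 2k ≤ 4N.
√2-numerator-defect : ∀ n → ∃ λ r → (2 ℕ.* (ℕ.suc n ℕ.* ℕ.suc n) ≡ √2-numerator n ℕ.* √2-numerator n ℕ.+ r) × r ℕ.≤ 4 ℕ.* ℕ.suc n
√2-numerator-defect n = r , ≡.sym (ℕ.m+[n∸m]≡n lower) , r≤
  where
  N = ℕ.suc n
  k = √2-numerator n
  lower = ⌊√⌋-lower (2 ℕ.* (N ℕ.* N))
  r = 2 ℕ.* (N ℕ.* N) ℕ.∸ k ℕ.* k
  k≤2N : k ℕ.≤ 2 ℕ.* N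
  k≤2N = ℕ.≮⇒≥ λ 2N<k → ℕ.<-irrefl ≡.refl (begin-strict
    k ℕ.* k                       ≤⟨ lower ⟩
    2 ℕ.* (N ℕ.* N)               ≤⟨ ℕ.*-monoˡ-≤ (N ℕ.* N) (ℕ.s≤s (ℕ.s≤s (ℕ.z≤n {2}))) ⟩
    4 ℕ.* (N ℕ.* N)               ≡⟨ solve 1 (λ N → con 4 :* (N :* N) := (con 2 :* N) :* (con 2 :* N)) ≡.refl N ⟩
    (2 ℕ.* N) ℕ.* (2 ℕ.* N)       <⟨ ℕ.*-mono-< 2N<k 2N<k ⟩
    k ℕ.* k                       ∎)
    where
    open ℕ.≤-Reasoning
    open Data.Nat.Solver.+-*-Solver
  r≤ : r ℕ.≤ 4 ℕ.* N
  r≤ = begin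
    2 ℕ.* (N ℕ.* N) ℕ.∸ k ℕ.* k                ≤⟨ ℕ.∸-monoˡ-≤ (k ℕ.* k) (ℕ.≤-pred (ℕ.≤-trans (⌊√⌋-upper (2 ℕ.* (N ℕ.* N))) (ℕ.≤-reflexive
                                                    (solve 1 (λ k → (con 1 :+ k) :* (con 1 :+ k) := con 1 :+ (con 2 :* k :+ k :* k)) ≡.refl k)))) ⟩
    (2 ℕ.* k ℕ.+ k ℕ.* k) ℕ.∸ k ℕ.* k          ≡⟨ ℕ.m+n∸n≡m (2 ℕ.* k) (k ℕ.* k) ⟩
    2 ℕ.* k                                    ≤⟨ ℕ.*-monoʳ-≤ 2 k≤2N ⟩
    2 ℕ.* (2 ℕ.* N)                            ≡⟨ ℕ.*-assoc 2 2 N ⟨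
    4 ℕ.* N                                    ∎
    where
    open ℕ.≤-Reasoning
    open Data.Nat.Solver.+-*-Solver

-- Here δ is r / N² with N = n + 1, so that r ≤ 4N bounds it by 4 / N.
square-defect : ∀ n k r → 2 ℕ.* (ℕ.suc n ℕ.* ℕ.suc n) ≡ k ℕ.* k ℕ.+ r → r ℕ.≤ 4 ℕ.* ℕ.suc n →
  ∃ λ δ → ((+ k ℚ./ ℕ.suc n) ℚ.* (+ k ℚ./ ℕ.suc n) ≡ + 2 ℚ./ 1 ℚ.- δ) × ∣ δ ∣ ℚ.≤ + 4 ℚ./ ℕ.suc n
square-defect n k r eq r≤ = δ , square , bound
  where
  N = ℕ.suc n
  instance
    NN≢0 : ℕ.NonZero (N ℕ.* N)
    NN≢0 = _
  δ = + r ℚ./ (N ℕ.* N)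
  square : (+ k ℚ./ N) ℚ.* (+ k ℚ./ N) ≡ + 2 ℚ./ 1 ℚ.- δ
  square = ℚ.toℚᵘ-injective (begin
    ℚ.toℚᵘ ((+ k ℚ./ N) ℚ.* (+ k ℚ./ N))
      ≈⟨ ℚ.toℚᵘ-homo-* ((+ k ℚ./ N)) ((+ k ℚ./ N)) ⟩
    ℚ.toℚᵘ ((+ k ℚ./ N)) ℚᵘ.* ℚ.toℚᵘ ((+ k ℚ./ N))
      ≈⟨ ℚᵘ.*-cong (ℚ.toℚᵘ-fromℚᵘ (ℚᵘ.mkℚᵘ (+ k) n)) (ℚ.toℚᵘ-fromℚᵘ (ℚᵘ.mkℚᵘ (+ k) n)) ⟩
    ℚᵘ.mkℚᵘ (+ k) n ℚᵘ.* ℚᵘ.mkℚᵘ (+ k) n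
      ≈⟨ ℚᵘ.*≡* (≡.trans (≡.cong (λ x → (+ k ℤ.* + k) ℤ.* (+ 1 ℤ.* x)) (ℤ.pos-* N N)) (≡.trans (solve 3 (λ k N r →
           (k :* k) :* (con 1ℤ :* (N :* N)) := (((k :* k :+ r) :+ (:- r) :* con 1ℤ)) :* (N :* N)) ≡.refl (+ k) (+ N) (+ r))
           (≡.cong₂ ℤ._*_ (≡.cong (ℤ._+ (ℤ.- + r) ℤ.* 1ℤ) eqℤ) (≡.sym (ℤ.pos-* N N))))) ⟩
    ℚᵘ.mkℚᵘ (+ 2) 0 ℚᵘ.- (+ r) ℚᵘ./ (N ℕ.* N)
      ≈⟨ ℚᵘ.+-cong (toℚᵘ-/1 (+ 2)) (ℚᵘ.-‿cong (ℚ.toℚᵘ-fromℚᵘ ((+ r) ℚᵘ./ (N ℕ.* N)))) ⟨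
    ℚ.toℚᵘ (+ 2 ℚ./ 1) ℚᵘ.- ℚ.toℚᵘ δ
      ≈⟨ ℚᵘ.+-congʳ (ℚ.toℚᵘ (+ 2 ℚ./ 1)) (ℚ.toℚᵘ-homo‿- δ) ⟨
    ℚ.toℚᵘ (+ 2 ℚ./ 1) ℚᵘ.+ ℚ.toℚᵘ (ℚ.- δ)
      ≈⟨ ℚ.toℚᵘ-homo-+ (+ 2 ℚ./ 1) (ℚ.- δ) ⟨
    ℚ.toℚᵘ (+ 2 ℚ./ 1 ℚ.- δ)   ∎)
    where
    open ≃-Reasoning
    open Data.Integer.Solver.+-*-Solver
    eqℤ : + k ℤ.* + k ℤ.+ + r ≡ + 2 ℤ.* + (N ℕ.* N)
    eqℤ = ≡.trans (≡.cong (ℤ._+ + r) (≡.sym (ℤ.pos-* k k))) (≡.trans (≡.sym (ℤ.pos-+ (k ℕ.* k) r))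
      (≡.trans (≡.cong +_ (≡.sym eq)) (ℤ.pos-* 2 (N ℕ.* N))))
  bound : ∣ δ ∣ ℚ.≤ + 4 ℚ./ N
  bound = ℚ.≤-trans (ℚ.≤-reflexive (ℚ.0≤p⇒∣p∣≡p (ℚ.nonNegative⁻¹ δ {{ℚ.normalize-nonNeg r (N ℕ.* N)}})))
    (ℚ.toℚᵘ-cancel-≤ (begin
      ℚ.toℚᵘ δ                  ≃⟨ ℚ.toℚᵘ-fromℚᵘ ((+ r) ℚᵘ./ (N ℕ.* N)) ⟩
      (+ r) ℚᵘ./ (N ℕ.* N)      ≤⟨ ℚᵘ.*≤* (≡.subst₂ ℤ._≤_ (ℤ.pos-* r N) (ℤ.pos-* 4 (N ℕ.* N)) (ℤ.+≤+ (ℕ.≤-trans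
                                    (ℕ.*-monoˡ-≤ N r≤) (ℕ.≤-reflexive (ℕ.*-assoc 4 N N))))) ⟩
      ℚᵘ.mkℚᵘ (+ 4) n           ≃⟨ ℚ.toℚᵘ-fromℚᵘ (ℚᵘ.mkℚᵘ (+ 4) n) ⟨
      ℚ.toℚᵘ (+ 4 ℚ./ N)      ∎))
    where open ℚᵘ.≤-Reasoning

√2-defect : ∀ n → ∃ λ δ → (√2-seq n ℚ.* √2-seq n ≡ + 2 ℚ./ 1 ℚ.- δ) × ∣ δ ∣ ℚ.≤ + 4 ℚ./ ℕ.suc n
√2-defect n = let r , eq , r≤ = √2-numerator-defect n in square-defect n (√2-numerator n) r eq r≤

√2-square : √2 *ʳ √2 ≃ fromℚ (+ 2 ℚ./ 1)
√2-square = mk≃ λ ε 0<ε →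
  -- The square of the n-th term misses 2 by at most 4 / (n + 1), which is below ε as soon as 1 / (n
  -- + 1) is below ε / 4.
  let N , small = archimedean (+ 1 ℚ./ 4 ℚ.* ε) (ℚ.≤-<-trans (ℚ.≤-reflexive (≡.sym (ℚ.*-zeroʳ (+ 1 ℚ./ 4)))) (ℚ.*-monoʳ-<-pos (+ 1 ℚ./ 4) 0<ε))
  in N , λ n N≤n → let δ , eq , δ≤ = √2-defect n in ℚ.≤-<-trans
    (ℚ.≤-reflexive (≡.trans (≡.cong ∣_∣ (≡.trans (≡.cong (ℚ._- + 2 ℚ./ 1) eq) (cancel (+ 2 ℚ./ 1) δ))) (ℚ.∣-p∣≡∣p∣ δ)))
    (ℚ.≤-<-trans δ≤ (ℚ.≤-<-trans (ℚ.≤-reflexive (quadruple n)) (ℚ.<-≤-trans (ℚ.*-monoʳ-<-pos (+ 4 ℚ./ 1) (small n N≤n))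
      (ℚ.≤-reflexive (≡.trans (≡.sym (ℚ.*-assoc (+ 4 ℚ./ 1) (+ 1 ℚ./ 4) ε)) (ℚ.*-identityˡ ε))))))
  where
  cancel : ∀ a δ → a ℚ.- δ ℚ.- a ≡ ℚ.- δ
  cancel = solve 2 (λ a δ → a :- δ :- a := :- δ) ≡.refl
    where open Data.Rational.Solver.+-*-Solver
  quadruple : ∀ n → + 4 ℚ./ ℕ.suc n ≡ (+ 4 ℚ./ 1) ℚ.* (1ℤ ℚ./ ℕ.suc n)
  quadruple n = ℚ.toℚᵘ-injective (begin
    ℚ.toℚᵘ (+ 4 ℚ./ ℕ.suc n)                         ≈⟨ ℚ.toℚᵘ-fromℚᵘ (ℚᵘ.mkℚᵘ (+ 4) n) ⟩
    ℚᵘ.mkℚᵘ (+ 4) n                                ≈⟨ ℚᵘ.*≡* (≡.cong (λ x → + 4 ℤ.* x) (≡.cong +_ (ℕ.*-identityˡ (ℕ.suc n)))) ⟩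
    ℚᵘ.mkℚᵘ (+ 4) 0 ℚᵘ.* ℚᵘ.mkℚᵘ 1ℤ n              ≈⟨ ℚᵘ.*-cong (toℚᵘ-/1 (+ 4)) (ℚ.toℚᵘ-fromℚᵘ (ℚᵘ.mkℚᵘ 1ℤ n)) ⟨
    ℚ.toℚᵘ (+ 4 ℚ./ 1) ℚᵘ.* ℚ.toℚᵘ (1ℤ ℚ./ ℕ.suc n)  ≈⟨ ℚ.toℚᵘ-homo-* (+ 4 ℚ./ 1) (1ℤ ℚ./ ℕ.suc n) ⟨
    ℚ.toℚᵘ ((+ 4 ℚ./ 1) ℚ.* (1ℤ ℚ./ ℕ.suc n))        ∎)
    where open ≃-Reasoning

-- The eighth root of unity

iᶜ : ℂ
iᶜ .re = fromℚ 0ℚ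
iᶜ .im = fromℚ 1ℚ

-- With s = √2/2 the real part is s² - s² and the imaginary part 2s² = 1. Only here does the
-- construction of `√2` enter; afterwards z is known through its square.
z*z≈iᶜ : z *ᶜ z ≃ᶜ iᶜ
z*z≈iᶜ = mk≃ᶜ
  (≗⇒≃ {re (z *ᶜ z)} {re iᶜ} λ n → ℚ.+-inverseʳ (½ ℚ.* √2-seq n ℚ.* (½ ℚ.* √2-seq n)))
  (≃-trans (≗⇒≃ {im (z *ᶜ z)} {fromℚ ½ *ʳ (√2 *ʳ √2)} λ n → expand (√2-seq n))
    (≃-trans (*ʳ-cong {fromℚ ½} {fromℚ ½} {√2 *ʳ √2} {fromℚ (+ 2 ℚ./ 1)} ≃-refl √2-square)
      (≗⇒≃ {fromℚ ½ *ʳ fromℚ (+ 2 ℚ./ 1)} {im iᶜ} λ _ → ≡.refl)))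
  where
  expand : ∀ q → ½ ℚ.* q ℚ.* (½ ℚ.* q) ℚ.+ ½ ℚ.* q ℚ.* (½ ℚ.* q) ≡ ½ ℚ.* (q ℚ.* q)
  expand = solve 1 (λ q → con ½ :* q :* (con ½ :* q) :+ con ½ :* q :* (con ½ :* q) := con ½ :* (q :* q)) ≡.refl
    where open Data.Rational.Solver.+-*-Solver

-1ᶜ : ℂ
-1ᶜ = -ᶜ 1ᶜ

z^4≈-1 : z ℂ′.^ 4 ≃ᶜ -1ᶜ
z^4≈-1 = begin
  z ℂ′.^ 4                   ≈⟨ ℂ′.^-assocʳ z 2 2 ⟨
  (z ℂ′.^ 2) ℂ′.^ 2          ≈⟨ ℂ′.^-congˡ 2 {z ℂ′.^ 2} {iᶜ} (≃ᶜ-trans (ℂ′.*-congˡ {z} (ℂ′.*-identityʳ z)) z*z≈iᶜ) ⟩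
  iᶜ ℂ′.^ 2                   ≈⟨ ℂ′.*-congˡ {iᶜ} (ℂ′.*-identityʳ iᶜ) ⟩
  iᶜ *ᶜ iᶜ                     ≈⟨ ≗⇒≃ᶜ (iᶜ *ᶜ iᶜ) -1ᶜ (λ _ → ≡.refl) (λ _ → ≡.refl) ⟩
  -1ᶜ                        ∎
  where open SetoidReasoning ℂ′.setoid

open PolynomialSemiring ℂ-commutativeRing 6
open MatrixAction ℂ-commutativeRing 6 hiding (sumOver; sumOver-0; sumOver-cong; sumOver-+)
open IntegerCoefficients ℂ-commutativeRing 6 ℤ⇒ℂ-homo
module Polyℂ = CommutativeSemiringLemmas polyCommutativeSemiring

z^8≈1 : z ℂ′.^ 8 ≃ᶜ 1ᶜ
z^8≈1 = begin
  z ℂ′.^ 8              ≈⟨ ℂ′.^-assocʳ z 4 2 ⟨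
  (z ℂ′.^ 4) ℂ′.^ 2     ≈⟨ ℂ′.^-congˡ 2 z^4≈-1 ⟩
  -1ᶜ ℂ′.^ 2            ≈⟨ ℂ′.*-congˡ { -1ᶜ } (ℂ′.*-identityʳ -1ᶜ) ⟩
  -1ᶜ *ᶜ -1ᶜ            ≈⟨ ≗⇒≃ᶜ (-1ᶜ *ᶜ -1ᶜ) 1ᶜ (λ _ → ≡.refl) (λ _ → ≡.refl) ⟩
  1ᶜ                    ∎
  where open SetoidReasoning ℂ′.setoid

1^≈1 : ∀ n → 1ᶜ ℂ′.^ n ≃ᶜ 1ᶜ
1^≈1 ℕ.zero    = ≃ᶜ-refl
1^≈1 (ℕ.suc n) = ≃ᶜ-trans (ℂ′.*-identityˡ (1ᶜ ℂ′.^ n)) (1^≈1 n)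

z^-mod8 : ∀ n → z ℂ′.^ n ≃ᶜ z ℂ′.^ (n % 8)
z^-mod8 n = begin
  z ℂ′.^ n                                   ≡⟨ ≡.cong (z ℂ′.^_) (m≡m%n+[m/n]*n n 8) ⟩
  z ℂ′.^ (n % 8 ℕ.+ n / 8 ℕ.* 8)             ≈⟨ ℂ′.^-homo-* z (n % 8) (n / 8 ℕ.* 8) ⟩
  z ℂ′.^ (n % 8) *ᶜ z ℂ′.^ (n / 8 ℕ.* 8)     ≈⟨ ℂ′.*-congˡ {z ℂ′.^ (n % 8)} (begin
                                                  z ℂ′.^ (n / 8 ℕ.* 8)     ≡⟨ ≡.cong (z ℂ′.^_) (ℕ.*-comm (n / 8) 8) ⟩
                                                  z ℂ′.^ (8 ℕ.* (n / 8))   ≈⟨ ℂ′.^-assocʳ z 8 (n / 8) ⟨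
                                                  (z ℂ′.^ 8) ℂ′.^ (n / 8)  ≈⟨ ℂ′.^-congˡ (n / 8) z^8≈1 ⟩
                                                  1ᶜ ℂ′.^ (n / 8)          ≈⟨ 1^≈1 (n / 8) ⟩
                                                  1ᶜ                       ∎) ⟩
  z ℂ′.^ (n % 8) *ᶜ 1ᶜ                       ≈⟨ ℂ′.*-identityʳ (z ℂ′.^ (n % 8)) ⟩
  z ℂ′.^ (n % 8)                             ∎
  where open SetoidReasoning ℂ′.setoid

ξ : ℂ
ξ = (z ℂ′.^ 3 +ᶜ z) *ᶜ ℚ⇒ℂ (1ℤ ℚ./ 4)

-- z³ + z = z (i + 1), whose square is i · 2i = −2.
ξ^8*4096≈1 : ξ ℂ′.^ 8 *ᶜ ℤ⇒ℂ (+ 4096) ≃ᶜ 1ᶜ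
ξ^8*4096≈1 = begin
  ξ ℂ′.^ 8 *ᶜ ℤ⇒ℂ (+ 4096)                       ≈⟨ ℂ′.*-congʳ {ℤ⇒ℂ (+ 4096)} (ℂ′.^-assocʳ ξ 2 4) ⟨
  (ξ ℂ′.^ 2) ℂ′.^ 4 *ᶜ ℤ⇒ℂ (+ 4096)              ≈⟨ ℂ′.*-congʳ {ℤ⇒ℂ (+ 4096)} (ℂ′.^-congˡ 4 ξ²) ⟩
  ℚ⇒ℂ (-1ℤ ℚ./ 8) ℂ′.^ 4 *ᶜ ℤ⇒ℂ (+ 4096)         ≈⟨ ≗⇒≃ᶜ (ℚ⇒ℂ (-1ℤ ℚ./ 8) ℂ′.^ 4 *ᶜ ℤ⇒ℂ (+ 4096)) 1ᶜ (λ _ → ≡.refl) (λ _ → ≡.refl) ⟩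
  1ᶜ                                             ∎
  where
  open SetoidReasoning ℂ′.setoid
  q = ℚ⇒ℂ (1ℤ ℚ./ 4)
  t = (iᶜ +ᶜ 1ᶜ) *ᶜ q
  ξ≈zt : ξ ≃ᶜ z *ᶜ t
  ξ≈zt = begin
    (z ℂ′.^ 3 +ᶜ z) *ᶜ q             ≈⟨ ℂ′.*-congʳ {q} (ℂ′.+-cong {z ℂ′.^ 3} {z *ᶜ iᶜ} {z} {z *ᶜ 1ᶜ}
                                          (ℂ′.*-congˡ {z} (≃ᶜ-trans (ℂ′.*-congˡ {z} (ℂ′.*-identityʳ z)) z*z≈iᶜ)) (≃ᶜ-sym (ℂ′.*-identityʳ z))) ⟩
    (z *ᶜ iᶜ +ᶜ z *ᶜ 1ᶜ) *ᶜ q         ≈⟨ ℂ′.*-congʳ {q} (ℂ′.distribˡ z iᶜ 1ᶜ) ⟨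
    z *ᶜ (iᶜ +ᶜ 1ᶜ) *ᶜ q              ≈⟨ ℂ′.*-assoc z (iᶜ +ᶜ 1ᶜ) q ⟩
    z *ᶜ t                           ∎
  ξ² : ξ ℂ′.^ 2 ≃ᶜ ℚ⇒ℂ (-1ℤ ℚ./ 8)
  ξ² = begin
    ξ ℂ′.^ 2                  ≈⟨ ℂ′.^-congˡ 2 ξ≈zt ⟩
    (z *ᶜ t) ℂ′.^ 2           ≈⟨ ℂ′.*-congˡ {z *ᶜ t} (ℂ′.*-identityʳ (z *ᶜ t)) ⟩
    z *ᶜ t *ᶜ (z *ᶜ t)        ≈⟨ ℂ′.*-interchange z t z t ⟩
    z *ᶜ z *ᶜ (t *ᶜ t)        ≈⟨ ℂ′.*-congʳ {t *ᶜ t} z*z≈iᶜ ⟩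
    iᶜ *ᶜ (t *ᶜ t)             ≈⟨ ≗⇒≃ᶜ (iᶜ *ᶜ (t *ᶜ t)) (ℚ⇒ℂ (-1ℤ ℚ./ 8)) (λ _ → ≡.refl) (λ _ → ≡.refl) ⟩
    ℚ⇒ℂ (-1ℤ ℚ./ 8)           ∎

-- Invariance under H

entries : Vec (Vec ℤ 6) 6 → Fin 6 → Fin 6 → ℤ
entries rows i j = lookup (lookup rows i) j

rowsX rowsP₁ rowsP₂ rowsF rowsG : Vec (Vec ℤ 6) 6

rowsX =
    (1ℤ ∷  2ℤ ∷  1ℤ ∷  1ℤ ∷  2ℤ ∷  1ℤ ∷ [])
  ∷ (1ℤ ∷  0ℤ ∷ -1ℤ ∷  1ℤ ∷  0ℤ ∷ -1ℤ ∷ [])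
  ∷ (1ℤ ∷ -2ℤ ∷  1ℤ ∷  1ℤ ∷ -2ℤ ∷  1ℤ ∷ [])
  ∷ (1ℤ ∷  2ℤ ∷  1ℤ ∷ -1ℤ ∷ -2ℤ ∷ -1ℤ ∷ [])
  ∷ (1ℤ ∷  0ℤ ∷ -1ℤ ∷ -1ℤ ∷  0ℤ ∷  1ℤ ∷ [])
  ∷ (1ℤ ∷ -2ℤ ∷  1ℤ ∷ -1ℤ ∷  2ℤ ∷ -1ℤ ∷ [])
  ∷ []

rowsP₁ =
    (1ℤ ∷ 0ℤ ∷ 0ℤ ∷ 0ℤ ∷ 0ℤ ∷ 0ℤ ∷ [])
  ∷ (0ℤ ∷ 0ℤ ∷ 0ℤ ∷ 0ℤ ∷ 1ℤ ∷ 0ℤ ∷ [])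
  ∷ (0ℤ ∷ 0ℤ ∷ 1ℤ ∷ 0ℤ ∷ 0ℤ ∷ 0ℤ ∷ [])
  ∷ (0ℤ ∷ 0ℤ ∷ 0ℤ ∷ 1ℤ ∷ 0ℤ ∷ 0ℤ ∷ [])
  ∷ (0ℤ ∷ 1ℤ ∷ 0ℤ ∷ 0ℤ ∷ 0ℤ ∷ 0ℤ ∷ [])
  ∷ (0ℤ ∷ 0ℤ ∷ 0ℤ ∷ 0ℤ ∷ 0ℤ ∷ 1ℤ ∷ [])
  ∷ []

rowsP₂ =
    (1ℤ ∷ 0ℤ ∷ 0ℤ ∷ 0ℤ ∷ 0ℤ ∷ 0ℤ ∷ [])
  ∷ (0ℤ ∷ 0ℤ ∷ 0ℤ ∷ 0ℤ ∷ 1ℤ ∷ 0ℤ ∷ [])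
  ∷ (0ℤ ∷ 0ℤ ∷ 1ℤ ∷ 0ℤ ∷ 0ℤ ∷ 0ℤ ∷ [])
  ∷ (0ℤ ∷ 0ℤ ∷ 0ℤ ∷ 0ℤ ∷ 0ℤ ∷ 1ℤ ∷ [])
  ∷ (0ℤ ∷ 1ℤ ∷ 0ℤ ∷ 0ℤ ∷ 0ℤ ∷ 0ℤ ∷ [])
  ∷ (0ℤ ∷ 0ℤ ∷ 0ℤ ∷ 1ℤ ∷ 0ℤ ∷ 0ℤ ∷ [])
  ∷ []

-- rowsX is the product of rowsF and rowsG, the MacWilliams transforms of the
-- binary and of the quaternary coordinate.
rowsF =
    (1ℤ ∷ 0ℤ ∷ 0ℤ ∷  1ℤ ∷  0ℤ ∷  0ℤ ∷ [])
  ∷ (0ℤ ∷ 1ℤ ∷ 0ℤ ∷  0ℤ ∷  1ℤ ∷  0ℤ ∷ [])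
  ∷ (0ℤ ∷ 0ℤ ∷ 1ℤ ∷  0ℤ ∷  0ℤ ∷  1ℤ ∷ [])
  ∷ (1ℤ ∷ 0ℤ ∷ 0ℤ ∷ -1ℤ ∷  0ℤ ∷  0ℤ ∷ [])
  ∷ (0ℤ ∷ 1ℤ ∷ 0ℤ ∷  0ℤ ∷ -1ℤ ∷  0ℤ ∷ [])
  ∷ (0ℤ ∷ 0ℤ ∷ 1ℤ ∷  0ℤ ∷  0ℤ ∷ -1ℤ ∷ [])
  ∷ []

rowsG =
    (1ℤ ∷  2ℤ ∷  1ℤ ∷ 0ℤ ∷  0ℤ ∷  0ℤ ∷ [])
  ∷ (1ℤ ∷  0ℤ ∷ -1ℤ ∷ 0ℤ ∷  0ℤ ∷  0ℤ ∷ [])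
  ∷ (1ℤ ∷ -2ℤ ∷  1ℤ ∷ 0ℤ ∷  0ℤ ∷  0ℤ ∷ [])
  ∷ (0ℤ ∷  0ℤ ∷  0ℤ ∷ 1ℤ ∷  2ℤ ∷  1ℤ ∷ [])
  ∷ (0ℤ ∷  0ℤ ∷  0ℤ ∷ 1ℤ ∷  0ℤ ∷ -1ℤ ∷ [])
  ∷ (0ℤ ∷  0ℤ ∷  0ℤ ∷ 1ℤ ∷ -2ℤ ∷  1ℤ ∷ [])
  ∷ []

-- The exponents of z in E₁ and E₂.
k₁ k₂ : Vec ℕ 6
k₁ = 0 ∷ 1 ∷ 4 ∷ 2 ∷ 7 ∷ 6 ∷ []
k₂ = 0 ∷ 1 ∷ 4 ∷ 0 ∷ 1 ∷ 4 ∷ []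

-- At the class of (u, v) the entry of `k₁` is 2u² + v² + 4uv modulo 8, and that of `k₂` is v²
-- modulo 8. Divisibility of the weights by 8 thus says that these quadratic forms vanish modulo 8
-- on the pairs of codewords.
weight : Vec ℕ 6 → Exponents → ℕ
weight k α = Vec.sum (zipWith ℕ._*_ k α)

diagonal₁ diagonal₂ : Fin 6 → ℂ
diagonal₁ = lookup (1ᶜ ∷ z ∷ -ᶜ 1ᶜ ∷ z ℂ′.^ 2 ∷ -ᶜ (z ℂ′.^ 3) ∷ -ᶜ (z ℂ′.^ 2) ∷ [])
diagonal₂ = lookup (1ᶜ ∷ z ∷ -ᶜ 1ᶜ ∷ 1ᶜ ∷ z ∷ -ᶜ 1ᶜ ∷ [])

z^[4+n]≈-z^n : ∀ n → -ᶜ (z ℂ′.^ n) ≃ᶜ z ℂ′.^ (4 ℕ.+ n)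
z^[4+n]≈-z^n n = begin
  -ᶜ (z ℂ′.^ n)               ≈⟨ -1*x≈-x (z ℂ′.^ n) ⟨
  -1ᶜ *ᶜ z ℂ′.^ n             ≈⟨ ℂ′.*-congʳ {z ℂ′.^ n} z^4≈-1 ⟨
  z ℂ′.^ 4 *ᶜ z ℂ′.^ n        ≈⟨ ℂ′.^-homo-* z 4 n ⟨
  z ℂ′.^ (4 ℕ.+ n)            ∎
  where open SetoidReasoning ℂ′.setoid

diagonal₁≈ : ∀ i → diagonal₁ i ≃ᶜ z ℂ′.^ lookup k₁ i
diagonal₁≈ 0F = ≃ᶜ-refl
diagonal₁≈ 1F = ≃ᶜ-sym (ℂ′.*-identityʳ z)
diagonal₁≈ 2F = ≃ᶜ-sym z^4≈-1
diagonal₁≈ 3F = ≃ᶜ-refl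
diagonal₁≈ 4F = z^[4+n]≈-z^n 3
diagonal₁≈ 5F = z^[4+n]≈-z^n 2

diagonal₂≈ : ∀ i → diagonal₂ i ≃ᶜ z ℂ′.^ lookup k₂ i
diagonal₂≈ 0F = ≃ᶜ-refl
diagonal₂≈ 1F = ≃ᶜ-sym (ℂ′.*-identityʳ z)
diagonal₂≈ 2F = ≃ᶜ-sym z^4≈-1
diagonal₂≈ 3F = ≃ᶜ-refl
diagonal₂≈ 4F = ≃ᶜ-sym (ℂ′.*-identityʳ z)
diagonal₂≈ 5F = ≃ᶜ-sym z^4≈-1

power-diagonal : ∀ d k → (∀ i → d i ≃ᶜ z ℂ′.^ lookup k i) → ∀ α → ℂ′.power d α ≃ᶜ z ℂ′.^ (weight k α % 8)
power-diagonal d k d≈ α = ≃ᶜ-trans (ℂ′.power-cong {p = d} {q = λ i → z ℂ′.^ lookup k i} d≈ α)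
  (≃ᶜ-trans (ℂ′.power-^ z k α) (z^-mod8 (weight k α)))

rescale-1 : ∀ w f → All (λ (_ , α) → w α ≃ᶜ 1ᶜ) f → rescale w f ≈ₚ f
rescale-1 w []            []           = Polyℂ.refl {[]}
rescale-1 w ((a , α) ∷ f) (w≈1 ∷ rest) = +ₚ-cong {(w α *ᶜ a , α) ∷ []} {(a , α) ∷ []} {rescale w f} {f}
  (≈ₚ-intro ((w α *ᶜ a , α) ∷ []) ((a , α) ∷ []) λ φ →
    ℂ′.+-congʳ {0ᶜ} (ℂ′.*-congʳ {φ α} (≃ᶜ-trans (ℂ′.*-congʳ {a} w≈1) (ℂ′.*-identityˡ a))))
  (rescale-1 w f rest)

-- All monomials that occur have eigenvalue z to a multiple of 8, which is 1.
diagonal-fixes-embed : ∀ d k → (∀ i → d i ≃ᶜ z ℂ′.^ lookup k i) → ∀ f →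
  All (λ (_ , α) → weight k α % 8 ≡ 0) f → diagonal d · embed f ≈ₚ embed f
diagonal-fixes-embed d k d≈ f 8∣weights = Polyℂ.trans {diagonal d · embed f} {rescale (ℂ′.power d) (embed f)} {embed f}
  (diagonal-· d (embed f)) (rescale-1 (ℂ′.power d) (embed f) (weights f 8∣weights))
  where
  weights : ∀ f → All (λ (_ , α) → weight k α % 8 ≡ 0) f → All (λ (_ , α) → ℂ′.power d α ≃ᶜ 1ᶜ) (embed f)
  weights []            []               = []
  weights ((_ , α) ∷ f) (8∣weight ∷ rest) = ≃ᶜ-trans (power-diagonal d k d≈ α)
    (≃ᶜ-trans (ℂ′.reflexive (≡.cong (z ℂ′.^_) 8∣weight)) ≃ᶜ-refl) ∷ weights f rest

-- Integer conditions for invariance in degree 8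

record Certified (w : ℤₚ.Poly 6) : Set where
  field
    homogeneous : All (λ (_ , α) → Vec.sum α ≡ 8) w
    under-F     : equalᴺ 6 (substitute 6 (forms (entries rowsF)) w) (nested 6 (ℤₚ._∙ₚ_ 6 (+ 16) w)) ≡ true
    under-G     : equalᴺ 6 (substitute 6 (forms (entries rowsG)) w) (nested 6 (ℤₚ._∙ₚ_ 6 (+ 256) w)) ≡ true
    under-P₁    : equalᴺ 6 (substitute 6 (forms (entries rowsP₁)) w) (nested 6 (ℤₚ._∙ₚ_ 6 1ℤ w)) ≡ true
    under-P₂    : equalᴺ 6 (substitute 6 (forms (entries rowsP₂)) w) (nested 6 (ℤₚ._∙ₚ_ 6 1ℤ w)) ≡ true
    under-E₁    : All (λ (_ , α) → weight k₁ α % 8 ≡ 0) w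
    under-E₂    : All (λ (_ , α) → weight k₂ α % 8 ≡ 0) w
    under-z     : All (λ (_ , α) → weight (Vec.replicate 6 1) α % 8 ≡ 0) w

-- The matrix identity X′ = F G, tested on linear forms: substituting the rows of G into those of F
-- gives the rows of X′.
rowsX-forms : ∀ i ρ → evaluateℤ (λ j → evaluateℤ ρ (forms (entries rowsG) j)) (forms (entries rowsF) i) ≈ₚ evaluateℤ ρ (forms (entries rowsX) i)
rowsX-forms 0F = substitute-equal⇒evaluateℤ (forms (entries rowsG)) (forms (entries rowsF) 0F) (forms (entries rowsX) 0F) ≡.refl
rowsX-forms 1F = substitute-equal⇒evaluateℤ (forms (entries rowsG)) (forms (entries rowsF) 1F) (forms (entries rowsX) 1F) ≡.refl
rowsX-forms 2F = substitute-equal⇒evaluateℤ (forms (entries rowsG)) (forms (entries rowsF) 2F) (forms (entries rowsX) 2F) ≡.refl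
rowsX-forms 3F = substitute-equal⇒evaluateℤ (forms (entries rowsG)) (forms (entries rowsF) 3F) (forms (entries rowsX) 3F) ≡.refl
rowsX-forms 4F = substitute-equal⇒evaluateℤ (forms (entries rowsG)) (forms (entries rowsF) 4F) (forms (entries rowsX) 4F) ≡.refl
rowsX-forms 5F = substitute-equal⇒evaluateℤ (forms (entries rowsG)) (forms (entries rowsF) 5F) (forms (entries rowsX) 5F) ≡.refl

module _ {w : ℤₚ.Poly 6} (certified : Certified w) where
  open Certified certified

  certified-fixed : ∀ A → H A → A · embed w ≈ₚ embed w
  certified-fixed = ·-fixes (embed w) λ
    { 0F → scaled-fixes-embed ξ (entries rowsX) (+ 16 ℤ.* + 256) homogeneous
             (compose-forms (forms (entries rowsF)) (forms (entries rowsG)) (forms (entries rowsX)) w (+ 16) (+ 256) rowsX-forms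
               (substitute-equal⇒evaluateℤ (forms (entries rowsF)) w (ℤₚ._∙ₚ_ 6 (+ 16) w) under-F)
               (substitute-equal⇒evaluateℤ (forms (entries rowsG)) w (ℤₚ._∙ₚ_ 6 (+ 256) w) under-G) var) ξ^8*4096≈1
    ; 1F → scaled-fixes-embed 1ᶜ (entries rowsP₁) 1ℤ homogeneous
             (substitute-equal⇒evaluateℤ (forms (entries rowsP₁)) w (ℤₚ._∙ₚ_ 6 1ℤ w) under-P₁ var)
             (≃ᶜ-trans (ℂ′.*-identityʳ (1ᶜ ℂ′.^ 8)) (1^≈1 8))
    -- The scalar z² disappears in degree 8, because its eighth power is z to the 16, which is 1.
    ; 2F → scaled-fixes-embed (z ℂ′.^ 2) (entries rowsP₂) 1ℤ homogeneous
             (substitute-equal⇒evaluateℤ (forms (entries rowsP₂)) w (ℤₚ._∙ₚ_ 6 1ℤ w) under-P₂ var)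
             (≃ᶜ-trans (ℂ′.*-identityʳ ((z ℂ′.^ 2) ℂ′.^ 8)) (≃ᶜ-trans (ℂ′.^-assocʳ z 2 8) (z^-mod8 16)))
    ; 3F → diagonal-fixes-embed diagonal₁ k₁ diagonal₁≈ w under-E₁
    ; 4F → diagonal-fixes-embed diagonal₂ k₂ diagonal₂≈ w under-E₂
    -- A scalar matrix is treated as a diagonal one with all exponents 1, for which the weight is
    -- the degree.
    ; 5F → diagonal-fixes-embed (λ _ → z) (Vec.replicate 6 1)
             (λ i → ≃ᶜ-trans (≃ᶜ-sym (ℂ′.*-identityʳ z)) (ℂ′.reflexive (≡.cong (z ℂ′.^_) (≡.sym (Vec.lookup-replicate i 1)))))
             w under-z
    }

-- The weight enumerators

codewordTerm : Word 2 8 × Word 4 8 → Poly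
codewordTerm (u , v) = ∏ₚ λ i → var i ^ₚ multiplicity i u v

codewordTerms : List (Word 2 8 × Word 4 8) → ℤₚ.Poly 6
codewordTerms = map λ (u , v) → 1ℤ , tabulate λ i → multiplicity i u v

concatMap-↭ : ∀ {ps qs} → ps ↭ qs → concatMap codewordTerm ps ≈ₚ concatMap codewordTerm qs
concatMap-↭ {ps} ↭.refl = Polyℂ.refl {concatMap codewordTerm ps}
concatMap-↭ (↭.prep {xs} {ys} p ps↭qs) =
  +ₚ-cong {codewordTerm p} {codewordTerm p} {concatMap codewordTerm xs} {concatMap codewordTerm ys}
    (Polyℂ.refl {codewordTerm p}) (concatMap-↭ ps↭qs)
concatMap-↭ (↭.swap {xs} {ys} p q ps↭qs) = begin
  codewordTerm p +ₚ (codewordTerm q +ₚ concatMap codewordTerm xs)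
    ≈⟨ Polyℂ.+-assoc (codewordTerm p) (codewordTerm q) (concatMap codewordTerm xs) ⟨
  codewordTerm p +ₚ codewordTerm q +ₚ concatMap codewordTerm xs
    ≈⟨ +ₚ-cong {codewordTerm p +ₚ codewordTerm q} {codewordTerm q +ₚ codewordTerm p} {concatMap codewordTerm xs} {concatMap codewordTerm ys}
         (+ₚ-comm (codewordTerm p) (codewordTerm q)) (concatMap-↭ ps↭qs) ⟩
  codewordTerm q +ₚ codewordTerm p +ₚ concatMap codewordTerm ys
    ≈⟨ Polyℂ.+-assoc (codewordTerm q) (codewordTerm p) (concatMap codewordTerm ys) ⟩
  codewordTerm q +ₚ (codewordTerm p +ₚ concatMap codewordTerm ys)   ∎
  where open SetoidReasoning Polyℂ.setoid
concatMap-↭ {ps} {qs} (↭.trans {ys = rs} ps↭rs rs↭qs) =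
  Polyℂ.trans {concatMap codewordTerm ps} {concatMap codewordTerm rs} {concatMap codewordTerm qs} (concatMap-↭ ps↭rs) (concatMap-↭ rs↭qs)

evaluateℤ-codewordTerms : ∀ ps → evaluateℤ var (codewordTerms ps) ≈ₚ concatMap codewordTerm ps
evaluateℤ-codewordTerms []             = Polyℂ.refl {[]}
evaluateℤ-codewordTerms (p@(u , v) ∷ ps) =
  +ₚ-cong {1ₚ *ₚ Polyℂ.power var α} {codewordTerm p} {evaluateℤ var (codewordTerms ps)} {concatMap codewordTerm ps}
    (begin
      1ₚ *ₚ Polyℂ.power var α   ≈⟨ *ₚ-identityˡ (Polyℂ.power var α) ⟩
      Polyℂ.power var α         ≈⟨ Polyℂ.product-cong {x = λ i → var i ^ₚ lookup α i} {y = λ i → var i ^ₚ multiplicity i u v}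
                                     (λ i → Polyℂ.reflexive (≡.cong (var i ^ₚ_) (Vec.lookup∘tabulate (λ i → multiplicity i u v) i))) ⟩
      codewordTerm p            ∎)
    (evaluateℤ-codewordTerms ps)
  where
  open SetoidReasoning Polyℂ.setoid
  α = tabulate λ i → multiplicity i u v

-- The sum over the filtered lists is exchanged for the sum over the spans, and only the latter is
-- evaluated, with integer coefficients.
weightEnumerator≈embed : ∀ {j k} (C : LinearCode 2 8) (C′ : LinearCode 4 8) (G : Vec (Word 2 8) j) (G′ : Vec (Word 4 8) k) w →
  _GeneratedBy_ 2 C G → _GeneratedBy_ 4 C′ G′ →
  equalᴺ 6 (nested 6 (codewordTerms (cartesianProduct (span 2 G) (span 4 G′)))) (nested 6 w) ≡ true →
  weightEnumerator C C′ ≈ₚ embed w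
weightEnumerator≈embed C C′ G G′ w C⇔G C′⇔G′ equal = begin
  weightEnumerator C C′
    ≈⟨ concatMap-↭ (codeword-pairs↭span-pairs C C′ G G′ C⇔G C′⇔G′) ⟩
  concatMap codewordTerm pairs
    ≈⟨ evaluateℤ-codewordTerms pairs ⟨
  evaluateℤ var (codewordTerms pairs)
    ≈⟨ nested-equal⇒evaluateℤ (codewordTerms pairs) w equal var ⟩
  evaluateℤ var w
    ≈⟨ evaluateℤ-var w ⟩
  embed w   ∎
  where
  open SetoidReasoning Polyℂ.setoid
  pairs = cartesianProduct (span 2 G) (span 4 G′)

decided : ∀ {a} {A : Set a} (A? : Dec A) → ⌊ A? ⌋ ≡ true → A
decided A? eq = toWitness {a? = A?} (Equivalence.from T-≡ eq)

generatorℰ₈ : Vec (Word 2 8) 4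
generatorℰ₈ =
    (1F ∷ 1F ∷ 1F ∷ 1F ∷ 0F ∷ 0F ∷ 0F ∷ 0F ∷ [])
  ∷ (0F ∷ 0F ∷ 1F ∷ 1F ∷ 1F ∷ 1F ∷ 0F ∷ 0F ∷ [])
  ∷ (0F ∷ 0F ∷ 0F ∷ 0F ∷ 1F ∷ 1F ∷ 1F ∷ 1F ∷ [])
  ∷ (1F ∷ 0F ∷ 1F ∷ 0F ∷ 1F ∷ 0F ∷ 1F ∷ 0F ∷ [])
  ∷ []

generator𝒬₈ : Vec (Word 4 8) 5
generator𝒬₈ =
    (0F ∷ 0F ∷ 1F ∷ 1F ∷ 0F ∷ 2F ∷ 1F ∷ 3F ∷ [])
  ∷ (0F ∷ 0F ∷ 0F ∷ 2F ∷ 1F ∷ 3F ∷ 1F ∷ 1F ∷ [])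
  ∷ (1F ∷ 1F ∷ 0F ∷ 2F ∷ 0F ∷ 0F ∷ 1F ∷ 3F ∷ [])
  ∷ (0F ∷ 2F ∷ 0F ∷ 2F ∷ 0F ∷ 2F ∷ 0F ∷ 2F ∷ [])
  ∷ (0F ∷ 0F ∷ 0F ∷ 0F ∷ 0F ∷ 0F ∷ 2F ∷ 2F ∷ [])
  ∷ []

generator𝒦₈ : Vec (Word 4 8) 7
generator𝒦₈ =
    (1F ∷ 1F ∷ 1F ∷ 1F ∷ 1F ∷ 1F ∷ 1F ∷ 1F ∷ [])
  ∷ (0F ∷ 2F ∷ 0F ∷ 0F ∷ 0F ∷ 0F ∷ 0F ∷ 2F ∷ [])
  ∷ (0F ∷ 0F ∷ 2F ∷ 0F ∷ 0F ∷ 0F ∷ 0F ∷ 2F ∷ [])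
  ∷ (0F ∷ 0F ∷ 0F ∷ 2F ∷ 0F ∷ 0F ∷ 0F ∷ 2F ∷ [])
  ∷ (0F ∷ 0F ∷ 0F ∷ 0F ∷ 2F ∷ 0F ∷ 0F ∷ 2F ∷ [])
  ∷ (0F ∷ 0F ∷ 0F ∷ 0F ∷ 0F ∷ 2F ∷ 0F ∷ 2F ∷ [])
  ∷ (0F ∷ 0F ∷ 0F ∷ 0F ∷ 0F ∷ 0F ∷ 2F ∷ 2F ∷ [])
  ∷ []

-- The two weight enumerators in expanded form

w₁ : ℤₚ.Poly 6
w₁ =
  ( (1ℤ , 8 ∷ 0 ∷ 0 ∷ 0 ∷ 0 ∷ 0 ∷ [])
  ∷ (+ 4 , 6 ∷ 0 ∷ 2 ∷ 0 ∷ 0 ∷ 0 ∷ [])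
  ∷ (+ 22 , 4 ∷ 0 ∷ 4 ∷ 0 ∷ 0 ∷ 0 ∷ [])
  ∷ (+ 14 , 4 ∷ 0 ∷ 0 ∷ 4 ∷ 0 ∷ 0 ∷ [])
  ∷ (+ 12 , 4 ∷ 0 ∷ 0 ∷ 2 ∷ 0 ∷ 2 ∷ [])
  ∷ (+ 14 , 4 ∷ 0 ∷ 0 ∷ 0 ∷ 0 ∷ 4 ∷ [])
  ∷ (+ 96 , 3 ∷ 4 ∷ 1 ∷ 0 ∷ 0 ∷ 0 ∷ [])
  ∷ (+ 32 , 3 ∷ 0 ∷ 1 ∷ 3 ∷ 0 ∷ 1 ∷ [])
  ∷ (+ 32 , 3 ∷ 0 ∷ 1 ∷ 1 ∷ 0 ∷ 3 ∷ [])
  ∷ (+ 96 , 3 ∷ 0 ∷ 1 ∷ 0 ∷ 4 ∷ 0 ∷ [])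
  ∷ (+ 576 , 2 ∷ 2 ∷ 0 ∷ 1 ∷ 2 ∷ 1 ∷ [])
  ∷ (+ 4 , 2 ∷ 0 ∷ 6 ∷ 0 ∷ 0 ∷ 0 ∷ [])
  ∷ (+ 12 , 2 ∷ 0 ∷ 2 ∷ 4 ∷ 0 ∷ 0 ∷ [])
  ∷ (+ 216 , 2 ∷ 0 ∷ 2 ∷ 2 ∷ 0 ∷ 2 ∷ [])
  ∷ (+ 12 , 2 ∷ 0 ∷ 2 ∷ 0 ∷ 0 ∷ 4 ∷ [])
  ∷ (+ 96 , 1 ∷ 4 ∷ 3 ∷ 0 ∷ 0 ∷ 0 ∷ [])
  ∷ (+ 576 , 1 ∷ 2 ∷ 1 ∷ 2 ∷ 2 ∷ 0 ∷ [])
  ∷ (+ 576 , 1 ∷ 2 ∷ 1 ∷ 0 ∷ 2 ∷ 2 ∷ [])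
  ∷ (+ 32 , 1 ∷ 0 ∷ 3 ∷ 3 ∷ 0 ∷ 1 ∷ [])
  ∷ (+ 32 , 1 ∷ 0 ∷ 3 ∷ 1 ∷ 0 ∷ 3 ∷ [])
  ∷ (+ 96 , 1 ∷ 0 ∷ 3 ∷ 0 ∷ 4 ∷ 0 ∷ [])
  ∷ (+ 32 , 0 ∷ 8 ∷ 0 ∷ 0 ∷ 0 ∷ 0 ∷ [])
  ∷ (+ 96 , 0 ∷ 4 ∷ 0 ∷ 3 ∷ 0 ∷ 1 ∷ [])
  ∷ (+ 96 , 0 ∷ 4 ∷ 0 ∷ 1 ∷ 0 ∷ 3 ∷ [])
  ∷ (+ 448 , 0 ∷ 4 ∷ 0 ∷ 0 ∷ 4 ∷ 0 ∷ [])
  ∷ (+ 576 , 0 ∷ 2 ∷ 2 ∷ 1 ∷ 2 ∷ 1 ∷ [])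
  ∷ (1ℤ , 0 ∷ 0 ∷ 8 ∷ 0 ∷ 0 ∷ 0 ∷ [])
  ∷ (+ 14 , 0 ∷ 0 ∷ 4 ∷ 4 ∷ 0 ∷ 0 ∷ [])
  ∷ (+ 12 , 0 ∷ 0 ∷ 4 ∷ 2 ∷ 0 ∷ 2 ∷ [])
  ∷ (+ 14 , 0 ∷ 0 ∷ 4 ∷ 0 ∷ 0 ∷ 4 ∷ [])
  ∷ (1ℤ , 0 ∷ 0 ∷ 0 ∷ 8 ∷ 0 ∷ 0 ∷ [])
  ∷ (+ 4 , 0 ∷ 0 ∷ 0 ∷ 6 ∷ 0 ∷ 2 ∷ [])
  ∷ (+ 22 , 0 ∷ 0 ∷ 0 ∷ 4 ∷ 0 ∷ 4 ∷ [])
  ∷ (+ 96 , 0 ∷ 0 ∷ 0 ∷ 3 ∷ 4 ∷ 1 ∷ [])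
  ∷ (+ 4 , 0 ∷ 0 ∷ 0 ∷ 2 ∷ 0 ∷ 6 ∷ [])
  ∷ (+ 96 , 0 ∷ 0 ∷ 0 ∷ 1 ∷ 4 ∷ 3 ∷ [])
  ∷ (+ 32 , 0 ∷ 0 ∷ 0 ∷ 0 ∷ 8 ∷ 0 ∷ [])
  ∷ (1ℤ , 0 ∷ 0 ∷ 0 ∷ 0 ∷ 0 ∷ 8 ∷ [])
  ∷ [])

w₂ : ℤₚ.Poly 6
w₂ =
  ( (1ℤ , 8 ∷ 0 ∷ 0 ∷ 0 ∷ 0 ∷ 0 ∷ [])
  ∷ (+ 28 , 6 ∷ 0 ∷ 2 ∷ 0 ∷ 0 ∷ 0 ∷ [])
  ∷ (+ 70 , 4 ∷ 0 ∷ 4 ∷ 0 ∷ 0 ∷ 0 ∷ [])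
  ∷ (+ 14 , 4 ∷ 0 ∷ 0 ∷ 4 ∷ 0 ∷ 0 ∷ [])
  ∷ (+ 84 , 4 ∷ 0 ∷ 0 ∷ 2 ∷ 0 ∷ 2 ∷ [])
  ∷ (+ 14 , 4 ∷ 0 ∷ 0 ∷ 0 ∷ 0 ∷ 4 ∷ [])
  ∷ (+ 224 , 3 ∷ 0 ∷ 1 ∷ 3 ∷ 0 ∷ 1 ∷ [])
  ∷ (+ 224 , 3 ∷ 0 ∷ 1 ∷ 1 ∷ 0 ∷ 3 ∷ [])
  ∷ (+ 28 , 2 ∷ 0 ∷ 6 ∷ 0 ∷ 0 ∷ 0 ∷ [])
  ∷ (+ 84 , 2 ∷ 0 ∷ 2 ∷ 4 ∷ 0 ∷ 0 ∷ [])
  ∷ (+ 504 , 2 ∷ 0 ∷ 2 ∷ 2 ∷ 0 ∷ 2 ∷ [])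
  ∷ (+ 84 , 2 ∷ 0 ∷ 2 ∷ 0 ∷ 0 ∷ 4 ∷ [])
  ∷ (+ 224 , 1 ∷ 0 ∷ 3 ∷ 3 ∷ 0 ∷ 1 ∷ [])
  ∷ (+ 224 , 1 ∷ 0 ∷ 3 ∷ 1 ∷ 0 ∷ 3 ∷ [])
  ∷ (+ 128 , 0 ∷ 8 ∷ 0 ∷ 0 ∷ 0 ∷ 0 ∷ [])
  ∷ (+ 1792 , 0 ∷ 4 ∷ 0 ∷ 0 ∷ 4 ∷ 0 ∷ [])
  ∷ (1ℤ , 0 ∷ 0 ∷ 8 ∷ 0 ∷ 0 ∷ 0 ∷ [])
  ∷ (+ 14 , 0 ∷ 0 ∷ 4 ∷ 4 ∷ 0 ∷ 0 ∷ [])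
  ∷ (+ 84 , 0 ∷ 0 ∷ 4 ∷ 2 ∷ 0 ∷ 2 ∷ [])
  ∷ (+ 14 , 0 ∷ 0 ∷ 4 ∷ 0 ∷ 0 ∷ 4 ∷ [])
  ∷ (1ℤ , 0 ∷ 0 ∷ 0 ∷ 8 ∷ 0 ∷ 0 ∷ [])
  ∷ (+ 28 , 0 ∷ 0 ∷ 0 ∷ 6 ∷ 0 ∷ 2 ∷ [])
  ∷ (+ 70 , 0 ∷ 0 ∷ 0 ∷ 4 ∷ 0 ∷ 4 ∷ [])
  ∷ (+ 28 , 0 ∷ 0 ∷ 0 ∷ 2 ∷ 0 ∷ 6 ∷ [])
  ∷ (+ 128 , 0 ∷ 0 ∷ 0 ∷ 0 ∷ 8 ∷ 0 ∷ [])
  ∷ (1ℤ , 0 ∷ 0 ∷ 0 ∷ 0 ∷ 0 ∷ 8 ∷ [])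
  ∷ [])

-- An evaluation over 16 · 256 = 4096 pairs of words; accordingly the coefficients of `w₁` add up to
-- 4096.
enumeration𝒬₈ : equalᴺ 6 (nested 6 (codewordTerms (cartesianProduct (span 2 generatorℰ₈) (span 4 generator𝒬₈)))) (nested 6 w₁) ≡ true
enumeration𝒬₈ = ≡.refl

weightEnumerator𝒬₈ : weightEnumerator ℰ₈ 𝒬₈ ≈ₚ embed w₁
weightEnumerator𝒬₈ = weightEnumerator≈embed ℰ₈ 𝒬₈ generatorℰ₈ generator𝒬₈ w₁ (⇔-id _) (⇔-id _) enumeration𝒬₈

enumeration𝒦₈ : equalᴺ 6 (nested 6 (codewordTerms (cartesianProduct (span 2 generatorℰ₈) (span 4 generator𝒦₈)))) (nested 6 w₂) ≡ true
enumeration𝒦₈ = ≡.refl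

weightEnumerator𝒦₈ : weightEnumerator ℰ₈ 𝒦₈ ≈ₚ embed w₂
weightEnumerator𝒦₈ = weightEnumerator≈embed ℰ₈ 𝒦₈ generatorℰ₈ generator𝒦₈ w₂ (⇔-id _) (⇔-id _) enumeration𝒦₈

w₁-certified : Certified w₁
w₁-certified = record
  { homogeneous = decided (All.all? (λ (_ , α) → Vec.sum α ℕ.≟ 8) w₁) ≡.refl
  ; under-F = ≡.refl ; under-G = ≡.refl ; under-P₁ = ≡.refl ; under-P₂ = ≡.refl
  ; under-E₁ = decided (All.all? (λ (_ , α) → weight k₁ α % 8 ℕ.≟ 0) w₁) ≡.refl
  ; under-E₂ = decided (All.all? (λ (_ , α) → weight k₂ α % 8 ℕ.≟ 0) w₁) ≡.refl
  ; under-z  = decided (All.all? (λ (_ , α) → weight (Vec.replicate 6 1) α % 8 ℕ.≟ 0) w₁) ≡.refl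
  }

w₂-certified : Certified w₂
w₂-certified = record
  { homogeneous = decided (All.all? (λ (_ , α) → Vec.sum α ℕ.≟ 8) w₂) ≡.refl
  ; under-F = ≡.refl ; under-G = ≡.refl ; under-P₁ = ≡.refl ; under-P₂ = ≡.refl
  ; under-E₁ = decided (All.all? (λ (_ , α) → weight k₁ α % 8 ℕ.≟ 0) w₂) ≡.refl
  ; under-E₂ = decided (All.all? (λ (_ , α) → weight k₂ α % 8 ℕ.≟ 0) w₂) ≡.refl
  ; under-z  = decided (All.all? (λ (_ , α) → weight (Vec.replicate 6 1) α % 8 ℕ.≟ 0) w₂) ≡.refl
  }

i-j+j≡i : ∀ i j → i ℤ.- j ℤ.+ j ≡ i
i-j+j≡i i j = ≡.trans (ℤ.+-assoc i (ℤ.- j) j) (≡.trans (≡.cong (λ k → i ℤ.+ k) (ℤ.+-inverseˡ j)) (ℤ.+-identityʳ i))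

-- The space of invariants of degree 8

coefficient-+ₚ : ∀ f g α → coefficient (f +ₚ g) α ≃ᶜ coefficient f α +ᶜ coefficient g α
coefficient-+ₚ []            g α = ≃ᶜ-sym (ℂ′.+-identityˡ (coefficient g α))
coefficient-+ₚ ((a , β) ∷ f) g α = ≃ᶜ-trans
  (ℂ′.+-congˡ {if does (β ≟ₑ α) then a else 0ᶜ} (coefficient-+ₚ f g α))
  (≃ᶜ-sym (ℂ′.+-assoc (if does (β ≟ₑ α) then a else 0ᶜ) (coefficient f α) (coefficient g α)))

coefficient-∙ₚ : ∀ a f α → coefficient (a ∙ₚ f) α ≃ᶜ a *ᶜ coefficient f α
coefficient-∙ₚ a []            α = ≃ᶜ-sym (ℂ′.zeroʳ a)
coefficient-∙ₚ a ((b , β) ∷ f) α = ≃ᶜ-trans (ℂ′.+-cong {if does (β ≟ₑ α) then a *ᶜ b else 0ᶜ} term (coefficient-∙ₚ a f α))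
  (≃ᶜ-sym (ℂ′.distribˡ a (if does (β ≟ₑ α) then b else 0ᶜ) (coefficient f α)))
  where
  term : (if does (β ≟ₑ α) then a *ᶜ b else 0ᶜ) ≃ᶜ a *ᶜ (if does (β ≟ₑ α) then b else 0ᶜ)
  term with does (β ≟ₑ α)
  ... | true  = ≃ᶜ-refl
  ... | false = ≃ᶜ-sym (ℂ′.zeroʳ a)

-- Coefficients killed by E₁ and E₂

^-fixes : ∀ x y n → x *ᶜ y ≃ᶜ y → x ℂ′.^ n *ᶜ y ≃ᶜ y
^-fixes x y ℕ.zero    xy≈y = ℂ′.*-identityˡ y
^-fixes x y (ℕ.suc n) xy≈y = ≃ᶜ-trans (ℂ′.*-assoc x (x ℂ′.^ n) y) (≃ᶜ-trans (ℂ′.*-congˡ {x} (^-fixes x y n xy≈y)) xy≈y)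

-1-fixes⇒≈0 : ∀ y → -1ᶜ *ᶜ y ≃ᶜ y → y ≃ᶜ 0ᶜ
-1-fixes⇒≈0 y -y≈y = ℤ⇒ℂ-cancel (+ 2) (λ ()) y (begin
  ℤ⇒ℂ (+ 2) *ᶜ y               ≈⟨ ℂ′.*-congʳ {y} {ℤ⇒ℂ (+ 2)} {1ᶜ +ᶜ 1ᶜ} (≗⇒≃ᶜ (ℤ⇒ℂ (+ 2)) (1ᶜ +ᶜ 1ᶜ) (λ _ → ≡.refl) (λ _ → ≡.refl)) ⟩
  (1ᶜ +ᶜ 1ᶜ) *ᶜ y              ≈⟨ ℂ′.distribʳ y 1ᶜ 1ᶜ ⟩
  1ᶜ *ᶜ y +ᶜ 1ᶜ *ᶜ y           ≈⟨ ℂ′.+-congˡ {1ᶜ *ᶜ y} (≃ᶜ-trans (ℂ′.*-identityˡ y) (≃ᶜ-sym -y≈y)) ⟩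
  1ᶜ *ᶜ y +ᶜ -1ᶜ *ᶜ y          ≈⟨ ℂ′.distribʳ y 1ᶜ -1ᶜ ⟨
  (1ᶜ +ᶜ -1ᶜ) *ᶜ y             ≈⟨ ℂ′.*-congʳ {y} {1ᶜ +ᶜ -1ᶜ} {0ᶜ} (≗⇒≃ᶜ (1ᶜ +ᶜ -1ᶜ) 0ᶜ (λ _ → ≡.refl) (λ _ → ≡.refl)) ⟩
  0ᶜ *ᶜ y                      ≈⟨ ℂ′.zeroˡ y ⟩
  0ᶜ                           ∎)
  where open SetoidReasoning ℂ′.setoid

-- Some power of z ^ r is z ^ (4 * odd) = −1 when 8 ∤ r.
z^-fixes⇒≈0 : ∀ r y → r % 8 ≢ 0 → z ℂ′.^ (r % 8) *ᶜ y ≃ᶜ y → y ≃ᶜ 0ᶜ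
z^-fixes⇒≈0 r y r≢0 fixes = by-residue (r % 8) (m%n<n r 8) r≢0 fixes
  where
  odd-power : ∀ k e m → k ℕ.* e ≡ 4 ℕ.* m → -1ᶜ ℂ′.^ m ≃ᶜ -1ᶜ → z ℂ′.^ k *ᶜ y ≃ᶜ y → y ≃ᶜ 0ᶜ
  odd-power k e m ke≡4m odd fixes = -1-fixes⇒≈0 y (≃ᶜ-trans (ℂ′.*-congʳ {y} (begin
    -1ᶜ                       ≈⟨ odd ⟨
    -1ᶜ ℂ′.^ m                ≈⟨ ℂ′.^-congˡ m z^4≈-1 ⟨
    (z ℂ′.^ 4) ℂ′.^ m         ≈⟨ ℂ′.^-assocʳ z 4 m ⟩
    z ℂ′.^ (4 ℕ.* m)          ≡⟨ ≡.cong (z ℂ′.^_) ke≡4m ⟨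
    z ℂ′.^ (k ℕ.* e)          ≈⟨ ℂ′.^-assocʳ z k e ⟨
    (z ℂ′.^ k) ℂ′.^ e         ∎)) (^-fixes (z ℂ′.^ k) y e fixes))
    where open SetoidReasoning ℂ′.setoid
  odd : ∀ m → -1ᶜ ℂ′.^ (1 ℕ.+ m ℕ.* 2) ≃ᶜ -1ᶜ
  odd m = begin
    -1ᶜ *ᶜ -1ᶜ ℂ′.^ (m ℕ.* 2)        ≡⟨ ≡.cong (λ e → -1ᶜ *ᶜ -1ᶜ ℂ′.^ e) (ℕ.*-comm m 2) ⟩
    -1ᶜ *ᶜ -1ᶜ ℂ′.^ (2 ℕ.* m)        ≈⟨ ℂ′.*-congˡ { -1ᶜ } (ℂ′.^-assocʳ -1ᶜ 2 m) ⟨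
    -1ᶜ *ᶜ (-1ᶜ ℂ′.^ 2) ℂ′.^ m       ≈⟨ ℂ′.*-congˡ { -1ᶜ } (ℂ′.^-congˡ m (≗⇒≃ᶜ (-1ᶜ ℂ′.^ 2) 1ᶜ (λ _ → ≡.refl) (λ _ → ≡.refl))) ⟩
    -1ᶜ *ᶜ 1ᶜ ℂ′.^ m                 ≈⟨ ℂ′.*-congˡ { -1ᶜ } (1^≈1 m) ⟩
    -1ᶜ *ᶜ 1ᶜ                        ≈⟨ ℂ′.*-identityʳ -1ᶜ ⟩
    -1ᶜ                              ∎
    where open SetoidReasoning ℂ′.setoid
  by-residue : ∀ k → k ℕ.< 8 → k ≢ 0 → z ℂ′.^ k *ᶜ y ≃ᶜ y → y ≃ᶜ 0ᶜ
  by-residue 0 _ 0≢0 = contradiction ≡.refl 0≢0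
  by-residue 1 _ _   = odd-power 1 4 1 ≡.refl (odd 0)
  by-residue 2 _ _   = odd-power 2 2 1 ≡.refl (odd 0)
  by-residue 3 _ _   = odd-power 3 4 3 ≡.refl (odd 1)
  by-residue 4 _ _   = odd-power 4 1 1 ≡.refl (odd 0)
  by-residue 5 _ _   = odd-power 5 4 5 ≡.refl (odd 2)
  by-residue 6 _ _   = odd-power 6 2 3 ≡.refl (odd 1)
  by-residue 7 _ _   = odd-power 7 4 7 ≡.refl (odd 3)
  by-residue (ℕ.suc (ℕ.suc (ℕ.suc (ℕ.suc (ℕ.suc (ℕ.suc (ℕ.suc (ℕ.suc k)))))))) k<8 = contradiction k<8 (ℕ.m+n≮m 8 k)

-- Invariance makes the coefficient at α a fixed point of multiplication by z to the weight of α, a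
-- nontrivial eighth root of unity when 8 does not divide the weight.
diagonal-kills : ∀ d k → (∀ i → d i ≃ᶜ z ℂ′.^ lookup k i) → ∀ f → diagonal d · f ≈ₚ f →
  ∀ α → weight k α % 8 ≢ 0 → coefficient f α ≃ᶜ 0ᶜ
diagonal-kills d k d≈ f fixed α 8∤weight = z^-fixes⇒≈0 (weight k α) (coefficient f α) 8∤weight (begin
  z ℂ′.^ (weight k α % 8) *ᶜ coefficient f α   ≈⟨ ℂ′.*-congʳ {coefficient f α} (power-diagonal d k d≈ α) ⟨
  ℂ′.power d α *ᶜ coefficient f α              ≈⟨ coefficient-diagonal d f α ⟨
  coefficient (diagonal d · f) α               ≈⟨ fixed α ⟩
  coefficient f α                              ∎)
  where open SetoidReasoning ℂ′.setoid

-- Linear relations imposed by X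

-- Evaluating X · f = f at an integer point q gives a linear relation between the
-- coefficients of f in which x^α has the coefficient (q′)^α − 4096 q^α, where q′ = rowsX q.
module ℤpow = Powers (Semiring.rawSemiring (CommutativeRing.semiring ℤ.+-*-commutativeRing))

imageX : Vec ℤ 6 → Fin 6 → ℤ
imageX q i = ℤsum (λ j → entries rowsX i j ℤ.* lookup q j)
  where open RawSemiringDefinitions (Semiring.rawSemiring (CommutativeRing.semiring ℤ.+-*-commutativeRing)) renaming (sum to ℤsum)

relationX : Vec ℤ 6 → Exponents → ℤ
relationX q α = ℤpow.power (imageX q) α ℤ.- + 4096 ℤ.* ℤpow.power (lookup q) α

combinationX : List (ℤ × Vec ℤ 6) → Exponents → ℤ
combinationX []             α = 0ℤ
combinationX ((k , q) ∷ qs) α = k ℤ.* relationX q α ℤ.+ combinationX qs α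

open SemiringHomomorphismLemmas (Semiring.rawSemiring (CommutativeRing.semiring ℤ.+-*-commutativeRing))
  (CommutativeRing.commutativeSemiring ℂ-commutativeRing) ℤ⇒ℂ-homo
module ℤ⇒ℂ = SemiringMorphisms.IsSemiringHomomorphism ℤ⇒ℂ-homo

id-homo : SemiringMorphisms.IsSemiringHomomorphism ℂ′.rawSemiring ℂ′.rawSemiring (λ x → x)
id-homo = Identity.isSemiringHomomorphism ℂ′.rawSemiring ≃ᶜ-refl

module Evalℂ = Evaluation ℂ-commutativeRing 6 (CommutativeRing.commutativeSemiring ℂ-commutativeRing) id-homo
open Evalℂ using (sumOver; sumOver-0; sumOver-cong; sumOver-+)

sumOver-* : ∀ x φ αs → sumOver (λ α → x *ᶜ φ α) αs ≃ᶜ x *ᶜ sumOver φ αs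
sumOver-* x φ []       = ≃ᶜ-sym (ℂ′.zeroʳ x)
sumOver-* x φ (α ∷ αs) = ≃ᶜ-trans (ℂ′.+-congˡ {x *ᶜ φ α} (sumOver-* x φ αs)) (≃ᶜ-sym (ℂ′.distribˡ x (φ α) (sumOver φ αs)))

sumOver-cong-∈ : ∀ {φ ψ} αs → (∀ {α} → α ∈ αs → φ α ≃ᶜ ψ α) → sumOver φ αs ≃ᶜ sumOver ψ αs
sumOver-cong-∈ []       φ≈ψ = ≃ᶜ-refl
sumOver-cong-∈ (α ∷ αs) φ≈ψ = ℂ′.+-cong (φ≈ψ (here ≡.refl)) (sumOver-cong-∈ αs (λ α∈αs → φ≈ψ (there α∈αs)))

-- Invariance under X reads f(q) = f(ξ q′). Both values are expanded over `αs`, and since each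
-- monomial there has degree 8, the factor ξ⁸ = 1/4096 can be moved to the other side. The
-- subtraction in `relationX` is avoided by adding the sum of the terms with 4096 q^α to both sides
-- and cancelling it at the end.
relationX-holds : ∀ f {αs} → X · f ≈ₚ f → Unique αs → (∀ {α} → α ∈ αs → Vec.sum α ≡ 8) →
  (∀ α → α ∉ αs → coefficient f α ≃ᶜ 0ᶜ) → ∀ q → sumOver (λ α → coefficient f α *ᶜ ℤ⇒ℂ (relationX q α)) αs ≃ᶜ 0ᶜ
relationX-holds f {αs} fixed αs! degree≡8 f≈0 q =
  +-cancelʳ (sumOver (λ α → c α *ᶜ ℤ⇒ℂ (N α)) αs) (sumOver (λ α → c α *ᶜ ℤ⇒ℂ (relationX q α)) αs) 0ᶜ (begin
    sumOver (λ α → c α *ᶜ ℤ⇒ℂ (relationX q α)) αs +ᶜ sumOver (λ α → c α *ᶜ ℤ⇒ℂ (N α)) αs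
      ≈⟨ sumOver-+ (λ α → c α *ᶜ ℤ⇒ℂ (relationX q α)) (λ α → c α *ᶜ ℤ⇒ℂ (N α)) αs ⟨
    sumOver (λ α → c α *ᶜ ℤ⇒ℂ (relationX q α) +ᶜ c α *ᶜ ℤ⇒ℂ (N α)) αs
      ≈⟨ sumOver-cong αs (λ α → begin
           c α *ᶜ ℤ⇒ℂ (relationX q α) +ᶜ c α *ᶜ ℤ⇒ℂ (N α)   ≈⟨ ℂ′.distribˡ (c α) (ℤ⇒ℂ (relationX q α)) (ℤ⇒ℂ (N α)) ⟨
           c α *ᶜ (ℤ⇒ℂ (relationX q α) +ᶜ ℤ⇒ℂ (N α))        ≈⟨ ℂ′.*-congˡ {c α} (ℤ⇒ℂ.+-homo (relationX q α) (N α)) ⟨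
           c α *ᶜ ℤ⇒ℂ (relationX q α ℤ.+ N α)               ≡⟨ ≡.cong (λ k → c α *ᶜ ℤ⇒ℂ k) (i-j+j≡i (ℤpow.power (imageX q) α) (N α)) ⟩
           c α *ᶜ ℤ⇒ℂ (ℤpow.power (imageX q) α)             ≈⟨ ℂ′.*-congˡ {c α} (power-homo (imageX q) α) ⟩
           c α *ᶜ ℂ′.power y′ α                             ∎) ⟩
    sumOver (λ α → c α *ᶜ ℂ′.power y′ α) αs
      ≈⟨ sumOver-cong-∈ αs (λ {α} α∈αs → begin
           c α *ᶜ ℂ′.power y′ α                             ≈⟨ rescaled α (degree≡8 α∈αs) ⟩
           ℤ⇒ℂ (+ 4096) *ᶜ (c α *ᶜ ℂ′.power (λ i → ξ *ᶜ y′ i) α)   ∎) ⟩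
    sumOver (λ α → ℤ⇒ℂ (+ 4096) *ᶜ (c α *ᶜ ℂ′.power (λ i → ξ *ᶜ y′ i) α)) αs
      ≈⟨ sumOver-* (ℤ⇒ℂ (+ 4096)) (λ α → c α *ᶜ ℂ′.power (λ i → ξ *ᶜ y′ i) α) αs ⟩
    ℤ⇒ℂ (+ 4096) *ᶜ sumOver (λ α → c α *ᶜ ℂ′.power (λ i → ξ *ᶜ y′ i) α) αs
      ≈⟨ ℂ′.*-congˡ {ℤ⇒ℂ (+ 4096)} (begin
           sumOver (λ α → c α *ᶜ ℂ′.power (λ i → ξ *ᶜ y′ i) α) αs
             ≈⟨ Evalℂ.extend-support (ℂ′.power λ i → ξ *ᶜ y′ i) f αs! f≈0 ⟨
           Evalℂ.evaluate (λ i → ξ *ᶜ y′ i) f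
             ≈⟨ Evalℂ.evaluate-cong f scaled ⟨
           Evalℂ.evaluate (λ i → ℂ′.sum λ j → X i j *ᶜ y j) f
             ≈⟨ Evalℂ.evaluate-· y X f ⟨
           Evalℂ.evaluate y (X · f)
             ≈⟨ Evalℂ.extend-congʳ (ℂ′.power y) (X · f) f fixed ⟩
           Evalℂ.evaluate y f
             ≈⟨ Evalℂ.extend-support (ℂ′.power y) f αs! f≈0 ⟩
           sumOver (λ α → c α *ᶜ ℂ′.power y α) αs   ∎) ⟩
    ℤ⇒ℂ (+ 4096) *ᶜ sumOver (λ α → c α *ᶜ ℂ′.power y α) αs
      ≈⟨ sumOver-* (ℤ⇒ℂ (+ 4096)) (λ α → c α *ᶜ ℂ′.power y α) αs ⟨
    sumOver (λ α → ℤ⇒ℂ (+ 4096) *ᶜ (c α *ᶜ ℂ′.power y α)) αs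
      ≈⟨ sumOver-cong αs (λ α → begin
           ℤ⇒ℂ (+ 4096) *ᶜ (c α *ᶜ ℂ′.power y α)        ≈⟨ ℂ′.x*yz≈y*xz (ℤ⇒ℂ (+ 4096)) (c α) (ℂ′.power y α) ⟩
           c α *ᶜ (ℤ⇒ℂ (+ 4096) *ᶜ ℂ′.power y α)        ≈⟨ ℂ′.*-congˡ {c α} (ℂ′.*-congˡ {ℤ⇒ℂ (+ 4096)} (power-homo (lookup q) α)) ⟨
           c α *ᶜ (ℤ⇒ℂ (+ 4096) *ᶜ ℤ⇒ℂ (ℤpow.power (lookup q) α))   ≈⟨ ℂ′.*-congˡ {c α} (ℤ⇒ℂ.*-homo (+ 4096) (ℤpow.power (lookup q) α)) ⟨
           c α *ᶜ ℤ⇒ℂ (N α)                             ∎) ⟩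
    sumOver (λ α → c α *ᶜ ℤ⇒ℂ (N α)) αs
      ≈⟨ ℂ′.+-identityˡ (sumOver (λ α → c α *ᶜ ℤ⇒ℂ (N α)) αs) ⟨
    0ᶜ +ᶜ sumOver (λ α → c α *ᶜ ℤ⇒ℂ (N α)) αs   ∎)
  where
  open SetoidReasoning ℂ′.setoid
  c = coefficient f
  N = λ α → + 4096 ℤ.* ℤpow.power (lookup q) α
  y = λ i → ℤ⇒ℂ (lookup q i)
  y′ = λ i → ℤ⇒ℂ (imageX q i)
  scaled : ∀ i → ℂ′.sum (λ j → X i j *ᶜ y j) ≃ᶜ ξ *ᶜ y′ i
  scaled i = begin
    ℂ′.sum (λ j → X i j *ᶜ y j)
      ≈⟨ ℂ′.sum-cong {x = λ j → X i j *ᶜ y j} {y = λ j → ξ *ᶜ ℤ⇒ℂ (entries rowsX i j ℤ.* lookup q j)} (λ j → begin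
           ξ *ᶜ ℤ⇒ℂ (entries rowsX i j) *ᶜ y j            ≈⟨ ℂ′.*-assoc ξ (ℤ⇒ℂ (entries rowsX i j)) (y j) ⟩
           ξ *ᶜ (ℤ⇒ℂ (entries rowsX i j) *ᶜ y j)          ≈⟨ ℂ′.*-congˡ {ξ} (ℤ⇒ℂ.*-homo (entries rowsX i j) (lookup q j)) ⟨
           ξ *ᶜ ℤ⇒ℂ (entries rowsX i j ℤ.* lookup q j)    ∎) ⟩
    ℂ′.sum (λ j → ξ *ᶜ ℤ⇒ℂ (entries rowsX i j ℤ.* lookup q j))
      ≈⟨ ℂ′.*-distribˡ-sum ξ (λ j → ℤ⇒ℂ (entries rowsX i j ℤ.* lookup q j)) ⟨
    ξ *ᶜ ℂ′.sum (λ j → ℤ⇒ℂ (entries rowsX i j ℤ.* lookup q j))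
      ≈⟨ ℂ′.*-congˡ {ξ} (sum-homo (λ j → entries rowsX i j ℤ.* lookup q j)) ⟨
    ξ *ᶜ y′ i   ∎
  rescaled : ∀ α → Vec.sum α ≡ 8 → c α *ᶜ ℂ′.power y′ α ≃ᶜ ℤ⇒ℂ (+ 4096) *ᶜ (c α *ᶜ ℂ′.power (λ i → ξ *ᶜ y′ i) α)
  rescaled α α≡8 = begin
    c α *ᶜ p                                                 ≈⟨ ℂ′.*-congˡ {c α} (begin
      p                                                        ≈⟨ ℂ′.*-identityˡ p ⟨
      1ᶜ *ᶜ p                                                  ≈⟨ ℂ′.*-congʳ {p} ξ^8*4096≈1 ⟨
      ξ ℂ′.^ 8 *ᶜ ℤ⇒ℂ (+ 4096) *ᶜ p                            ≈⟨ ℂ′.*-congʳ {p} (ℂ′.*-comm (ξ ℂ′.^ 8) (ℤ⇒ℂ (+ 4096))) ⟩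
      ℤ⇒ℂ (+ 4096) *ᶜ ξ ℂ′.^ 8 *ᶜ p                            ≈⟨ ℂ′.*-assoc (ℤ⇒ℂ (+ 4096)) (ξ ℂ′.^ 8) p ⟩
      ℤ⇒ℂ (+ 4096) *ᶜ (ξ ℂ′.^ 8 *ᶜ p)                          ≡⟨ ≡.cong (λ d → ℤ⇒ℂ (+ 4096) *ᶜ (ξ ℂ′.^ d *ᶜ p)) α≡8 ⟨
      ℤ⇒ℂ (+ 4096) *ᶜ (ξ ℂ′.^ Vec.sum α *ᶜ p)                  ≈⟨ ℂ′.*-congˡ {ℤ⇒ℂ (+ 4096)} (ℂ′.*-congʳ {p} (ℂ′.power-const ξ α)) ⟨
      ℤ⇒ℂ (+ 4096) *ᶜ (ℂ′.power (λ _ → ξ) α *ᶜ p)              ≈⟨ ℂ′.*-congˡ {ℤ⇒ℂ (+ 4096)} (ℂ′.power-* (λ _ → ξ) y′ α) ⟨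
      ℤ⇒ℂ (+ 4096) *ᶜ ℂ′.power (λ i → ξ *ᶜ y′ i) α             ∎) ⟩
    c α *ᶜ (ℤ⇒ℂ (+ 4096) *ᶜ ℂ′.power (λ i → ξ *ᶜ y′ i) α)    ≈⟨ ℂ′.x*yz≈y*xz (c α) (ℤ⇒ℂ (+ 4096)) (ℂ′.power (λ i → ξ *ᶜ y′ i) α) ⟩
    ℤ⇒ℂ (+ 4096) *ᶜ (c α *ᶜ ℂ′.power (λ i → ξ *ᶜ y′ i) α)    ∎
    where p = ℂ′.power y′ α

-- Elimination

-- Each step names a monomial and a combination of relations in which that
-- monomial occurs but none of the monomials of the later steps does.
Steps : Set
Steps = List (Exponents × List (ℤ × Vec ℤ 6))

Triangular : Steps → Set
Triangular []                = ⊤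
Triangular ((α , qs) ∷ steps) =
  combinationX qs α ≢ 0ℤ × All (λ β → combinationX qs β ≡ 0ℤ) (map proj₁ steps) × Triangular steps

triangular? : ∀ steps → Dec (Triangular steps)
triangular? []                 = yes tt
triangular? ((α , qs) ∷ steps) =
  ¬? (combinationX qs α ℤ.≟ 0ℤ) ×-dec All.all? (λ β → combinationX qs β ℤ.≟ 0ℤ) (map proj₁ steps) ×-dec triangular? steps

combinationX-holds : ∀ (c : Exponents → ℂ) αs → (∀ q → sumOver (λ α → c α *ᶜ ℤ⇒ℂ (relationX q α)) αs ≃ᶜ 0ᶜ) →
  ∀ qs → sumOver (λ α → c α *ᶜ ℤ⇒ℂ (combinationX qs α)) αs ≃ᶜ 0ᶜ
combinationX-holds c αs holds []             = sumOver-0 αs λ {α} _ → ℂ′.zeroʳ (c α)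
combinationX-holds c αs holds ((k , q) ∷ qs) = begin
  sumOver (λ α → c α *ᶜ ℤ⇒ℂ (k ℤ.* relationX q α ℤ.+ combinationX qs α)) αs
    ≈⟨ sumOver-cong αs (λ α → begin
         c α *ᶜ ℤ⇒ℂ (k ℤ.* relationX q α ℤ.+ combinationX qs α)
           ≈⟨ ℂ′.*-congˡ {c α} (ℤ⇒ℂ.+-homo (k ℤ.* relationX q α) (combinationX qs α)) ⟩
         c α *ᶜ (ℤ⇒ℂ (k ℤ.* relationX q α) +ᶜ ℤ⇒ℂ (combinationX qs α))
           ≈⟨ ℂ′.distribˡ (c α) (ℤ⇒ℂ (k ℤ.* relationX q α)) (ℤ⇒ℂ (combinationX qs α)) ⟩
         c α *ᶜ ℤ⇒ℂ (k ℤ.* relationX q α) +ᶜ c α *ᶜ ℤ⇒ℂ (combinationX qs α)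
           ≈⟨ ℂ′.+-congʳ {c α *ᶜ ℤ⇒ℂ (combinationX qs α)} (≃ᶜ-trans (ℂ′.*-congˡ {c α} (ℤ⇒ℂ.*-homo k (relationX q α)))
                (ℂ′.x*yz≈y*xz (c α) (ℤ⇒ℂ k) (ℤ⇒ℂ (relationX q α)))) ⟩
         ℤ⇒ℂ k *ᶜ (c α *ᶜ ℤ⇒ℂ (relationX q α)) +ᶜ c α *ᶜ ℤ⇒ℂ (combinationX qs α)   ∎) ⟩
  sumOver (λ α → ℤ⇒ℂ k *ᶜ (c α *ᶜ ℤ⇒ℂ (relationX q α)) +ᶜ c α *ᶜ ℤ⇒ℂ (combinationX qs α)) αs
    ≈⟨ sumOver-+ (λ α → ℤ⇒ℂ k *ᶜ (c α *ᶜ ℤ⇒ℂ (relationX q α))) (λ α → c α *ᶜ ℤ⇒ℂ (combinationX qs α)) αs ⟩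
  sumOver (λ α → ℤ⇒ℂ k *ᶜ (c α *ᶜ ℤ⇒ℂ (relationX q α))) αs +ᶜ sumOver (λ α → c α *ᶜ ℤ⇒ℂ (combinationX qs α)) αs
    ≈⟨ ℂ′.+-cong (≃ᶜ-trans (sumOver-* (ℤ⇒ℂ k) (λ α → c α *ᶜ ℤ⇒ℂ (relationX q α)) αs)
         (≃ᶜ-trans (ℂ′.*-congˡ {ℤ⇒ℂ k} (holds q)) (ℂ′.zeroʳ (ℤ⇒ℂ k)))) (combinationX-holds c αs holds qs) ⟩
  0ᶜ +ᶜ 0ᶜ
    ≈⟨ ℂ′.+-identityˡ 0ᶜ ⟩
  0ᶜ   ∎
  where open SetoidReasoning ℂ′.setoid

-- The combination of the first step retains only its own monomial, whose coefficient must therefore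
-- vanish. Deleting that monomial keeps the relations of all points valid on the remaining ones, so
-- every later step may again combine arbitrary points.
triangular-solve : ∀ (c : Exponents → ℂ) steps → Triangular steps →
  (∀ q → sumOver (λ α → c α *ᶜ ℤ⇒ℂ (relationX q α)) (map proj₁ steps) ≃ᶜ 0ᶜ) → ∀ {α} → α ∈ map proj₁ steps → c α ≃ᶜ 0ᶜ
triangular-solve c ((α , qs) ∷ steps) (pivot≢0 , rest≡0 , triangular) holds = λ
  { (here ≡.refl) → cα≈0
  ; (there β∈)    → triangular-solve c steps triangular later β∈ }
  where
  open SetoidReasoning ℂ′.setoid
  αs = map proj₁ steps
  cα≈0 : c α ≃ᶜ 0ᶜ
  cα≈0 = ℤ⇒ℂ-cancel (combinationX qs α) pivot≢0 (c α) (begin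
    ℤ⇒ℂ (combinationX qs α) *ᶜ c α
      ≈⟨ ℂ′.*-comm (ℤ⇒ℂ (combinationX qs α)) (c α) ⟩
    c α *ᶜ ℤ⇒ℂ (combinationX qs α)
      ≈⟨ ℂ′.+-identityʳ (c α *ᶜ ℤ⇒ℂ (combinationX qs α)) ⟨
    c α *ᶜ ℤ⇒ℂ (combinationX qs α) +ᶜ 0ᶜ
      ≈⟨ ℂ′.+-congˡ {c α *ᶜ ℤ⇒ℂ (combinationX qs α)} (sumOver-0 αs λ {β} β∈ →
           ≃ᶜ-trans (ℂ′.*-congˡ {c β} (ℂ′.reflexive (≡.cong ℤ⇒ℂ (All.lookup rest≡0 β∈)))) (ℂ′.zeroʳ (c β))) ⟨
    sumOver (λ β → c β *ᶜ ℤ⇒ℂ (combinationX qs β)) (α ∷ αs)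
      ≈⟨ combinationX-holds c (α ∷ αs) holds qs ⟩
    0ᶜ   ∎)
  later : ∀ q → sumOver (λ β → c β *ᶜ ℤ⇒ℂ (relationX q β)) αs ≃ᶜ 0ᶜ
  later q = begin
    sumOver (λ β → c β *ᶜ ℤ⇒ℂ (relationX q β)) αs
      ≈⟨ ℂ′.+-identityˡ (sumOver (λ β → c β *ᶜ ℤ⇒ℂ (relationX q β)) αs) ⟨
    0ᶜ +ᶜ sumOver (λ β → c β *ᶜ ℤ⇒ℂ (relationX q β)) αs
      ≈⟨ ℂ′.+-congʳ {sumOver (λ β → c β *ᶜ ℤ⇒ℂ (relationX q β)) αs}
           (≃ᶜ-trans (ℂ′.*-congʳ {ℤ⇒ℂ (relationX q α)} cα≈0) (ℂ′.zeroˡ (ℤ⇒ℂ (relationX q α)))) ⟨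
    sumOver (λ β → c β *ᶜ ℤ⇒ℂ (relationX q β)) (α ∷ αs)
      ≈⟨ holds q ⟩
    0ᶜ   ∎

-- The monomials f⁸ and a b⁴ c³. The entries of a word of 𝒦₈ are all even or all odd, so the second
-- monomial, which mixes both kinds, is absent from its enumerator; this makes the matrix of pivot
-- coefficients triangular.
pivot₁ pivot₂ : Exponents
pivot₁ = 0 ∷ 0 ∷ 0 ∷ 0 ∷ 0 ∷ 8 ∷ []
pivot₂ = 1 ∷ 4 ∷ 3 ∷ 0 ∷ 0 ∷ 0 ∷ []

-- Found by Gaussian elimination over relations at points with small coordinates.
certificate : Steps
certificate =
  ( (0 ∷ 0 ∷ 0 ∷ 8 ∷ 0 ∷ 0 ∷ [] ,
      -- The images of these two points differ only in the signs of b and e, which the remaining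
      -- monomials contain to an even total degree. In the difference e⁸ cancels too, so that only
      -- d⁸ and the pivot f⁸ are left, with opposite coefficients.
      (1ℤ , 0ℤ ∷ 0ℤ ∷ 0ℤ ∷ 0ℤ ∷ -1ℤ ∷ 2ℤ ∷ [])
      ∷ (-1ℤ , 0ℤ ∷ 0ℤ ∷ 0ℤ ∷ 2ℤ ∷ -1ℤ ∷ 0ℤ ∷ [])
      ∷ [])
  ∷ (0 ∷ 0 ∷ 8 ∷ 0 ∷ 0 ∷ 0 ∷ [] ,
      (1ℤ , 0ℤ ∷ 0ℤ ∷ 0ℤ ∷ 0ℤ ∷ -1ℤ ∷ 2ℤ ∷ [])
      ∷ (-1ℤ , 0ℤ ∷ -1ℤ ∷ 2ℤ ∷ 0ℤ ∷ 0ℤ ∷ 0ℤ ∷ [])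
      ∷ (-1ℤ , 0ℤ ∷ 0ℤ ∷ 2ℤ ∷ 0ℤ ∷ -1ℤ ∷ 0ℤ ∷ [])
      ∷ (1ℤ , 0ℤ ∷ -1ℤ ∷ 0ℤ ∷ 2ℤ ∷ 0ℤ ∷ 0ℤ ∷ [])
      ∷ [])
  ∷ (8 ∷ 0 ∷ 0 ∷ 0 ∷ 0 ∷ 0 ∷ [] ,
      (1ℤ , 0ℤ ∷ 1ℤ ∷ 2ℤ ∷ 0ℤ ∷ 1ℤ ∷ 2ℤ ∷ [])
      ∷ (+ 16 , 0ℤ ∷ -1ℤ ∷ 2ℤ ∷ 0ℤ ∷ 0ℤ ∷ 0ℤ ∷ [])
      ∷ [])
  ∷ (3 ∷ 4 ∷ 1 ∷ 0 ∷ 0 ∷ 0 ∷ [] ,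
      (-[1+ 122849 ] , 1ℤ ∷ 0ℤ ∷ 0ℤ ∷ 1ℤ ∷ 0ℤ ∷ 0ℤ ∷ [])
      ∷ (+ 2184 , 2ℤ ∷ 1ℤ ∷ 1ℤ ∷ 1ℤ ∷ 0ℤ ∷ 0ℤ ∷ [])
      ∷ (-[1+ 24 ] , + 3 ∷ 2ℤ ∷ 2ℤ ∷ 1ℤ ∷ 0ℤ ∷ 0ℤ ∷ [])
      ∷ (-[1+ 12 ] , 1ℤ ∷ 2ℤ ∷ 2ℤ ∷ -1ℤ ∷ 0ℤ ∷ 0ℤ ∷ [])
      ∷ [])
  ∷ (0 ∷ 8 ∷ 0 ∷ 0 ∷ 0 ∷ 0 ∷ [] ,
      (-[1+ 61424 ] , 0ℤ ∷ 1ℤ ∷ 2ℤ ∷ 0ℤ ∷ 1ℤ ∷ 2ℤ ∷ [])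
      ∷ (-[1+ 327599 ] , 0ℤ ∷ 1ℤ ∷ 2ℤ ∷ 0ℤ ∷ 0ℤ ∷ 0ℤ ∷ [])
      ∷ (+ 1248 , -1ℤ ∷ 1ℤ ∷ 2ℤ ∷ 0ℤ ∷ 0ℤ ∷ + 3 ∷ [])
      ∷ (+ 40950 , 0ℤ ∷ 1ℤ ∷ 0ℤ ∷ 0ℤ ∷ 1ℤ ∷ 0ℤ ∷ [])
      ∷ (+ 19219200 , 0ℤ ∷ 0ℤ ∷ 1ℤ ∷ 0ℤ ∷ 0ℤ ∷ 1ℤ ∷ [])
      ∷ (+ 78624 , 1ℤ ∷ -1ℤ ∷ 2ℤ ∷ 0ℤ ∷ 0ℤ ∷ 1ℤ ∷ [])
      ∷ (+ 800 , + 3 ∷ 2ℤ ∷ 2ℤ ∷ 1ℤ ∷ 0ℤ ∷ 0ℤ ∷ [])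
      ∷ (-[1+ 2079 ] , 1ℤ ∷ 2ℤ ∷ 2ℤ ∷ -1ℤ ∷ 0ℤ ∷ 0ℤ ∷ [])
      ∷ [])
  ∷ (0 ∷ 0 ∷ 0 ∷ 0 ∷ 8 ∷ 0 ∷ [] ,
      (1ℤ , 0ℤ ∷ -1ℤ ∷ 2ℤ ∷ 0ℤ ∷ 0ℤ ∷ 0ℤ ∷ [])
      ∷ (-1ℤ , 0ℤ ∷ 0ℤ ∷ 0ℤ ∷ 2ℤ ∷ -1ℤ ∷ 0ℤ ∷ [])
      ∷ [])
  ∷ (0 ∷ 4 ∷ 0 ∷ 0 ∷ 4 ∷ 0 ∷ [] ,
      (+ 16 , 0ℤ ∷ 0ℤ ∷ 0ℤ ∷ 2ℤ ∷ -1ℤ ∷ 0ℤ ∷ [])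
      ∷ (+ 256 , 0ℤ ∷ 0ℤ ∷ 1ℤ ∷ 0ℤ ∷ 0ℤ ∷ 1ℤ ∷ [])
      ∷ (-1ℤ , 0ℤ ∷ 1ℤ ∷ 0ℤ ∷ 0ℤ ∷ 1ℤ ∷ 0ℤ ∷ [])
      ∷ [])
  ∷ (0 ∷ 0 ∷ 4 ∷ 0 ∷ 0 ∷ 4 ∷ [] ,
      (1ℤ , 0ℤ ∷ 0ℤ ∷ 0ℤ ∷ 0ℤ ∷ -1ℤ ∷ 2ℤ ∷ [])
      ∷ [])
  ∷ (4 ∷ 0 ∷ 0 ∷ 4 ∷ 0 ∷ 0 ∷ [] ,
      (1ℤ , 0ℤ ∷ 0ℤ ∷ 0ℤ ∷ 0ℤ ∷ 1ℤ ∷ 2ℤ ∷ [])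
      ∷ [])
  ∷ (6 ∷ 0 ∷ 2 ∷ 0 ∷ 0 ∷ 0 ∷ [] ,
      (-[1+ 255 ] , 0ℤ ∷ 2ℤ ∷ 1ℤ ∷ 0ℤ ∷ 2ℤ ∷ 1ℤ ∷ [])
      ∷ (+ 16875 , 0ℤ ∷ 1ℤ ∷ 0ℤ ∷ 0ℤ ∷ 1ℤ ∷ 0ℤ ∷ [])
      ∷ (+ 13824 , + 3 ∷ 1ℤ ∷ 0ℤ ∷ + 3 ∷ 1ℤ ∷ 0ℤ ∷ [])
      ∷ [])
  ∷ (4 ∷ 0 ∷ 4 ∷ 0 ∷ 0 ∷ 0 ∷ [] ,
      (1ℤ , 0ℤ ∷ 1ℤ ∷ 1ℤ ∷ 0ℤ ∷ 1ℤ ∷ 1ℤ ∷ [])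
      ∷ (-[1+ 8 ] , 1ℤ ∷ 0ℤ ∷ 0ℤ ∷ 1ℤ ∷ 0ℤ ∷ 0ℤ ∷ [])
      ∷ [])
  ∷ (2 ∷ 0 ∷ 6 ∷ 0 ∷ 0 ∷ 0 ∷ [] ,
      (1ℤ , 0ℤ ∷ 1ℤ ∷ 0ℤ ∷ 0ℤ ∷ 1ℤ ∷ 0ℤ ∷ [])
      ∷ [])
  ∷ (2 ∷ 0 ∷ 2 ∷ 0 ∷ 0 ∷ 4 ∷ [] ,
      (1ℤ , 1ℤ ∷ -1ℤ ∷ 0ℤ ∷ 0ℤ ∷ 0ℤ ∷ -1ℤ ∷ [])
      ∷ [])
  ∷ (2 ∷ 0 ∷ 2 ∷ 4 ∷ 0 ∷ 0 ∷ [] ,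
      (1ℤ , 0ℤ ∷ 0ℤ ∷ 1ℤ ∷ -1ℤ ∷ -1ℤ ∷ 0ℤ ∷ [])
      ∷ [])
  ∷ (0 ∷ 0 ∷ 0 ∷ 4 ∷ 0 ∷ 4 ∷ [] ,
      (-[1+ 767 ] , 0ℤ ∷ 0ℤ ∷ 0ℤ ∷ 1ℤ ∷ 0ℤ ∷ -1ℤ ∷ [])
      ∷ (+ 30 , 0ℤ ∷ 0ℤ ∷ 0ℤ ∷ 1ℤ ∷ -1ℤ ∷ 1ℤ ∷ [])
      ∷ (1ℤ , 0ℤ ∷ 0ℤ ∷ 0ℤ ∷ -1ℤ ∷ 1ℤ ∷ + 3 ∷ [])
      ∷ (1ℤ , 0ℤ ∷ 0ℤ ∷ 0ℤ ∷ + 3 ∷ 1ℤ ∷ -1ℤ ∷ [])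
      ∷ [])
  ∷ (0 ∷ 0 ∷ 0 ∷ 6 ∷ 0 ∷ 2 ∷ [] ,
      (+ 153 , 0ℤ ∷ 0ℤ ∷ 0ℤ ∷ 1ℤ ∷ 0ℤ ∷ -1ℤ ∷ [])
      ∷ (-1ℤ , 0ℤ ∷ 0ℤ ∷ 0ℤ ∷ + 3 ∷ 2ℤ ∷ 1ℤ ∷ [])
      ∷ (-[1+ 15 ] , 0ℤ ∷ 0ℤ ∷ 0ℤ ∷ + 3 ∷ 1ℤ ∷ -1ℤ ∷ [])
      ∷ [])
  ∷ (0 ∷ 0 ∷ 0 ∷ 2 ∷ 0 ∷ 6 ∷ [] ,
      (1ℤ , 0ℤ ∷ 0ℤ ∷ 0ℤ ∷ 1ℤ ∷ 0ℤ ∷ -1ℤ ∷ [])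
      ∷ [])
  ∷ (0 ∷ 0 ∷ 0 ∷ 1 ∷ 4 ∷ 3 ∷ [] ,
      (+ 3 , 0ℤ ∷ 0ℤ ∷ 0ℤ ∷ 1ℤ ∷ -1ℤ ∷ 1ℤ ∷ [])
      ∷ (1ℤ , 0ℤ ∷ 0ℤ ∷ 0ℤ ∷ -1ℤ ∷ -1ℤ ∷ + 3 ∷ [])
      ∷ [])
  ∷ (0 ∷ 0 ∷ 0 ∷ 3 ∷ 4 ∷ 1 ∷ [] ,
      (1ℤ , 0ℤ ∷ 0ℤ ∷ 0ℤ ∷ 1ℤ ∷ 2ℤ ∷ + 3 ∷ [])
      ∷ [])
  ∷ (0 ∷ 0 ∷ 4 ∷ 2 ∷ 0 ∷ 2 ∷ [] ,
      (1ℤ , 0ℤ ∷ 0ℤ ∷ 1ℤ ∷ 1ℤ ∷ -1ℤ ∷ 0ℤ ∷ [])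
      ∷ [])
  ∷ (4 ∷ 0 ∷ 0 ∷ 2 ∷ 0 ∷ 2 ∷ [] ,
      (1ℤ , 1ℤ ∷ 0ℤ ∷ 0ℤ ∷ 2ℤ ∷ + 3 ∷ + 3 ∷ [])
      ∷ [])
  ∷ (1 ∷ 2 ∷ 1 ∷ 2 ∷ 2 ∷ 0 ∷ [] ,
      (+ 10 , 1ℤ ∷ + 3 ∷ 1ℤ ∷ 0ℤ ∷ 2ℤ ∷ 0ℤ ∷ [])
      ∷ (+ 17 , 2ℤ ∷ 0ℤ ∷ -1ℤ ∷ + 3 ∷ 1ℤ ∷ 0ℤ ∷ [])
      ∷ (-[1+ 14 ] , 0ℤ ∷ 2ℤ ∷ 1ℤ ∷ -1ℤ ∷ 1ℤ ∷ 0ℤ ∷ [])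
      ∷ (-[1+ 15 ] , 1ℤ ∷ 1ℤ ∷ 2ℤ ∷ -1ℤ ∷ -1ℤ ∷ 0ℤ ∷ [])
      ∷ (1ℤ , 2ℤ ∷ 2ℤ ∷ 1ℤ ∷ 1ℤ ∷ 1ℤ ∷ 0ℤ ∷ [])
      ∷ [])
  ∷ (3 ∷ 0 ∷ 1 ∷ 0 ∷ 4 ∷ 0 ∷ [] ,
      (+ 16 , 0ℤ ∷ 0ℤ ∷ -1ℤ ∷ -1ℤ ∷ 1ℤ ∷ 2ℤ ∷ [])
      ∷ (-1ℤ , -1ℤ ∷ 1ℤ ∷ 1ℤ ∷ 2ℤ ∷ 2ℤ ∷ 0ℤ ∷ [])
      ∷ [])
  ∷ (1 ∷ 0 ∷ 3 ∷ 0 ∷ 4 ∷ 0 ∷ [] ,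
      (-[1+ 14 ] , -1ℤ ∷ 0ℤ ∷ 0ℤ ∷ 1ℤ ∷ 2ℤ ∷ 2ℤ ∷ [])
      ∷ (-[1+ 14 ] , 0ℤ ∷ 0ℤ ∷ 1ℤ ∷ 2ℤ ∷ 0ℤ ∷ -1ℤ ∷ [])
      ∷ (-1ℤ , 1ℤ ∷ 0ℤ ∷ + 3 ∷ 0ℤ ∷ 1ℤ ∷ 2ℤ ∷ [])
      ∷ [])
  ∷ (0 ∷ 0 ∷ 4 ∷ 4 ∷ 0 ∷ 0 ∷ [] ,
      (1ℤ , 1ℤ ∷ 0ℤ ∷ 0ℤ ∷ -1ℤ ∷ -1ℤ ∷ 0ℤ ∷ [])
      ∷ [])
  ∷ (4 ∷ 0 ∷ 0 ∷ 0 ∷ 0 ∷ 4 ∷ [] ,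
      (1ℤ , 1ℤ ∷ 0ℤ ∷ 0ℤ ∷ 1ℤ ∷ -1ℤ ∷ 2ℤ ∷ [])
      ∷ [])
  ∷ (0 ∷ 4 ∷ 0 ∷ 3 ∷ 0 ∷ 1 ∷ [] ,
      (+ 5 , 1ℤ ∷ 0ℤ ∷ + 3 ∷ 0ℤ ∷ + 3 ∷ 2ℤ ∷ [])
      ∷ (-[1+ 2047 ] , 0ℤ ∷ 1ℤ ∷ -1ℤ ∷ 2ℤ ∷ 0ℤ ∷ 1ℤ ∷ [])
      ∷ [])
  ∷ (0 ∷ 4 ∷ 0 ∷ 1 ∷ 0 ∷ 3 ∷ [] ,
      (1ℤ , 2ℤ ∷ 2ℤ ∷ + 3 ∷ -1ℤ ∷ 0ℤ ∷ 0ℤ ∷ [])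
      ∷ [])
  ∷ (0 ∷ 1 ∷ 1 ∷ 3 ∷ 3 ∷ 0 ∷ [] ,
      (-1ℤ , 0ℤ ∷ 2ℤ ∷ -1ℤ ∷ -1ℤ ∷ -1ℤ ∷ 0ℤ ∷ [])
      ∷ (+ 8 , 0ℤ ∷ 0ℤ ∷ 2ℤ ∷ 0ℤ ∷ -1ℤ ∷ 0ℤ ∷ [])
      ∷ [])
  ∷ (0 ∷ 3 ∷ 3 ∷ 1 ∷ 1 ∷ 0 ∷ [] ,
      (1ℤ , 0ℤ ∷ -1ℤ ∷ + 3 ∷ + 3 ∷ -1ℤ ∷ 0ℤ ∷ [])
      ∷ [])
  ∷ (2 ∷ 3 ∷ 1 ∷ 1 ∷ 1 ∷ 0 ∷ [] ,
      (1ℤ , 0ℤ ∷ -1ℤ ∷ -1ℤ ∷ 0ℤ ∷ 1ℤ ∷ + 3 ∷ [])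
      ∷ [])
  ∷ (3 ∷ 3 ∷ 0 ∷ 0 ∷ 1 ∷ 1 ∷ [] ,
      (-[1+ 80 ] , 1ℤ ∷ -1ℤ ∷ 0ℤ ∷ 0ℤ ∷ 2ℤ ∷ 1ℤ ∷ [])
      ∷ (-[1+ 7 ] , + 3 ∷ -1ℤ ∷ 0ℤ ∷ 0ℤ ∷ -1ℤ ∷ + 3 ∷ [])
      ∷ [])
  ∷ (1 ∷ 1 ∷ 0 ∷ 0 ∷ 3 ∷ 3 ∷ [] ,
      (1ℤ , -1ℤ ∷ 1ℤ ∷ 0ℤ ∷ 0ℤ ∷ + 3 ∷ + 3 ∷ [])
      ∷ [])
  ∷ (2 ∷ 2 ∷ 0 ∷ 1 ∷ 2 ∷ 1 ∷ [] ,
      (1ℤ , 1ℤ ∷ 2ℤ ∷ 0ℤ ∷ 2ℤ ∷ 1ℤ ∷ 1ℤ ∷ [])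
      ∷ (+ 4 , 1ℤ ∷ 1ℤ ∷ 0ℤ ∷ 0ℤ ∷ 1ℤ ∷ + 3 ∷ [])
      ∷ [])
  ∷ (1 ∷ 1 ∷ 0 ∷ 2 ∷ 3 ∷ 1 ∷ [] ,
      (1ℤ , 0ℤ ∷ 1ℤ ∷ 1ℤ ∷ 0ℤ ∷ 1ℤ ∷ + 3 ∷ [])
      ∷ [])
  ∷ (1 ∷ 3 ∷ 2 ∷ 0 ∷ 1 ∷ 1 ∷ [] ,
      (-[1+ 7 ] , 1ℤ ∷ 1ℤ ∷ 2ℤ ∷ 0ℤ ∷ 1ℤ ∷ + 3 ∷ [])
      ∷ (+ 9 , 2ℤ ∷ 1ℤ ∷ 0ℤ ∷ -1ℤ ∷ + 3 ∷ -1ℤ ∷ [])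
      ∷ [])
  ∷ (1 ∷ 2 ∷ 1 ∷ 0 ∷ 2 ∷ 2 ∷ [] ,
      (1ℤ , 2ℤ ∷ -1ℤ ∷ + 3 ∷ 0ℤ ∷ 0ℤ ∷ + 3 ∷ [])
      ∷ [])
  ∷ (0 ∷ 2 ∷ 2 ∷ 1 ∷ 2 ∷ 1 ∷ [] ,
      (-[1+ 11 ] , 0ℤ ∷ 2ℤ ∷ -1ℤ ∷ 2ℤ ∷ -1ℤ ∷ 1ℤ ∷ [])
      ∷ (1ℤ , 0ℤ ∷ 1ℤ ∷ + 3 ∷ 2ℤ ∷ 2ℤ ∷ -1ℤ ∷ [])
      ∷ [])
  ∷ (0 ∷ 1 ∷ 1 ∷ 1 ∷ 3 ∷ 2 ∷ [] ,
      (1ℤ , 0ℤ ∷ -1ℤ ∷ 2ℤ ∷ 1ℤ ∷ -1ℤ ∷ 1ℤ ∷ [])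
      ∷ [])
  ∷ (1 ∷ 0 ∷ 3 ∷ 1 ∷ 0 ∷ 3 ∷ [] ,
      (+ 1825 , 1ℤ ∷ -1ℤ ∷ 2ℤ ∷ 2ℤ ∷ 1ℤ ∷ + 3 ∷ [])
      ∷ (-[1+ 2783 ] , 2ℤ ∷ 1ℤ ∷ + 3 ∷ 1ℤ ∷ -1ℤ ∷ 2ℤ ∷ [])
      ∷ (+ 63 , 1ℤ ∷ 1ℤ ∷ 2ℤ ∷ 2ℤ ∷ -1ℤ ∷ + 3 ∷ [])
      ∷ (+ 728 , 2ℤ ∷ -1ℤ ∷ 1ℤ ∷ 2ℤ ∷ 1ℤ ∷ + 3 ∷ [])
      ∷ [])
  ∷ (3 ∷ 0 ∷ 1 ∷ 3 ∷ 0 ∷ 1 ∷ [] ,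
      (+ 15 , 2ℤ ∷ 0ℤ ∷ 2ℤ ∷ 1ℤ ∷ 0ℤ ∷ -1ℤ ∷ [])
      ∷ (1ℤ , 2ℤ ∷ -1ℤ ∷ + 3 ∷ 2ℤ ∷ 1ℤ ∷ 1ℤ ∷ [])
      ∷ [])
  ∷ (3 ∷ 0 ∷ 1 ∷ 1 ∷ 0 ∷ 3 ∷ [] ,
      (-[1+ 2 ] , 2ℤ ∷ 0ℤ ∷ 2ℤ ∷ 1ℤ ∷ 0ℤ ∷ -1ℤ ∷ [])
      ∷ (-1ℤ , 2ℤ ∷ 1ℤ ∷ 1ℤ ∷ 2ℤ ∷ -1ℤ ∷ + 3 ∷ [])
      ∷ [])
  ∷ (1 ∷ 0 ∷ 3 ∷ 3 ∷ 0 ∷ 1 ∷ [] ,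
      (1ℤ , 2ℤ ∷ -1ℤ ∷ 1ℤ ∷ 2ℤ ∷ 1ℤ ∷ + 3 ∷ [])
      ∷ [])
  ∷ (2 ∷ 0 ∷ 2 ∷ 2 ∷ 0 ∷ 2 ∷ [] ,
      (1ℤ , 2ℤ ∷ 1ℤ ∷ 0ℤ ∷ 2ℤ ∷ -1ℤ ∷ 2ℤ ∷ [])
      ∷ [])
  ∷ [])

certificate-triangular : Triangular certificate
certificate-triangular = decided (triangular? certificate) ≡.refl

-- The surviving monomials and the bound on the dimension

monomials : List Exponents
monomials = pivot₁ ∷ pivot₂ ∷ map proj₁ certificate

exponentsOfDegree : ∀ n → ℕ → List (Vec ℕ n)
exponentsOfDegree ℕ.zero    ℕ.zero    = [] ∷ []
exponentsOfDegree ℕ.zero    (ℕ.suc d) = []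
exponentsOfDegree (ℕ.suc n) d         = concatMap (λ i → map (i ∷_) (exponentsOfDegree n (d ℕ.∸ i))) (upTo (ℕ.suc d))

∈-exponentsOfDegree : ∀ {n} (α : Vec ℕ n) {d} → Vec.sum α ≡ d → α ∈ exponentsOfDegree n d
∈-exponentsOfDegree []      ≡.refl = here ≡.refl
∈-exponentsOfDegree (i ∷ α) ≡.refl = ∈-concatMap⁺ _ (lose (∈-upTo⁺ (ℕ.s≤s (ℕ.m≤m+n i (Vec.sum α))))
  (∈-map⁺ (i ∷_) (∈-exponentsOfDegree α (≡.sym (ℕ.m+n∸m≡n i (Vec.sum α))))))

open DecMembership (_≟ₑ_ {6}) using (_∈?_)

-- A finite check over the 1287 exponent vectors of degree 8 in six variables.
monomials-complete : All (λ α → weight k₁ α % 8 ≡ 0 → weight k₂ α % 8 ≡ 0 → α ∈ monomials) (exponentsOfDegree 6 8)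
monomials-complete = decided (All.all? (λ α →
  (weight k₁ α % 8 ℕ.≟ 0) →-dec ((weight k₂ α % 8 ℕ.≟ 0) →-dec (α ∈? monomials))) (exponentsOfDegree 6 8)) ≡.refl

monomials-unique : Unique monomials
monomials-unique = decided (AllPairs.allPairs? (λ α β → ¬? (α ≟ₑ β)) monomials) ≡.refl

monomials-degree : All (λ α → Vec.sum α ≡ 8) monomials
monomials-degree = decided (All.all? (λ α → Vec.sum α ℕ.≟ 8) monomials) ≡.refl

off-monomials : ∀ f → InvariantRing H f → IsHomogeneous 8 f → ∀ α → α ∉ monomials → coefficient f α ≃ᶜ 0ᶜ
off-monomials f fixed homogeneous α α∉monomials with Vec.sum α ℕ.≟ 8
... | no  α≢8 = homogeneous α α≢8
... | yes α≡8 with weight k₁ α % 8 ℕ.≟ 0 | weight k₂ α % 8 ℕ.≟ 0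
... | no 8∤weight₁  | _             = diagonal-kills diagonal₁ k₁ diagonal₁≈ f (fixed E₁ (generated 3F)) α 8∤weight₁
... | yes _         | no 8∤weight₂  = diagonal-kills diagonal₂ k₂ diagonal₂≈ f (fixed E₂ (generated 4F)) α 8∤weight₂
... | yes 8∣weight₁ | yes 8∣weight₂ =
  contradiction (All.lookup monomials-complete (∈-exponentsOfDegree α α≡8) 8∣weight₁ 8∣weight₂) α∉monomials

-- With both pivots zero, each relation loses its two pivot terms and becomes a relation among the
-- monomials of `certificate`, to which the elimination applies.
pivots-determine : ∀ f → HomogeneousInvariant H 8 f → coefficient f pivot₁ ≃ᶜ 0ᶜ → coefficient f pivot₂ ≃ᶜ 0ᶜ → f ≈ₚ 0ₚ
pivots-determine f (fixed , homogeneous) pivot₁≈0 pivot₂≈0 α with α ∈? monomials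
... | no  α∉monomials          = off-monomials f fixed homogeneous α α∉monomials
... | yes (here ≡.refl)         = pivot₁≈0
... | yes (there (here ≡.refl)) = pivot₂≈0
... | yes (there (there α∈))    = triangular-solve (coefficient f) certificate certificate-triangular
  (λ q → ≃ᶜ-trans (≃ᶜ-sym (drop-pivots q)) (relationX-holds f (fixed X (generated 0F)) monomials-unique
    (All.lookup monomials-degree) (off-monomials f fixed homogeneous) q)) α∈
  where
  drop : ∀ c x y → c ≃ᶜ 0ᶜ → c *ᶜ x +ᶜ y ≃ᶜ y
  drop c x y c≈0 = ≃ᶜ-trans (ℂ′.+-congʳ {y} (≃ᶜ-trans (ℂ′.*-congʳ {x} c≈0) (ℂ′.zeroˡ x))) (ℂ′.+-identityˡ y)
  drop-pivots : ∀ q → sumOver (λ α → coefficient f α *ᶜ ℤ⇒ℂ (relationX q α)) monomials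
    ≃ᶜ sumOver (λ α → coefficient f α *ᶜ ℤ⇒ℂ (relationX q α)) (map proj₁ certificate)
  drop-pivots q = ≃ᶜ-trans
    (drop (coefficient f pivot₁) (ℤ⇒ℂ (relationX q pivot₁)) (sumOver relation (pivot₂ ∷ map proj₁ certificate)) pivot₁≈0)
    (drop (coefficient f pivot₂) (ℤ⇒ℂ (relationX q pivot₂)) (sumOver relation (map proj₁ certificate)) pivot₂≈0)
    where relation = λ α → coefficient f α *ᶜ ℤ⇒ℂ (relationX q α)

-- Linear combinations of invariants, independence and spanning

+ₚ-closed : ∀ {d f g} → HomogeneousInvariant H d f → HomogeneousInvariant H d g → HomogeneousInvariant H d (f +ₚ g)
+ₚ-closed {f = f} {g} (f-fixed , f-homogeneous) (g-fixed , g-homogeneous) =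
  (λ A HA → Polyℂ.trans {A · (f +ₚ g)} {A · f +ₚ A · g} {f +ₚ g} (·-+ₚ A f g)
    (+ₚ-cong {A · f} {f} {A · g} {g} (f-fixed A HA) (g-fixed A HA))) ,
  λ α α≢d → ≃ᶜ-trans (coefficient-+ₚ f g α)
    (≃ᶜ-trans (ℂ′.+-cong (f-homogeneous α α≢d) (g-homogeneous α α≢d)) (ℂ′.+-identityˡ 0ᶜ))

∙ₚ-closed : ∀ {d f} a → HomogeneousInvariant H d f → HomogeneousInvariant H d (a ∙ₚ f)
∙ₚ-closed {f = f} a (f-fixed , f-homogeneous) =
  (λ A HA → Polyℂ.trans {A · (a ∙ₚ f)} {a ∙ₚ (A · f)} {a ∙ₚ f} (·-∙ₚ A a f) (∙ₚ-cong {a} {a} {A · f} {f} ≃ᶜ-refl (f-fixed A HA))) ,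
  λ α α≢d → ≃ᶜ-trans (coefficient-∙ₚ a f α) (≃ᶜ-trans (ℂ′.*-congˡ {a} (f-homogeneous α α≢d)) (ℂ′.zeroʳ a))

certified-invariant : ∀ {w W} → Certified w → W ≈ₚ embed w → HomogeneousInvariant H 8 W
certified-invariant {w} {W} certified W≈w =
  (λ A HA → begin
    A · W         ≈⟨ ·-congʳ A {W} {embed w} W≈w ⟩
    A · embed w   ≈⟨ certified-fixed certified A HA ⟩
    embed w       ≈⟨ W≈w ⟨
    W             ∎) ,
  λ α α≢8 → ≃ᶜ-trans (W≈w α) (embed-homogeneous (Certified.homogeneous certified) α α≢8)
  where open SetoidReasoning Polyℂ.setoid

coefficient-at : ∀ {w W} α k → W ≈ₚ embed w → ℤₚ.coefficient 6 w α ≡ k → coefficient W α ≃ᶜ ℤ⇒ℂ k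
coefficient-at {w} α k W≈w w[α]≡k = ≃ᶜ-trans (W≈w α)
  (≃ᶜ-trans (coefficient-embed w α) (ℂ′.reflexive (≡.cong ℤ⇒ℂ w[α]≡k)))

-- At pivot₁ both polynomials have coefficient 1, at pivot₂ they have 96 and 0.
basis : ∀ {W₁ W₂} → W₁ ≈ₚ embed w₁ → W₂ ≈ₚ embed w₂ → IsBasisOf (HomogeneousInvariant H 8) (lookup (W₁ ∷ W₂ ∷ []))
basis {W₁} {W₂} W₁≈w₁ W₂≈w₂ = record
  { belongs     = λ { 0F → W₁-invariant ; 1F → W₂-invariant }
  ; independent = λ a combination≈0 → λ
      { 0F → a₀≈0 a combination≈0
      ; 1F → a₁≈0 a combination≈0 }
  ; spanning    = λ f f-invariant → coordinates f , spans f f-invariant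
  }
  where
  open SetoidReasoning ℂ′.setoid
  W₁-invariant : HomogeneousInvariant H 8 W₁
  W₁-invariant = certified-invariant {w₁} {W₁} w₁-certified W₁≈w₁
  W₂-invariant : HomogeneousInvariant H 8 W₂
  W₂-invariant = certified-invariant {w₂} {W₂} w₂-certified W₂≈w₂

  -- The linear combination as the sum over `Fin 2` unfolds, with its final `0ₚ`.
  Σ : (Fin 2 → ℂ) → Poly
  Σ a = a 0F ∙ₚ W₁ +ₚ (a 1F ∙ₚ W₂ +ₚ 0ₚ)

  coefficient-Σ : ∀ a α → coefficient (Σ a) α ≃ᶜ a 0F *ᶜ coefficient W₁ α +ᶜ a 1F *ᶜ coefficient W₂ α
  coefficient-Σ a α = begin
    coefficient (Σ a) α
      ≈⟨ coefficient-+ₚ (a 0F ∙ₚ W₁) (a 1F ∙ₚ W₂ +ₚ 0ₚ) α ⟩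
    coefficient (a 0F ∙ₚ W₁) α +ᶜ coefficient (a 1F ∙ₚ W₂ +ₚ 0ₚ) α
      ≈⟨ ℂ′.+-cong (coefficient-∙ₚ (a 0F) W₁ α) (≃ᶜ-trans (coefficient-+ₚ (a 1F ∙ₚ W₂) 0ₚ α)
           (≃ᶜ-trans (ℂ′.+-identityʳ (coefficient (a 1F ∙ₚ W₂) α)) (coefficient-∙ₚ (a 1F) W₂ α))) ⟩
    a 0F *ᶜ coefficient W₁ α +ᶜ a 1F *ᶜ coefficient W₂ α   ∎

  at-pivot₁ : ∀ a → coefficient (Σ a) pivot₁ ≃ᶜ a 0F +ᶜ a 1F
  at-pivot₁ a = begin
    coefficient (Σ a) pivot₁
      ≈⟨ coefficient-Σ a pivot₁ ⟩
    a 0F *ᶜ coefficient W₁ pivot₁ +ᶜ a 1F *ᶜ coefficient W₂ pivot₁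
      ≈⟨ ℂ′.+-cong
           (≃ᶜ-trans (ℂ′.*-congˡ {a 0F} (coefficient-at {w₁} {W₁} pivot₁ 1ℤ W₁≈w₁ ≡.refl)) (ℂ′.*-identityʳ (a 0F)))
           (≃ᶜ-trans (ℂ′.*-congˡ {a 1F} (coefficient-at {w₂} {W₂} pivot₁ 1ℤ W₂≈w₂ ≡.refl)) (ℂ′.*-identityʳ (a 1F))) ⟩
    a 0F +ᶜ a 1F   ∎

  at-pivot₂ : ∀ a → coefficient (Σ a) pivot₂ ≃ᶜ ℤ⇒ℂ (+ 96) *ᶜ a 0F
  at-pivot₂ a = begin
    coefficient (Σ a) pivot₂
      ≈⟨ coefficient-Σ a pivot₂ ⟩
    a 0F *ᶜ coefficient W₁ pivot₂ +ᶜ a 1F *ᶜ coefficient W₂ pivot₂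
      ≈⟨ ℂ′.+-cong
           (≃ᶜ-trans (ℂ′.*-congˡ {a 0F} (coefficient-at {w₁} {W₁} pivot₂ (+ 96) W₁≈w₁ ≡.refl)) (ℂ′.*-comm (a 0F) (ℤ⇒ℂ (+ 96))))
           (≃ᶜ-trans (ℂ′.*-congˡ {a 1F} (coefficient-at {w₂} {W₂} pivot₂ 0ℤ W₂≈w₂ ≡.refl)) (ℂ′.zeroʳ (a 1F))) ⟩
    ℤ⇒ℂ (+ 96) *ᶜ a 0F +ᶜ 0ᶜ
      ≈⟨ ℂ′.+-identityʳ (ℤ⇒ℂ (+ 96) *ᶜ a 0F) ⟩
    ℤ⇒ℂ (+ 96) *ᶜ a 0F   ∎

  a₀≈0 : ∀ a → Σ a ≈ₚ 0ₚ → a 0F ≃ᶜ 0ᶜ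
  a₀≈0 a Σ≈0 = ℤ⇒ℂ-cancel (+ 96) (λ ()) (a 0F) (≃ᶜ-trans (≃ᶜ-sym (at-pivot₂ a)) (Σ≈0 pivot₂))

  a₁≈0 : ∀ a → Σ a ≈ₚ 0ₚ → a 1F ≃ᶜ 0ᶜ
  a₁≈0 a Σ≈0 = begin
    a 1F            ≈⟨ ℂ′.+-identityˡ (a 1F) ⟨
    0ᶜ +ᶜ a 1F      ≈⟨ ℂ′.+-congʳ {a 1F} (a₀≈0 a Σ≈0) ⟨
    a 0F +ᶜ a 1F    ≈⟨ at-pivot₁ a ⟨
    coefficient (Σ a) pivot₁   ≈⟨ Σ≈0 pivot₁ ⟩
    0ᶜ              ∎

  -- The solution of the triangular system in which 96 a₀ is the coefficient at `pivot₂` and a₀ + a₁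
  -- the one at `pivot₁`.
  coordinates : Poly → Fin 2 → ℂ
  coordinates f 0F = ℚ⇒ℂ (1ℤ ℚ./ 96) *ᶜ coefficient f pivot₂
  coordinates f 1F = coefficient f pivot₁ +ᶜ -1ᶜ *ᶜ coordinates f 0F

  -- The difference of `f` and the combination is again a homogeneous invariant of degree 8 and
  -- vanishes at both pivots, hence everywhere.
  spans : ∀ f → HomogeneousInvariant H 8 f → f ≈ₚ Σ (coordinates f)
  spans f f-invariant α = begin
    coefficient f α
      ≈⟨ ℂ′.+-identityʳ (coefficient f α) ⟨
    coefficient f α +ᶜ 0ᶜ
      ≈⟨ ℂ′.+-congˡ {coefficient f α} (cancel (coefficient (Σ a) α)) ⟨
    coefficient f α +ᶜ (-1ᶜ *ᶜ coefficient (Σ a) α +ᶜ coefficient (Σ a) α)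
      ≈⟨ ℂ′.+-assoc (coefficient f α) (-1ᶜ *ᶜ coefficient (Σ a) α) (coefficient (Σ a) α) ⟨
    coefficient f α +ᶜ -1ᶜ *ᶜ coefficient (Σ a) α +ᶜ coefficient (Σ a) α
      ≈⟨ ℂ′.+-congʳ {coefficient (Σ a) α} (≃ᶜ-trans (≃ᶜ-sym (coefficient-difference α))
           (pivots-determine difference difference-invariant pivot₁-agrees pivot₂-agrees α)) ⟩
    0ᶜ +ᶜ coefficient (Σ a) α
      ≈⟨ ℂ′.+-identityˡ (coefficient (Σ a) α) ⟩
    coefficient (Σ a) α   ∎
    where
    a = coordinates f
    cancel : ∀ x → -1ᶜ *ᶜ x +ᶜ x ≃ᶜ 0ᶜ
    cancel x = ≃ᶜ-trans (ℂ′.+-congʳ {x} (-1*x≈-x x)) (+ᶜ-inverseˡ x)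
    difference : Poly
    difference = f +ₚ -1ᶜ ∙ₚ Σ a
    coefficient-difference : ∀ α → coefficient difference α ≃ᶜ coefficient f α +ᶜ -1ᶜ *ᶜ coefficient (Σ a) α
    coefficient-difference α = ≃ᶜ-trans (coefficient-+ₚ f (-1ᶜ ∙ₚ Σ a) α) (ℂ′.+-congˡ {coefficient f α} (coefficient-∙ₚ -1ᶜ (Σ a) α))
    0ₚ-invariant : HomogeneousInvariant H 8 0ₚ
    0ₚ-invariant = (λ A HA → Polyℂ.refl {0ₚ}) , λ α α≢8 → ≃ᶜ-refl
    difference-invariant : HomogeneousInvariant H 8 difference
    difference-invariant = +ₚ-closed {8} {f} { -1ᶜ ∙ₚ Σ a} f-invariant (∙ₚ-closed {8} {Σ a} -1ᶜ
      (+ₚ-closed {8} {a 0F ∙ₚ W₁} {a 1F ∙ₚ W₂ +ₚ 0ₚ} (∙ₚ-closed {8} {W₁} (a 0F) W₁-invariant)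
        (+ₚ-closed {8} {a 1F ∙ₚ W₂} {0ₚ} (∙ₚ-closed {8} {W₂} (a 1F) W₂-invariant) 0ₚ-invariant)))
    agrees : ∀ α → coefficient (Σ a) α ≃ᶜ coefficient f α → coefficient difference α ≃ᶜ 0ᶜ
    agrees α Σ≈f = ≃ᶜ-trans (coefficient-difference α) (≃ᶜ-trans (ℂ′.+-congʳ { -1ᶜ *ᶜ coefficient (Σ a) α} (≃ᶜ-sym Σ≈f))
      (≃ᶜ-trans (ℂ′.+-comm (coefficient (Σ a) α) (-1ᶜ *ᶜ coefficient (Σ a) α)) (cancel (coefficient (Σ a) α))))
    pivot₁-agrees : coefficient difference pivot₁ ≃ᶜ 0ᶜ
    pivot₁-agrees = agrees pivot₁ (begin
      coefficient (Σ a) pivot₁                               ≈⟨ at-pivot₁ a ⟩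
      a 0F +ᶜ (coefficient f pivot₁ +ᶜ -1ᶜ *ᶜ a 0F)          ≈⟨ ℂ′.+-comm (a 0F) (coefficient f pivot₁ +ᶜ -1ᶜ *ᶜ a 0F) ⟩
      coefficient f pivot₁ +ᶜ -1ᶜ *ᶜ a 0F +ᶜ a 0F            ≈⟨ ℂ′.+-assoc (coefficient f pivot₁) (-1ᶜ *ᶜ a 0F) (a 0F) ⟩
      coefficient f pivot₁ +ᶜ (-1ᶜ *ᶜ a 0F +ᶜ a 0F)          ≈⟨ ℂ′.+-congˡ {coefficient f pivot₁} (cancel (a 0F)) ⟩
      coefficient f pivot₁ +ᶜ 0ᶜ                             ≈⟨ ℂ′.+-identityʳ (coefficient f pivot₁) ⟩
      coefficient f pivot₁                                   ∎)
    pivot₂-agrees : coefficient difference pivot₂ ≃ᶜ 0ᶜ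
    pivot₂-agrees = agrees pivot₂ (begin
      coefficient (Σ a) pivot₂                                         ≈⟨ at-pivot₂ a ⟩
      ℤ⇒ℂ (+ 96) *ᶜ (ℚ⇒ℂ (1ℤ ℚ./ 96) *ᶜ coefficient f pivot₂)          ≈⟨ ℂ′.*-assoc (ℤ⇒ℂ (+ 96)) (ℚ⇒ℂ (1ℤ ℚ./ 96)) (coefficient f pivot₂) ⟨
      ℤ⇒ℂ (+ 96) *ᶜ ℚ⇒ℂ (1ℤ ℚ./ 96) *ᶜ coefficient f pivot₂            ≈⟨ ℂ′.*-congʳ {coefficient f pivot₂} {ℤ⇒ℂ (+ 96) *ᶜ ℚ⇒ℂ (1ℤ ℚ./ 96)} {1ᶜ}
                                                                            (≗⇒≃ᶜ (ℤ⇒ℂ (+ 96) *ᶜ ℚ⇒ℂ (1ℤ ℚ./ 96)) 1ᶜ (λ _ → ≡.refl) (λ _ → ≡.refl)) ⟩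
      1ᶜ *ᶜ coefficient f pivot₂                                       ≈⟨ ℂ′.*-identityˡ (coefficient f pivot₂) ⟩
      coefficient f pivot₂                                             ∎)

theorem3p2 : IsBasisOf (HomogeneousInvariant H 8) (lookup (weightEnumerator ℰ₈ 𝒬₈ ∷ weightEnumerator ℰ₈ 𝒦₈ ∷ []))
theorem3p2 = basis {weightEnumerator ℰ₈ 𝒬₈} {weightEnumerator ℰ₈ 𝒦₈} weightEnumerator𝒬₈ weightEnumerator𝒦₈
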